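{- Let $P$ be a $2$-neighborly $6$-dimensional convex polytope. Then $f_5(P) \ge f_0(P)$. Moreover, the equality $f_5(P) = f_0(P)$ holds if and only if $P$ is a simplex or $P$ is a dual $2$-neighborly polytope with $f_0(P) \ge 27$.
   Context: $f_i(P)$ denotes the number of $i$-dimensional faces of $P$ (so $f_0$ is the number of vertices and $f_5$ the number of facets of a $6$-polytope). A polytope is $2$-neighborly if every pair of its vertices forms an edge ($1$-face). A polytope is dual $2$-neighborly if its polar (dual) polytope is $2$-neighborly, i.e. every two facets intersect in a common ridge (face of dimension $d-2$). -}

module Defs where

open import Level using (Level; _⊔_) renaming (suc to lsuc)
open import Data.Nat using (ℕ; zero; suc)
open import Data.Fin using (Fin; zero; suc)
open import Data.Product using (Σ; ∃; _×_; _,_)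
open import Data.Sum using (_⊎_)
open import Data.List using (List; length)
open import Data.List.Relation.Unary.Unique.Propositional using (Unique)
import Data.List.Membership.Propositional as LM
open import Data.Fin.Subset using (Subset; _∈_; _∉_; ⊤; _∪_; _∩_)
open import Relation.Nullary using (¬_)
open import Relation.Binary.PropositionalEquality using (_≡_)
open import Function.Bundles using (_⇔_)
open import Algebra.Bundles using (CommutativeRing)
open import Relation.Binary.Structures using (IsStrictTotalOrder)

-- Ordered fields (the ambient coordinate field; ℝ is an instance).

record OrderedField (c ℓ₁ ℓ₂ : Level) : Set (lsuc (c ⊔ ℓ₁ ⊔ ℓ₂)) where
  field
    commutativeRing : CommutativeRing c ℓ₁
  open CommutativeRing commutativeRing public
  field
    _<_                 : Carrier → Carrier → Set ℓ₂
    isStrictTotalOrder  : IsStrictTotalOrder _≈_ _<_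
    0≉1                 : ¬ (0# ≈ 1#)
    inverse             : ∀ x → ¬ (x ≈ 0#) → ∃ λ y → x * y ≈ 1#
    +-monoˡ-<           : ∀ {x y} z → x < y → (x + z) < (y + z)
    *-pos               : ∀ {x y} → 0# < x → 0# < y → 0# < (x * y)

  _≤_ : Carrier → Carrier → Set (ℓ₁ ⊔ ℓ₂)
  x ≤ y = (x < y) ⊎ (x ≈ y)

module Polytopes {c ℓ₁ ℓ₂} (F : OrderedField c ℓ₁ ℓ₂) where
  open OrderedField F hiding (zero)

  ∑ : ∀ {m} → (Fin m → Carrier) → Carrier
  ∑ {zero}  f = 0#
  ∑ {suc m} f = f zero + ∑ (λ i → f (suc i))

  Point : ℕ → Set c
  Point d = Fin d → Carrier

  _·_ : ∀ {d} → Point d → Point d → Carrier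
  a · x = ∑ (λ k → a k * x k)

  AffinelyIndependent : ∀ {d m} → (Fin m → Point d) → Set (c ⊔ ℓ₁)
  AffinelyIndependent {d} {m} p =
    (λ' : Fin m → Carrier) →
    ∑ λ' ≈ 0# →
    (∀ (k : Fin d) → ∑ (λ i → λ' i * p i k) ≈ 0#) →
    ∀ i → λ' i ≈ 0#

  -- A polytope given by its list of vertices v : Fin n → Point d,
  -- P = conv {v i}.  Convex position: no v i lies in the convex hull
  -- of the other v j, so the v i are exactly the vertices of P.
  ConvexPosition : ∀ {d n} → (Fin n → Point d) → Set (c ⊔ ℓ₁ ⊔ ℓ₂)
  ConvexPosition {d} {n} v = ∀ i → ¬ (Σ (Fin n → Carrier) λ μ →
      (μ i ≈ 0#) × (∀ j → 0# ≤ μ j) × (∑ μ ≈ 1#) ×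
      (∀ (k : Fin d) → ∑ (λ j → μ j * v j k) ≈ v i k))

  module _ {d n : ℕ} (v : Fin n → Point d) where

    AffDim : Subset n → ℕ → Set (c ⊔ ℓ₁)
    AffDim S k =
      (Σ (Fin (suc k) → Fin n) λ g → (∀ i → g i ∈ S) × AffinelyIndependent (λ i → v (g i)))
      × ((g : Fin (suc (suc k)) → Fin n) → (∀ i → g i ∈ S) → ¬ AffinelyIndependent (λ i → v (g i)))

    -- S is the vertex set of a (nonempty) face of P: it is cut out by a
    -- valid inequality a·x ≤ b that is tight exactly at the vertices in S.
    IsFaceSet : Subset n → Set (c ⊔ ℓ₁ ⊔ ℓ₂)
    IsFaceSet S = Σ (Point d) λ a → Σ Carrier λ b →
      (∀ j → j ∈ S → (a · v j) ≈ b) × (∀ j → j ∉ S → (a · v j) < b)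

    IsFace : ℕ → Subset n → Set (c ⊔ ℓ₁ ⊔ ℓ₂)
    IsFace i S = IsFaceSet S × AffDim S i

    NumFaces : ℕ → ℕ → Set (c ⊔ ℓ₁ ⊔ ℓ₂)
    NumFaces i m = Σ (List (Subset n)) λ L →
      Unique L × (length L ≡ m) × (∀ S → (IsFace i S ⇔ (S LM.∈ L)))

    HasDim : ℕ → Set (c ⊔ ℓ₁)
    HasDim d' = AffDim ⊤ d'

    IsSimplex : Set (c ⊔ ℓ₁)
    IsSimplex = AffinelyIndependent v

    TwoNeighborly : Set (c ⊔ ℓ₁ ⊔ ℓ₂)
    TwoNeighborly = ∀ S T → IsFace 0 S → IsFace 0 T → ¬ (S ≡ T) → IsFace 1 (S ∪ T)

    DualTwoNeighborly : ℕ → Set (c ⊔ ℓ₁ ⊔ ℓ₂)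
    DualTwoNeighborly D = ∀ S T → IsFace (D Data.Nat.∸ 1) S → IsFace (D Data.Nat.∸ 1) T →
      ¬ (S ≡ T) → IsFace (D Data.Nat.∸ 2) (S ∩ T)

{-# OPTIONS --safe #-}

-- Let aᵣ be the number of faces of dimension r - 1.  All 2- and 3-faces of P are simplices and every 2-face lies in
-- at least four 3-faces, so a₃ ≤ a₄; with a₂ = C(a₁, 2), a₅ ≤ C(a₆, 2) and Euler's relation this gives a₁ ≤ a₆, and
-- equality forces any two facets to meet in a ridge.  If both P and its dual are 2-neighborly, with n facets and n
-- vertices, then Euler's relation in the intervals of the face lattice determines, for a facet with m vertices, the
-- first two moments of the numbers k of vertices of its n - 1 ridges; moreover every vertex lies in exactly m facets
-- and 10 ≤ 2k ≤ m + 4.  This leaves n = 7, n ≥ 27, or (m, n) one of (11, 20), (12, 23), (12, 24).  The first and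
-- last are excluded because distinct ridges of a facet share at most four vertices, and (12, 23) by a Bonferroni
-- inequality for the number of common vertices of two ridges.
--
-- Euler's relation for an interval [A , B] comes from the fan of cones of functionals vanishing on A according to
-- the face on which they are minimal, relative to a functional exposing A: cutting an open cone by a hyperplane
-- does not change its signed count.
module Submission where

open import Defs
import Level

-- The combinatorial half works with an abstract graded poset whose axioms are self-dual, so each
-- count for vertices and edges is also one for facets and ridges. For a facet with m vertices and s
-- = n - 1 ridges, put y = k - 5 ≥ 0. The sums of y and of y² depend on m and s only, so y ≤ y² and
-- (y - 1)(y - 2) ≥ 0 bound s from below, and y² ≤ Ky for y ≤ K bounds it from above. For m ≥ 13
-- this already gives n ≥ 27. The three exceptional pairs satisfy all these inequalities; only the
-- way in which ridges overlap can exclude them.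
--
-- The geometric half has to work over any ordered field, hence without topology. Let p expose A,
-- and scale the vectors off A to p = 1. If y vanishes on A, subtracting from y its minimum over the
-- vectors of B off A, times p, gives a functional that exposes within B a face C strictly above A.
-- So the functionals vanishing on A are partitioned according to C, and the part of C has
-- codimension ρ C - 1. Comparing signed counts of the parts and of the whole is Euler's relation
-- for the interval. As linear systems are decidable, the faces can be listed.

module Combinatorics where

  open import Data.Nat
  open import Data.Nat.Properties
  open import Data.Bool using (true; false; if_then_else_)
  open import Data.Fin using (Fin; zero; suc)
  import Data.Fin.Properties as FinP
  open import Data.Product
  open import Data.Sum using (_⊎_; inj₁; inj₂; [_,_]′)
  open import Relation.Nullary
  open import Relation.Binary.PropositionalEquality hiding (J)
  open import Function using (_∘_)
  open import Algebra.Properties.Semiring.Sum +-*-semiring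
    using (sum; sum-cong-≗; sum-replicate-zero; ∑-distrib-+; ∑-comm; *-distribˡ-sum; *-distribʳ-sum)
  open import Data.Nat.Tactic.RingSolver using (solve-∀)

  private
    variable
      n : ℕ

  -- Indicator sums and Eulerian posets of rank 7

  ⟦_⟧ : ∀ {a} {A : Set a} → Dec A → ℕ
  ⟦ yes _ ⟧ = 1
  ⟦ no  _ ⟧ = 0

  ⟦⟧-yes : ∀ {a} {A : Set a} (d : Dec A) → A → ⟦ d ⟧ ≡ 1
  ⟦⟧-yes (yes _) _ = refl
  ⟦⟧-yes (no ¬p) p = contradiction p ¬p

  ⟦⟧-no : ∀ {a} {A : Set a} (d : Dec A) → ¬ A → ⟦ d ⟧ ≡ 0
  ⟦⟧-no (yes p) ¬p = contradiction p ¬p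
  ⟦⟧-no (no _)  _  = refl

  sum-mono : {f g : Fin n → ℕ} → (∀ i → f i ≤ g i) → sum f ≤ sum g
  sum-mono {zero}  h = z≤n
  sum-mono {suc n} h = +-mono-≤ (h zero) (sum-mono (h ∘ suc))

  sum-zero : {f : Fin n → ℕ} → (∀ i → f i ≡ 0) → sum f ≡ 0
  sum-zero {n} h = trans (sum-cong-≗ h) (sum-replicate-zero n)

  sum-single : (f : Fin n → ℕ) (a : Fin n) → (∀ z → z ≢ a → f z ≡ 0) → sum f ≡ f a
  sum-single {suc n} f zero h =
    trans (cong (f zero +_) (sum-zero (λ i → h (suc i) λ ()))) (+-identityʳ _)
  sum-single {suc n} f (suc a) h = trans (cong (_+ sum (f ∘ suc)) (h zero λ ()))
    (sum-single (f ∘ suc) a (λ z z≢a → h (suc z) (z≢a ∘ FinP.suc-injective)))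

  module _ {N : ℕ} {_⊑_ : Fin N → Fin N → Set} (_⊑?_ : ∀ x y → Dec (x ⊑ y)) (ρ : Fin N → ℕ) where

    inInterval : Fin N → Fin N → ℕ → Fin N → ℕ
    inInterval A B r z = ⟦ A ⊑? z ⟧ * ⟦ z ⊑? B ⟧ * ⟦ ρ z ≟ r ⟧

    countIn : Fin N → Fin N → ℕ → ℕ
    countIn A B r = sum (inInterval A B r)

  -- For a finite bounded poset `between` says that it is a lattice; unlike meets and joins it is self-dual.
  record EulerianPoset : Set₁ where
    infix 4 _⊑_
    field
      N        : ℕ
      _⊑_      : Fin N → Fin N → Set
      _⊑?_     : ∀ x y → Dec (x ⊑ y)
      ⊑-refl   : ∀ {x} → x ⊑ x
      ⊑-trans  : ∀ {x y z} → x ⊑ y → y ⊑ z → x ⊑ z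
      ρ        : Fin N → ℕ
      ρ-strict : ∀ {x y} → x ⊑ y → x ≢ y → ρ x < ρ y
      bot top  : Fin N
      bot-min  : ∀ x → bot ⊑ x
      top-max  : ∀ x → x ⊑ top
      ρ-bot    : ρ bot ≡ 0
      ρ-top    : ρ top ≡ 7
      between  : ∀ {x y a b} → x ⊑ a → x ⊑ b → y ⊑ a → y ⊑ b →
                 ∃ λ z → x ⊑ z × y ⊑ z × z ⊑ a × z ⊑ b
      -- With `ρ-strict` this makes the poset graded: repeated use reaches an element of rank one
      -- below that of `y`, see `coatom`.
      dense    : ∀ {x y} → x ⊑ y → 2 + ρ x ≤ ρ y → ∃ λ z → x ⊑ z × z ⊑ y × ρ x < ρ z × ρ z < ρ y
      euler    : ∀ {x y} → x ⊑ y → x ≢ y → let c = countIn _⊑?_ ρ x y in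
                 c 0 + c 2 + c 4 + c 6 ≡ c 1 + c 3 + c 5 + c 7

  -- Makes Euler's relation compute, for literal a and b, to an equation between the unknown counts.
  forced : ℕ → ℕ → (ℕ → ℕ) → ℕ → ℕ
  forced a b c r = if r <ᵇ a then 0 else if r ≡ᵇ a then 1 else
                   if r ≡ᵇ b then 1 else if b <ᵇ r then 0 else c r

  -- Counting elements and flags in intervals

  module Intervals (P : EulerianPoset) where
    open EulerianPoset P

    X : Set
    X = Fin N

    W : X → X → ℕ → X → ℕ
    W = inInterval _⊑?_ ρ

    c : X → X → ℕ → ℕ
    c = countIn _⊑?_ ρ

    S : X → X → ℕ → (X → ℕ) → ℕ
    S A B r f = sum (λ z → W A B r z * f z)

    antisym : ∀ {x y} → x ⊑ y → y ⊑ x → x ≡ y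
    antisym {x} {y} p q with x FinP.≟ y
    ... | yes e = e
    ... | no x≢y = contradiction (<-trans (ρ-strict p x≢y) (ρ-strict q (x≢y ∘ sym))) (<-irrefl refl)

    ρ-mono : ∀ {x y} → x ⊑ y → ρ x ≤ ρ y
    ρ-mono {x} {y} p with x FinP.≟ y
    ... | yes refl = ≤-refl
    ... | no x≢y = <⇒≤ (ρ-strict p x≢y)

    same-rank : ∀ {x y} → x ⊑ y → ρ y ≤ ρ x → x ≡ y
    same-rank {x} {y} p q with x FinP.≟ y
    ... | yes e = e
    ... | no x≢y = contradiction (ρ-strict p x≢y) (≤⇒≯ q)

    ρ≢ : ∀ {x y} → ρ x < ρ y → x ≢ y
    ρ≢ p refl = <-irrefl refl p

    -- Each case carries the value of `W` as an equation, so that one case analysis settles both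
    -- membership in the interval and its indicator.
    data View (A B : X) (r : ℕ) (z : X) : Set where
      in-  : A ⊑ z → z ⊑ B → ρ z ≡ r → W A B r z ≡ 1 → View A B r z
      out- : ¬ (A ⊑ z × z ⊑ B × ρ z ≡ r) → W A B r z ≡ 0 → View A B r z

    view : ∀ A B r z → View A B r z
    view A B r z with A ⊑? z in e₁ | z ⊑? B in e₂ | ρ z ≟ r in e₃
    ... | yes p | yes q | yes s = in- p q s (cong₂ _*_ (cong₂ _*_ (cong ⟦_⟧ e₁) (cong ⟦_⟧ e₂)) (cong ⟦_⟧ e₃))
    ... | no ¬p | _ | _ = out- (¬p ∘ proj₁) (cong (λ t → ⟦ t ⟧ * ⟦ z ⊑? B ⟧ * ⟦ ρ z ≟ r ⟧) e₁)
    ... | yes _ | no ¬q | _ = out- (¬q ∘ proj₁ ∘ proj₂)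
            (trans (cong (λ t → ⟦ A ⊑? z ⟧ * ⟦ t ⟧ * ⟦ ρ z ≟ r ⟧) e₂) (cong (_* ⟦ ρ z ≟ r ⟧) (*-zeroʳ ⟦ A ⊑? z ⟧)))
    ... | yes _ | yes _ | no ¬s = out- (¬s ∘ proj₂ ∘ proj₂)
            (trans (cong (λ t → ⟦ A ⊑? z ⟧ * ⟦ z ⊑? B ⟧ * ⟦ t ⟧) e₃) (*-zeroʳ (⟦ A ⊑? z ⟧ * ⟦ z ⊑? B ⟧)))

    W-yes : ∀ {A B r z} → A ⊑ z → z ⊑ B → ρ z ≡ r → W A B r z ≡ 1
    W-yes {A} {B} {r} {z} p q s with view A B r z
    ... | in- _ _ _ e = e
    ... | out- n _ = contradiction (p , q , s) n

    W-no : ∀ {A B r z} → ¬ (A ⊑ z × z ⊑ B × ρ z ≡ r) → W A B r z ≡ 0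
    W-no {A} {B} {r} {z} n with view A B r z
    ... | in- p q s _ = contradiction (p , q , s) n
    ... | out- _ e = e

    S-cong : ∀ {A B r} {f g : X → ℕ} → (∀ {z} → A ⊑ z → z ⊑ B → ρ z ≡ r → f z ≡ g z) → S A B r f ≡ S A B r g
    S-cong {A} {B} {r} {f} {g} h = sum-cong-≗ pt
      where
      pt : ∀ z → W A B r z * f z ≡ W A B r z * g z
      pt z with view A B r z
      ... | in- p q s _ = cong (W A B r z *_) (h p q s)
      ... | out- _ e rewrite e = refl

    S-mono : ∀ {A B r} {f g : X → ℕ} → (∀ {z} → A ⊑ z → z ⊑ B → ρ z ≡ r → f z ≤ g z) → S A B r f ≤ S A B r g
    S-mono {A} {B} {r} {f} {g} h = sum-mono pt
      where
      pt : ∀ z → W A B r z * f z ≤ W A B r z * g z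
      pt z with view A B r z
      ... | in- p q s _ = *-monoʳ-≤ (W A B r z) (h p q s)
      ... | out- _ e rewrite e = ≤-refl

    S-const : ∀ A B r k → S A B r (λ _ → k) ≡ c A B r * k
    S-const A B r k = sym (*-distribʳ-sum k (W A B r))

    S-one : ∀ A B r → S A B r (λ _ → 1) ≡ c A B r
    S-one A B r = trans (S-const A B r 1) (*-identityʳ _)

    S-+ : ∀ A B r f g → S A B r (λ z → f z + g z) ≡ S A B r f + S A B r g
    S-+ A B r f g = trans (sum-cong-≗ (λ z → *-distribˡ-+ (W A B r z) (f z) (g z)))
                          (∑-distrib-+ (λ z → W A B r z * f z) (λ z → W A B r z * g z))

    S-*ˡ : ∀ A B r k f → S A B r (λ z → k * f z) ≡ k * S A B r f
    S-*ˡ A B r k f = trans (sum-cong-≗ (λ z → exch (W A B r z) k (f z)))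
                           (sym (*-distribˡ-sum k (λ z → W A B r z * f z)))
      where
      exch : ∀ a b d → a * (b * d) ≡ b * (a * d)
      exch = solve-∀

    private
      flag-pt : ∀ A B r₁ r₂ x y → W A B r₁ x * W x B r₂ y ≡ W A B r₂ y * W A y r₁ x
      flag-pt A B r₁ r₂ x y with view A B r₁ x | view x B r₂ y
      ... | in- p q s e₁ | in- p′ q′ s′ e₂ rewrite e₁ | e₂ | W-yes {A} {B} {r₂} {y} (⊑-trans p p′) q′ s′ | W-yes {A} {y} {r₁} {x} p p′ s = refl
      ... | in- p q s e₁ | out- n e₂ rewrite e₁ | e₂ with view A B r₂ y | view A y r₁ x
      ...   | in- _ q″ s″ _ | in- _ q‴ _ _ = contradiction (q‴ , q″ , s″) n
      ...   | out- _ e | _ rewrite e = refl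
      ...   | in- _ _ _ e | out- _ e′ rewrite e | e′ = refl
      flag-pt A B r₁ r₂ x y | out- n e₁ | v rewrite e₁ with view A B r₂ y | view A y r₁ x
      ...   | in- _ q _ _ | in- p q′ s _ = contradiction (p , ⊑-trans q′ q , s) n
      ...   | out- _ e | _ rewrite e = refl
      ...   | in- _ _ _ e | out- _ e′ rewrite e | e′ = refl

    -- Double counting of the pairs x ⊑ y of ranks `r₁` and `r₂` in the interval: choose x and then
    -- y above it, or y and then x below it.
    flags : ∀ A B r₁ r₂ (g : X → X → ℕ) →
            S A B r₁ (λ x → S x B r₂ (g x)) ≡ S A B r₂ (λ y → S A y r₁ (λ x → g x y))
    flags A B r₁ r₂ g = begin
      sum (λ x → W A B r₁ x * sum (λ y → W x B r₂ y * g x y))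
        ≡⟨ sum-cong-≗ (λ x → *-distribˡ-sum (W A B r₁ x) (λ y → W x B r₂ y * g x y)) ⟩
      sum (λ x → sum (λ y → W A B r₁ x * (W x B r₂ y * g x y)))
        ≡⟨ ∑-comm (λ x y → W A B r₁ x * (W x B r₂ y * g x y)) ⟩
      sum (λ y → sum (λ x → W A B r₁ x * (W x B r₂ y * g x y)))
        ≡⟨ sum-cong-≗ (λ y → sum-cong-≗ (λ x → pt x y)) ⟩
      sum (λ y → sum (λ x → W A B r₂ y * (W A y r₁ x * g x y)))
        ≡⟨ sum-cong-≗ (λ y → sym (*-distribˡ-sum (W A B r₂ y) (λ x → W A y r₁ x * g x y))) ⟩
      sum (λ y → W A B r₂ y * sum (λ x → W A y r₁ x * g x y)) ∎
      where
      open ≡-Reasoning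
      pt : ∀ x y → W A B r₁ x * (W x B r₂ y * g x y) ≡ W A B r₂ y * (W A y r₁ x * g x y)
      pt x y = trans (sym (*-assoc (W A B r₁ x) (W x B r₂ y) (g x y)))
              (trans (cong (_* g x y) (flag-pt A B r₁ r₂ x y)) (*-assoc (W A B r₂ y) (W A y r₁ x) (g x y)))

    flags-const : ∀ A B r₁ r₂ α β →
      (∀ {x} → A ⊑ x → x ⊑ B → ρ x ≡ r₁ → c x B r₂ ≡ α) →
      (∀ {y} → A ⊑ y → y ⊑ B → ρ y ≡ r₂ → c A y r₁ ≡ β) →
      c A B r₁ * α ≡ c A B r₂ * β
    flags-const A B r₁ r₂ α β hα hβ = begin
      c A B r₁ * α ≡⟨ sym (S-const A B r₁ α) ⟩
      S A B r₁ (λ _ → α) ≡⟨ S-cong (λ p q s → sym (trans (S-one _ B r₂) (hα p q s))) ⟩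
      S A B r₁ (λ x → S x B r₂ (λ _ → 1)) ≡⟨ flags A B r₁ r₂ (λ _ _ → 1) ⟩
      S A B r₂ (λ y → S A y r₁ (λ _ → 1)) ≡⟨ S-cong (λ p q s → trans (S-one A _ r₁) (hβ p q s)) ⟩
      S A B r₂ (λ _ → β) ≡⟨ S-const A B r₂ β ⟩
      c A B r₂ * β ∎
      where open ≡-Reasoning

    c-zero : ∀ {A B r} → (∀ {z} → A ⊑ z → z ⊑ B → ρ z ≢ r) → c A B r ≡ 0
    c-zero {A} {B} {r} h = sum-zero (λ z → W-no {A} {B} {r} {z} (λ (p , q , s) → h p q s))

    c-lo : ∀ {A B} → A ⊑ B → c A B (ρ A) ≡ 1
    c-lo {A} {B} p = trans (sum-single _ A λ z z≢A → W-no λ (p′ , _ , s) → z≢A (sym (same-rank p′ (≤-reflexive s))))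
                           (W-yes ⊑-refl p refl)

    c-hi : ∀ {A B} → A ⊑ B → c A B (ρ B) ≡ 1
    c-hi {A} {B} p = trans (sum-single _ B λ z z≢B → W-no λ (_ , q , s) → z≢B (same-rank q (≤-reflexive (sym s))))
                           (W-yes p ⊑-refl refl)

    c-forced : ∀ {A B} → A ⊑ B → ∀ r → c A B r ≡ forced (ρ A) (ρ B) (c A B) r
    c-forced {A} {B} p r with r <ᵇ ρ A in e₁
    ... | true = c-zero λ p′ _ s → <⇒≱ (<ᵇ⇒< r (ρ A) (subst Data.Bool.T (sym e₁) _)) (subst (ρ A ≤_) s (ρ-mono p′))
    ... | false with r ≡ᵇ ρ A in e₂
    ...   | true rewrite ≡ᵇ⇒≡ r (ρ A) (subst Data.Bool.T (sym e₂) _) = c-lo p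
    ...   | false with r ≡ᵇ ρ B in e₃
    ...     | true rewrite ≡ᵇ⇒≡ r (ρ B) (subst Data.Bool.T (sym e₃) _) = c-hi p
    ...     | false with ρ B <ᵇ r in e₄
    ...       | true = c-zero λ _ q s → <⇒≱ (<ᵇ⇒< (ρ B) r (subst Data.Bool.T (sym e₄) _)) (subst (_≤ ρ B) s (ρ-mono q))
    ...       | false = refl

    EulerEq : ℕ → ℕ → (ℕ → ℕ) → Set
    EulerEq a b f = g 0 + g 2 + g 4 + g 6 ≡ g 1 + g 3 + g 5 + g 7
      where g = forced a b f

    euler-at : ∀ {A B} a b → A ⊑ B → ρ A ≡ a → ρ B ≡ b → a < b → EulerEq a b (c A B)
    euler-at {A} {B} a b p refl refl a<b
      rewrite sym (c-forced p 0) | sym (c-forced p 1) | sym (c-forced p 2) | sym (c-forced p 3)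
            | sym (c-forced p 4) | sym (c-forced p 5) | sym (c-forced p 6) | sym (c-forced p 7) = euler p (ρ≢ a<b)

    ρ≤7 : ∀ x → ρ x ≤ 7
    ρ≤7 x = subst (ρ x ≤_) ρ-top (ρ-mono (top-max x))

  +0 : ∀ x → x + 0 ≡ x
  +0 = +-identityʳ

  7∸-inv : ∀ {a} → a ≤ 7 → 7 ∸ (7 ∸ a) ≡ a
  7∸-inv = m∸[m∸n]≡n

  -- The dual poset

  module Dual (P : EulerianPoset) where
    open EulerianPoset P
    open Intervals P

    ρᵒ : X → ℕ
    ρᵒ x = 7 ∸ ρ x

    private
      pt : ∀ A B r z → r ≤ 7 → inInterval {_⊑_ = λ x y → y ⊑ x} (λ x y → y ⊑? x) ρᵒ B A r z ≡ W A B (7 ∸ r) z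
      pt A B r z r≤7 = cong₂ _*_ (*-comm ⟦ z ⊑? B ⟧ ⟦ A ⊑? z ⟧) rank-eq
        where
        rank-eq : ⟦ 7 ∸ ρ z ≟ r ⟧ ≡ ⟦ ρ z ≟ 7 ∸ r ⟧
        rank-eq with ρ z ≟ 7 ∸ r
        ... | yes e = ⟦⟧-yes (7 ∸ ρ z ≟ r) (trans (cong (7 ∸_) e) (7∸-inv r≤7))
        ... | no ¬e = ⟦⟧-no (7 ∸ ρ z ≟ r) λ e → ¬e (trans (sym (7∸-inv (ρ≤7 z))) (cong (7 ∸_) e))

    c-op′ : ∀ A B r → r ≤ 7 → countIn {_⊑_ = λ x y → y ⊑ x} (λ x y → y ⊑? x) ρᵒ B A r ≡ c A B (7 ∸ r)
    c-op′ A B r r≤7 = sum-cong-≗ (λ z → pt A B r z r≤7)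

    private
      gap : ∀ {a b} → a ≤ 7 → b ≤ 7 → 2 + (7 ∸ a) ≤ 7 ∸ b → 2 + b ≤ a
      gap {a} {b} a≤7 b≤7 h = +-cancelʳ-≤ (7 ∸ a) (2 + b) a (begin
        2 + b + (7 ∸ a)    ≡⟨ exch b (7 ∸ a) ⟩
        2 + (7 ∸ a) + b    ≤⟨ +-monoˡ-≤ b h ⟩
        7 ∸ b + b          ≡⟨ m∸n+n≡m b≤7 ⟩
        7                  ≡⟨ sym (m+[n∸m]≡n a≤7) ⟩
        a + (7 ∸ a)        ∎)
        where
        open ≤-Reasoning
        exch : ∀ b x → 2 + b + x ≡ 2 + x + b
        exch = solve-∀

    op : EulerianPoset
    op = record
      { N = N ; _⊑_ = λ x y → y ⊑ x ; _⊑?_ = λ x y → y ⊑? x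
      ; ⊑-refl = ⊑-refl ; ⊑-trans = λ p q → ⊑-trans q p
      ; ρ = ρᵒ
      ; ρ-strict = λ {x} {y} p x≢y → ∸-monoʳ-< (ρ-strict p (x≢y ∘ sym)) (ρ≤7 x)
      ; bot = top ; top = bot ; bot-min = top-max ; top-max = bot-min
      ; ρ-bot = cong (7 ∸_) ρ-top ; ρ-top = cong (7 ∸_) ρ-bot
      ; between = λ xa xb ya yb → let (z , az , bz , zx , zy) = between xa ya xb yb in z , zx , zy , az , bz
      ; dense = λ {x} {y} p h → let (z , yz , zx , l , l′) = dense p (gap (ρ≤7 x) (ρ≤7 y) h) in
          z , zx , yz , ∸-monoʳ-< l′ (ρ≤7 x) , ∸-monoʳ-< l (ρ≤7 z)
      -- As 7 is odd, passing from r to 7 - r exchanges even and odd ranks and hence the two sides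
      -- of the relation.
      ; euler = λ {x} {y} p x≢y →
          trans (cong₂ _+_ (cong₂ _+_ (cong₂ _+_ (k y x 0) (k y x 2)) (k y x 4)) (k y x 6))
         (trans (rev (c y x 7) (c y x 5) (c y x 3) (c y x 1))
         (trans (sym (euler p (x≢y ∘ sym)))
         (trans (rev (c y x 0) (c y x 2) (c y x 4) (c y x 6))
         (sym (cong₂ _+_ (cong₂ _+_ (cong₂ _+_ (k y x 1) (k y x 3)) (k y x 5)) (k y x 7))))))
      }
      where
      k : ∀ A B r {r≤7 : Data.Bool.T (r ≤ᵇ 7)} → countIn {_⊑_ = λ x y → y ⊑ x} (λ x y → y ⊑? x) ρᵒ B A r ≡ c A B (7 ∸ r)
      k A B r {r≤7} = c-op′ A B r (≤ᵇ⇒≤ r 7 r≤7)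
      rev : ∀ a b c d → a + b + c + d ≡ d + c + b + a
      rev = solve-∀

    S-op : ∀ A B r f → r ≤ 7 → Intervals.S op B A r f ≡ S A B (7 ∸ r) f
    S-op A B r f r≤7 = sum-cong-≗ (λ z → cong (_* f z) (pt A B r z r≤7))

    c-op : ∀ A B r → r ≤ 7 → Intervals.c op B A r ≡ c A B (7 ∸ r)
    c-op = c-op′

  -- Diamonds and the least number of atoms

  module Thin (P : EulerianPoset) where
    open EulerianPoset P
    open Intervals P

    -- Euler's relation for an interval of length two reads 1 + 1 = x. The cases on `a` are there
    -- because `EulerEq` computes only at literal ranks.
    thin : ∀ {A B} a → A ⊑ B → ρ A ≡ a → ρ B ≡ 2 + a → c A B (1 + a) ≡ 2
    thin {A} {B} a p hA hB = go a (subst (_≤ 7) hB (ρ≤7 B)) (euler-at a (2 + a) p hA hB (m<n⇒m<1+n (n<1+n a)))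
      where
      go : ∀ a → 2 + a ≤ 7 → EulerEq a (2 + a) (c A B) → c A B (1 + a) ≡ 2
      go 0 _ h = trans (sym (trans (+0 _) (trans (+0 _) (+0 _)))) (sym h)
      go 1 _ h = trans (sym (trans (+0 _) (+0 _))) h
      go 2 _ h = trans (sym (trans (+0 _) (+0 _))) (sym h)
      go 3 _ h = trans (sym (+0 _)) h
      go 4 _ h = trans (sym (+0 _)) (sym h)
      go 5 _ h = h
      go (suc (suc (suc (suc (suc (suc a)))))) (s≤s (s≤s (s≤s (s≤s (s≤s (s≤s (s≤s ()))))))) _

    other : ∀ {A C B} → A ⊑ C → C ⊑ B → ρ C ≡ 1 + ρ A → ρ B ≡ 2 + ρ A →
            ∃ λ z → A ⊑ z × z ⊑ B × ρ z ≡ 1 + ρ A × z ≢ C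
    other {A} {C} {B} AC CB hC hB
      with FinP.any? (λ z → (A ⊑? z) ×-dec (z ⊑? B) ×-dec (ρ z ≟ 1 + ρ A) ×-dec ¬? (z FinP.≟ C))
    ... | yes r = r
    ... | no n = contradiction (trans (sym (thin (ρ A) (⊑-trans AC CB) refl hB))
                   (trans (sum-single _ C λ z z≢C → W-no {A} {B} {1 + ρ A} {z} λ (p , q , s) → n (z , p , q , s , z≢C))
                          (W-yes AC CB hC))) λ ()

    coatom : ∀ {A B} → A ⊑ B → ρ A < ρ B → ∃ λ C → A ⊑ C × C ⊑ B × suc (ρ C) ≡ ρ B
    coatom {A} {B} p A<B = go (ρ B) p A<B (m≤m+n (ρ B) (ρ A))
      where
      -- The fuel `k` bounds the rank distance from `D` to `B`, which every use of `dense` lowers.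
      go : ∀ k {D} → D ⊑ B → ρ D < ρ B → ρ B ≤ k + ρ D → ∃ λ C → D ⊑ C × C ⊑ B × suc (ρ C) ≡ ρ B
      go zero q D<B h = contradiction h (<⇒≱ D<B)
      go (suc k) {D} q D<B h with m≤n⇒m<n∨m≡n D<B
      ... | inj₂ e = D , ⊑-refl , q , e
      ... | inj₁ l with dense q l
      ...   | z , Dz , zB , D<z , z<B with go k zB z<B (≤-trans h (≤-trans (≤-reflexive (sym (+-suc k (ρ D)))) (+-monoʳ-≤ k D<z)))
      ...     | C , zC , CB , e = C , ⊑-trans Dz zC , CB , e

    -- Take a coatom `D` of `C` above `A` and the second element `C′` of the diamond between `D` and
    -- `B`. By `between`, anything below both `C` and `C′` is below `D`; so the atom below `C′` but
    -- off `D`, found by induction, is off `C`.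
    new-atom : ∀ ℓ {A C B} → A ⊑ C → C ⊑ B → ρ C ≡ ℓ + ρ A → ρ B ≡ suc (ρ C) →
               ∃ λ z → A ⊑ z × z ⊑ B × ρ z ≡ suc (ρ A) × ¬ (z ⊑ C)
    new-atom zero {A} {C} {B} AC CB e e′ =
      B , ⊑-trans AC CB , ⊑-refl , trans e′ (cong suc e) , λ BC → <⇒≱ (≤-reflexive (sym e′)) (ρ-mono BC)
    new-atom (suc ℓ) {A} {C} {B} AC CB e e′
      with coatom AC (≤-trans (s≤s (m≤n+m (ρ A) ℓ)) (≤-reflexive (sym e)))
    ... | D , AD , DC , eD with other DC CB (sym eD) (trans e′ (cong suc (sym eD)))
    ... | C′ , DC′ , C′B , eC′ , C′≢C with new-atom ℓ AD DC′ (suc-injective (trans eD e)) eC′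
    ... | z , Az , zC′ , ez , z⋢D = z , Az , ⊑-trans zC′ C′B , ez , λ zC → contra zC (between zC zC′ DC DC′)
      where
      contra : z ⊑ C → (∃ λ w → z ⊑ w × D ⊑ w × w ⊑ C × w ⊑ C′) → _
      contra zC (w , zw , Dw , wC , wC′) with w FinP.≟ C
      ... | yes refl = C′≢C (sym (same-rank wC′ (≤-reflexive (trans eC′ eD))))
      ... | no w≢C = z⋢D (subst (z ⊑_) (sym (same-rank Dw (≤-pred (≤-trans (ρ-strict wC w≢C) (≤-reflexive (sym eD)))))) zw)

    -- A coatom has the atoms counted by induction, and `new-atom` adds one outside it: no interval
    -- has fewer atoms than a simplex of its rank.
    atoms≥ : ∀ ℓ {A B} → A ⊑ B → ρ B ≡ suc ℓ + ρ A → suc ℓ ≤ c A B (suc (ρ A))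
    atoms≥ zero {A} {B} p e = ≤-reflexive (sym (subst (λ r → c A B r ≡ 1) e (c-hi p)))
    atoms≥ (suc ℓ) {A} {B} p e
      with coatom p (≤-trans (s≤s (m≤n+m (ρ A) (suc ℓ))) (≤-reflexive (sym e)))
    ... | C , AC , CB , eC with suc-injective (trans eC e)
    ... | e′ with new-atom (suc ℓ) AC CB e′ (sym eC)
    ... | z , Az , zB , ez , z⋢C = begin
      suc (suc ℓ)                                            ≤⟨ s≤s (atoms≥ ℓ AC e′) ⟩
      1 + c A C r                                            ≡⟨ cong (_+ c A C r) (sym one) ⟩
      sum (λ x → ⟦ x FinP.≟ z ⟧) + c A C r                   ≡⟨ sym (∑-distrib-+ (λ x → ⟦ x FinP.≟ z ⟧) (W A C r)) ⟩
      sum (λ x → ⟦ x FinP.≟ z ⟧ + W A C r x)                 ≤⟨ sum-mono pt ⟩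
      c A B r                                                ∎
      where
      open ≤-Reasoning
      r = suc (ρ A)
      one : sum (λ x → ⟦ x FinP.≟ z ⟧) ≡ 1
      one = trans (sum-single _ z λ x n → ⟦⟧-no (x FinP.≟ z) n) (⟦⟧-yes (z FinP.≟ z) refl)
      pt : ∀ x → ⟦ x FinP.≟ z ⟧ + W A C r x ≤ W A B r x
      pt x with view A C r x
      ... | in- p q s w rewrite w | W-yes {A} {B} {r} {x} p (⊑-trans q CB) s
            = ≤-reflexive (cong (_+ 1) (⟦⟧-no (x FinP.≟ z) λ { refl → z⋢C q }))
      ... | out- _ w rewrite w | +0 ⟦ x FinP.≟ z ⟧ with x FinP.≟ z
      ...   | yes refl = ≤-reflexive (sym (W-yes {A} {B} {r} {x} Az zB ez))
      ...   | no _ = z≤n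

  -- Counting edges, and 2-neighborliness

  Neighborly : EulerianPoset → Set
  Neighborly P = ∀ {x y} → ρ x ≡ 1 → ρ y ≡ 1 → x ≢ y → ∃ λ e → ρ e ≡ 2 × x ⊑ e × y ⊑ e
    where open EulerianPoset P

  module Edges (P : EulerianPoset) where
    open EulerianPoset P
    open Intervals P
    open Thin P

    T2 : ∀ {e} → ρ e ≡ 2 → c bot e 1 ≡ 2
    T2 h = thin 0 (bot-min _) ρ-bot h

    -- Candidates of rank `r` for a join of `A` and `y` below `B`. The counts below turn on there
    -- being at most one of them unless `y ⊑ A`.
    J : X → X → X → ℕ → ℕ
    J A y B r = S A B r (λ e → ⟦ y ⊑? e ⟧)

    -- Unlike in `flags`, the two elements range over intervals with different lower ends. With
    -- `Z = bot` and `A` an atom, this counts all endpoints of the edges at `A`, including those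
    -- other than `A`.
    flags′ : ∀ Z A B r₁ r₂ → S A B r₂ (λ e → c Z e r₁) ≡ S Z B r₁ (λ y → J A y B r₂)
    flags′ Z A B r₁ r₂ = begin
      sum (λ e → W A B r₂ e * sum (λ y → W Z e r₁ y))
        ≡⟨ sum-cong-≗ (λ e → *-distribˡ-sum (W A B r₂ e) (W Z e r₁)) ⟩
      sum (λ e → sum (λ y → W A B r₂ e * W Z e r₁ y))
        ≡⟨ ∑-comm (λ e y → W A B r₂ e * W Z e r₁ y) ⟩
      sum (λ y → sum (λ e → W A B r₂ e * W Z e r₁ y))
        ≡⟨ sum-cong-≗ (λ y → sum-cong-≗ (λ e → pt y e)) ⟩
      sum (λ y → sum (λ e → W Z B r₁ y * (W A B r₂ e * ⟦ y ⊑? e ⟧)))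
        ≡⟨ sum-cong-≗ (λ y → sym (*-distribˡ-sum (W Z B r₁ y) (λ e → W A B r₂ e * ⟦ y ⊑? e ⟧))) ⟩
      sum (λ y → W Z B r₁ y * J A y B r₂) ∎
      where
      open ≡-Reasoning
      pt : ∀ y e → W A B r₂ e * W Z e r₁ y ≡ W Z B r₁ y * (W A B r₂ e * ⟦ y ⊑? e ⟧)
      pt y e with view A B r₂ e
      ... | out- _ w rewrite w = sym (*-zeroʳ (W Z B r₁ y))
      ... | in- Ae eB re w rewrite w with view Z e r₁ y
      ...   | in- Zy ye ry w′ rewrite w′ | W-yes {Z} {B} {r₁} {y} Zy (⊑-trans ye eB) ry | ⟦⟧-yes (y ⊑? e) ye = refl
      ...   | out- n w′ rewrite w′ with view Z B r₁ y
      ...     | out- _ w″ rewrite w″ = refl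
      ...     | in- Zy _ ry w″ rewrite w″ | ⟦⟧-no (y ⊑? e) (λ ye → n (Zy , ye , ry)) = refl

    J-below : ∀ {A y B r} → y ⊑ A → J A y B r ≡ c A B r
    J-below {A} {y} {B} {r} yA = trans (S-cong {A} {B} {r} (λ {e} Ae _ _ → ⟦⟧-yes (y ⊑? e) (⊑-trans yA Ae))) (S-one A B r)

    private
      J-pt : ∀ {A y B r} e → W A B r e * ⟦ y ⊑? e ⟧ ≢ 0 → A ⊑ e × e ⊑ B × ρ e ≡ r × y ⊑ e
      J-pt {A} {y} {B} {r} e h with view A B r e | y ⊑? e
      ... | in- p q s _ | yes ye = p , q , s , ye
      ... | in- _ _ _ w | no _ = contradiction (*-zeroʳ (W A B r e)) h
      ... | out- _ w | d = contradiction (cong (_* ⟦ d ⟧) w) h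

    J-unique : ∀ {A y B r e} → A ⊑ e → e ⊑ B → ρ e ≡ r → y ⊑ e →
               (∀ {e′} → A ⊑ e′ → e′ ⊑ B → ρ e′ ≡ r → y ⊑ e′ → e′ ≡ e) → J A y B r ≡ 1
    J-unique {A} {y} {B} {r} {e} p q s t u =
      trans (sum-single _ e λ z z≢e → zero-or z z≢e) (cong₂ _*_ (W-yes p q s) (⟦⟧-yes (y ⊑? e) t))
      where
      zero-or : ∀ z → z ≢ e → W A B r z * ⟦ y ⊑? z ⟧ ≡ 0
      zero-or z z≢e with W A B r z * ⟦ y ⊑? z ⟧ ≟ 0
      ... | yes h = h
      ... | no h = let (p , q , s , t) = J-pt {A} {y} {B} {r} z h in contradiction (u p q s t) z≢e

    J≤1 : ∀ {A y B r} →
          (∀ {e e′} → A ⊑ e → ρ e ≡ r → y ⊑ e → A ⊑ e′ → ρ e′ ≡ r → y ⊑ e′ → e′ ≡ e) → J A y B r ≤ 1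
    J≤1 {A} {y} {B} {r} u with FinP.any? (λ e → ¬? (W A B r e * ⟦ y ⊑? e ⟧ ≟ 0))
    ... | yes (e , h) = let (p , q , s , t) = J-pt {A} {y} {B} {r} e h in
          ≤-reflexive (J-unique p q s t (λ p′ _ s′ t′ → u p s t p′ s′ t′))
    ... | no n = ≤-trans (≤-reflexive (sum-zero λ e → decidable-stable (W A B r e * ⟦ y ⊑? e ⟧ ≟ 0) λ h → n (e , h))) z≤n

    -- The element that `between` puts under `e` and `b` and over `x` and `y` has rank at least 2,
    -- since in rank 1 it would equal both atoms. Lying under the edge, it is `e`.
    edge-unique : ∀ {x y e b} → ρ x ≡ 1 → ρ y ≡ 1 → x ≢ y → ρ e ≡ 2 → x ⊑ e → y ⊑ e → x ⊑ b → y ⊑ b → e ⊑ b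
    edge-unique {x} {y} {e} {b} hx hy x≢y he xe ye xb yb with between xe xb ye yb
    ... | z , xz , yz , ze , zb with z FinP.≟ e
    ...   | yes refl = zb
    ...   | no z≢e = contradiction (trans x≡z (sym y≡z)) x≢y
      where
      ρz≤1 : ρ z ≤ 1
      ρz≤1 = ≤-pred (≤-trans (ρ-strict ze z≢e) (≤-reflexive he))
      x≡z : x ≡ z
      x≡z = same-rank xz (≤-trans ρz≤1 (≤-reflexive (sym hx)))
      y≡z : y ≡ z
      y≡z = same-rank yz (≤-trans ρz≤1 (≤-reflexive (sym hy)))

    S-at : ∀ {A B r} x (f : X → ℕ) → A ⊑ x → x ⊑ B → ρ x ≡ r → S A B r (λ z → ⟦ z FinP.≟ x ⟧ * f z) ≡ f x
    S-at {A} {B} {r} x f p q s = trans (sum-single _ x off) (trans (cong₂ _*_ (W-yes p q s) (cong (_* f x) (⟦⟧-yes (x FinP.≟ x) refl)))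
                                   (trans (+0 _) (+0 _)))
      where
      off : ∀ z → z ≢ x → W A B r z * (⟦ z FinP.≟ x ⟧ * f z) ≡ 0
      off z n rewrite ⟦⟧-no (z FinP.≟ x) n = *-zeroʳ (W A B r z)

    edge-at-most-one : ∀ {x y B} → ρ x ≡ 1 → ρ y ≡ 1 → y ≢ x → J x y B 2 ≤ 1
    edge-at-most-one {x} {y} {B} hx hy y≢x = J≤1 {x} {y} {B} λ xe he ye xe′ he′ ye′ →
      sym (same-rank (edge-unique hx hy (y≢x ∘ sym) he xe ye xe′ ye′) (≤-reflexive (trans he′ (sym he))))

    -- δ records the atoms of B known not to be joined to x.
    edges-at≤ : ∀ {x B} (δ : X → ℕ) → ρ x ≡ 1 → x ⊑ B → δ x ≡ 0 →
                (∀ {y} → y ⊑ B → ρ y ≡ 1 → y ≢ x → J x y B 2 + δ y ≤ 1) →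
                c x B 2 + 1 + S bot B 1 δ ≤ c bot B 1
    edges-at≤ {x} {B} δ hx xB δx h = cancel (c x B 2) (c bot B 1) (S bot B 1 δ) (begin
      c x B 2 * 2 + 1 + S bot B 1 δ
        ≡⟨ cong (λ t → t + 1 + S bot B 1 δ) (sym (S-const x B 2 2)) ⟩
      S x B 2 (λ _ → 2) + 1 + S bot B 1 δ
        ≡⟨ cong (λ t → t + 1 + S bot B 1 δ) (S-cong {x} {B} {2} (λ _ _ s → sym (T2 s))) ⟩
      S x B 2 (λ e → c bot e 1) + 1 + S bot B 1 δ
        ≡⟨ cong (λ t → t + 1 + S bot B 1 δ) (flags′ bot x B 1 2) ⟩
      S bot B 1 (λ y → J x y B 2) + 1 + S bot B 1 δ
        ≡⟨ cong (λ t → S bot B 1 (λ y → J x y B 2) + t + S bot B 1 δ) (sym (S-at {bot} {B} {1} x (λ _ → 1) (bot-min x) xB hx)) ⟩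
      S bot B 1 (λ y → J x y B 2) + S bot B 1 (λ y → ⟦ y FinP.≟ x ⟧ * 1) + S bot B 1 δ
        ≡⟨ cong (_+ S bot B 1 δ) (sym (S-+ bot B 1 _ _)) ⟩
      S bot B 1 (λ y → J x y B 2 + ⟦ y FinP.≟ x ⟧ * 1) + S bot B 1 δ
        ≡⟨ sym (S-+ bot B 1 _ _) ⟩
      S bot B 1 (λ y → J x y B 2 + ⟦ y FinP.≟ x ⟧ * 1 + δ y)
        ≤⟨ S-mono {bot} {B} {1} (λ {y} _ yB hy → pt y yB hy) ⟩
      -- Every edge at `x` contains `x`, so at y = x the count is `c x B 2` instead of at most 1;
      -- the second summand absorbs it.
      S bot B 1 (λ y → 1 + ⟦ y FinP.≟ x ⟧ * c x B 2)
        ≡⟨ S-+ bot B 1 _ _ ⟩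
      S bot B 1 (λ _ → 1) + S bot B 1 (λ y → ⟦ y FinP.≟ x ⟧ * c x B 2)
        ≡⟨ cong₂ _+_ (S-one bot B 1) (S-at {bot} {B} {1} x (λ _ → c x B 2) (bot-min x) xB hx) ⟩
      c bot B 1 + c x B 2 ∎)
      where
      open ≤-Reasoning
      cancel : ∀ k a d → k * 2 + 1 + d ≤ a + k → k + 1 + d ≤ a
      cancel k a d h = +-cancelʳ-≤ k (k + 1 + d) a (≤-trans (≤-reflexive (eq k d)) h)
        where
        eq : ∀ k d → k + 1 + d + k ≡ k * 2 + 1 + d
        eq = solve-∀
      pt : ∀ y → y ⊑ B → ρ y ≡ 1 → J x y B 2 + ⟦ y FinP.≟ x ⟧ * 1 + δ y ≤ 1 + ⟦ y FinP.≟ x ⟧ * c x B 2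
      pt y yB hy with y FinP.≟ x
      ... | yes refl = ≤-reflexive (trans (cong₂ (λ p q → p + 1 + q) (J-below {x} {x} {B} {2} ⊑-refl) δx)
                                   (trans (+0 _) (trans (+-comm _ 1) (cong suc (sym (+0 _))))))
      ... | no y≢x = ≤-trans (≤-reflexive (cong (_+ δ y) (+0 (J x y B 2)))) (h yB hy y≢x)

    -- Handshake lemma, with 1 added to each degree: under 2-neighborliness every summand is then
    -- the number of atoms.
    edge-sum : ∀ B → 2 * c bot B 2 + c bot B 1 ≡ S bot B 1 (λ x → c x B 2 + 1)
    edge-sum B = begin
      2 * c bot B 2 + c bot B 1
        ≡⟨ cong₂ _+_ (trans (*-comm 2 (c bot B 2)) (sym (S-const bot B 2 2))) (sym (S-one bot B 1)) ⟩
      S bot B 2 (λ _ → 2) + S bot B 1 (λ _ → 1)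
        ≡⟨ cong (_+ S bot B 1 (λ _ → 1)) (S-cong {bot} {B} {2} λ {e} _ _ s → trans (sym (T2 s)) (sym (S-one bot e 1))) ⟩
      S bot B 2 (λ e → S bot e 1 (λ _ → 1)) + S bot B 1 (λ _ → 1)
        ≡⟨ cong (_+ S bot B 1 (λ _ → 1)) (sym (flags bot B 1 2 (λ _ _ → 1))) ⟩
      S bot B 1 (λ x → S x B 2 (λ _ → 1)) + S bot B 1 (λ _ → 1)
        ≡⟨ sym (S-+ bot B 1 _ _) ⟩
      S bot B 1 (λ x → S x B 2 (λ _ → 1) + 1)
        ≡⟨ S-cong {bot} {B} {1} (λ {x} _ _ _ → cong (_+ 1) (S-one x B 2)) ⟩
      S bot B 1 (λ x → c x B 2 + 1) ∎
      where open ≡-Reasoning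

    private
      edges-at≤′ : ∀ {x B} → ρ x ≡ 1 → x ⊑ B → c x B 2 + 1 ≤ c bot B 1
      edges-at≤′ {x} {B} hx xB = ≤-trans (m≤m+n (c x B 2 + 1) _)
        (edges-at≤ (λ _ → 0) hx xB refl λ {y} _ hy y≢x →
          ≤-trans (≤-reflexive (+0 _)) (edge-at-most-one {x} {y} {B} hx hy y≢x))

    -- The subtraction-free form of e ≤ a(a - 1)/2, the number of pairs of atoms.
    edges≤ : ∀ B → 2 * c bot B 2 + c bot B 1 ≤ c bot B 1 * c bot B 1
    edges≤ B = begin
      2 * c bot B 2 + c bot B 1      ≡⟨ edge-sum B ⟩
      S bot B 1 (λ x → c x B 2 + 1)  ≤⟨ S-mono {bot} {B} {1} (λ _ q s → edges-at≤′ s q) ⟩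
      S bot B 1 (λ _ → c bot B 1)    ≡⟨ S-const bot B 1 (c bot B 1) ⟩
      c bot B 1 * c bot B 1          ∎
      where open ≤-Reasoning

    private
      -- The atom `y` is missing among the neighbours of `x`, so the degree bound at `x` improves by
      -- one (`δ` marks `y`) and the handshake sum stays strictly below its maximum.
      separated : ∀ {x y} → ρ x ≡ 1 → ρ y ≡ 1 → x ≢ y → ¬ (∃ λ e → ρ e ≡ 2 × x ⊑ e × y ⊑ e) →
                  2 * c bot top 2 + c bot top 1 < c bot top 1 * c bot top 1
      separated {x} {y} hx hy x≢y n = begin-strict
        2 * c bot top 2 + c bot top 1
          <⟨ m<m+n _ (≤-reflexive (sym (S-at {bot} {top} {1} x (λ _ → 1) (bot-min x) (top-max x) hx))) ⟩
        2 * c bot top 2 + c bot top 1 + S bot top 1 (λ z → ⟦ z FinP.≟ x ⟧ * 1)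
          ≡⟨ cong (_+ S bot top 1 (λ z → ⟦ z FinP.≟ x ⟧ * 1)) (edge-sum top) ⟩
        S bot top 1 (λ z → c z top 2 + 1) + S bot top 1 (λ z → ⟦ z FinP.≟ x ⟧ * 1)
          ≡⟨ sym (S-+ bot top 1 _ _) ⟩
        S bot top 1 (λ z → c z top 2 + 1 + ⟦ z FinP.≟ x ⟧ * 1)
          ≤⟨ S-mono {bot} {top} {1} (λ {z} _ q s → pt z q s) ⟩
        S bot top 1 (λ _ → c bot top 1)
          ≡⟨ S-const bot top 1 (c bot top 1) ⟩
        c bot top 1 * c bot top 1 ∎
        where
        open ≤-Reasoning
        J0 : J x y top 2 ≡ 0
        J0 = sum-zero λ e → zz e
          where
          zz : ∀ e → W x top 2 e * ⟦ y ⊑? e ⟧ ≡ 0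
          zz e with view x top 2 e | y ⊑? e
          ... | out- _ w | _ rewrite w = refl
          ... | in- _ _ _ _ | no _ = *-zeroʳ (W x top 2 e)
          ... | in- xe _ he _ | yes ye = contradiction (e , he , xe , ye) n
        δ : X → ℕ
        δ z = ⟦ z FinP.≟ y ⟧ * 1
        hδ : ∀ {z} → z ⊑ top → ρ z ≡ 1 → z ≢ x → J x z top 2 + δ z ≤ 1
        hδ {z} _ hz z≢x with z FinP.≟ y
        ... | yes refl = ≤-reflexive (cong (_+ 1) J0)
        ... | no _ = ≤-trans (≤-reflexive (+0 _)) (edge-at-most-one {x} {z} {top} hx hz z≢x)
        pt : ∀ z → z ⊑ top → ρ z ≡ 1 → c z top 2 + 1 + ⟦ z FinP.≟ x ⟧ * 1 ≤ c bot top 1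
        pt z q s with z FinP.≟ x
        ... | no _ = ≤-trans (≤-reflexive (+0 _)) (edges-at≤′ s q)
        ... | yes refl = ≤-trans (≤-reflexive (cong (c x top 2 + 1 +_) (sym (S-at {bot} {top} {1} y (λ _ → 1) (bot-min y) (top-max y) hy))))
                  (edges-at≤ {x} {top} δ hx (top-max x) (cong (_* 1) (⟦⟧-no (x FinP.≟ y) x≢y)) hδ)

    edges-max⇒neighborly : 2 * c bot top 2 + c bot top 1 ≡ c bot top 1 * c bot top 1 → Neighborly P
    edges-max⇒neighborly h {x} {y} hx hy x≢y with FinP.any? (λ e → (ρ e ≟ 2) ×-dec (x ⊑? e) ×-dec (y ⊑? e))
    ... | yes r = r
    ... | no n = contradiction (separated hx hy x≢y n) (≤⇒≯ (≤-reflexive (sym h)))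

  module NB (P : EulerianPoset) (nb : Neighborly P) where
    open EulerianPoset P
    open Intervals P
    open Thin P
    open Edges P

    private
      cancel-edges : ∀ k a → k * 2 + 1 ≡ a + k → k + 1 ≡ a
      cancel-edges k a h = +-cancelʳ-≡ k (k + 1) a (trans (x k) h)
        where
        x : ∀ k → k + 1 + k ≡ k * 2 + 1
        x = solve-∀

    -- Through an atom x, the edges of [x , B] are in bijection with the atoms of B other than x.
    edges-at : ∀ {x B} → ρ x ≡ 1 → x ⊑ B → c x B 2 + 1 ≡ c bot B 1
    edges-at {x} {B} hx xB = cancel-edges (c x B 2) (c bot B 1) (begin
      c x B 2 * 2 + 1
        ≡⟨ cong (_+ 1) (sym (S-const x B 2 2)) ⟩
      S x B 2 (λ _ → 2) + 1
        ≡⟨ cong (_+ 1) (S-cong {x} {B} {2} (λ _ _ s → sym (T2 s))) ⟩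
      S x B 2 (λ e → c bot e 1) + 1
        ≡⟨ cong (_+ 1) (flags′ bot x B 1 2) ⟩
      S bot B 1 (λ y → J x y B 2) + 1
        ≡⟨ cong (S bot B 1 (λ y → J x y B 2) +_) (sym (S-at {bot} {B} {1} x (λ _ → 1) (bot-min x) xB hx)) ⟩
      S bot B 1 (λ y → J x y B 2) + S bot B 1 (λ y → ⟦ y FinP.≟ x ⟧ * 1)
        ≡⟨ sym (S-+ bot B 1 _ _) ⟩
      S bot B 1 (λ y → J x y B 2 + ⟦ y FinP.≟ x ⟧ * 1)
        ≡⟨ S-cong {bot} {B} {1} (λ {y} _ yB hy → pt y yB hy) ⟩
      S bot B 1 (λ y → 1 + ⟦ y FinP.≟ x ⟧ * c x B 2)
        ≡⟨ S-+ bot B 1 _ _ ⟩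
      S bot B 1 (λ _ → 1) + S bot B 1 (λ y → ⟦ y FinP.≟ x ⟧ * c x B 2)
        ≡⟨ cong₂ _+_ (S-one bot B 1) (S-at {bot} {B} {1} x (λ _ → c x B 2) (bot-min x) xB hx) ⟩
      c bot B 1 + c x B 2 ∎)
      where
      open ≡-Reasoning
      pt : ∀ y → y ⊑ B → ρ y ≡ 1 → J x y B 2 + ⟦ y FinP.≟ x ⟧ * 1 ≡ 1 + ⟦ y FinP.≟ x ⟧ * c x B 2
      pt y yB hy with y FinP.≟ x
      ... | yes refl = trans (cong (_+ 1) (J-below {x} {x} {B} {2} ⊑-refl)) (trans (+-comm _ 1) (cong suc (sym (+0 _))))
      ... | no y≢x with nb hx hy (y≢x ∘ sym)
      ...   | e , he , xe , ye = cong (_+ 0) (J-unique xe (edge-unique hx hy (y≢x ∘ sym) he xe ye xB yB) he ye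
                λ xe′ _ he′ ye′ → sym (same-rank (edge-unique hx hy (y≢x ∘ sym) he xe ye xe′ ye′) (≤-reflexive (trans he′ (sym he)))))

    edges : ∀ B → 2 * c bot B 2 + c bot B 1 ≡ c bot B 1 * c bot B 1
    edges B = trans (edge-sum B) (trans (S-cong {bot} {B} {1} (λ _ q s → edges-at s q)) (S-const bot B 1 (c bot B 1)))

  -- Certificates for linear arithmetic

  ≡-from : ∀ {a b p q} → p ≡ q → a + q ≡ b + p → a ≡ b
  ≡-from {a} {b} {p} refl h = +-cancelʳ-≡ p a b h

  -- Linear consequences over ℕ without subtraction: the hypotheses are scaled and added to `p ≤ q`
  -- by `⊕`, `⊗` and `⊞`, and the ring solver checks the identity `a + q ≡ b + p`.
  ≤-from : ∀ {a b p q} → p ≤ q → a + q ≡ b + p → a ≤ b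
  ≤-from {a} {b} {p} {q} h e = +-cancelʳ-≤ q a b (≤-trans (≤-reflexive e) (+-monoʳ-≤ b h))

  ≤-from′ : ∀ {a b p q} d → p ≤ q → a + q + d ≡ b + p → a ≤ b
  ≤-from′ {a} {b} {p} {q} d h e = +-cancelʳ-≤ q a b
    (≤-trans (m≤m+n (a + q) d) (≤-trans (≤-reflexive e) (+-monoʳ-≤ b h)))

  infixl 6 _⊕_ _⊞_
  infixl 7 _⊗_
  _⊕_ : ∀ {a b c d : ℕ} → a ≡ b → c ≡ d → a + c ≡ b + d
  _⊕_ = cong₂ _+_

  _⊗_ : ∀ {a b : ℕ} k → a ≡ b → k * a ≡ k * b
  k ⊗ h = cong (k *_) h

  _⊞_ : ∀ {a b c d : ℕ} → a ≤ b → c ≤ d → a + c ≤ b + d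
  _⊞_ = +-mono-≤

  -- Small faces are simplices; vertices against facets

  private
    -- For a polygon Euler's relation is e = a, and e = a(a - 1)/2 leaves only a = 3.
    arith₃ : ∀ a e → 1 + e + 0 + 0 ≡ a + 1 + 0 + 0 → 2 * e + a ≡ a * a → 3 ≤ a → a ≡ 3
    arith₃ a e h₁ h₂ (s≤s {n = a′} _) = *-cancelˡ-≡ _ _ (suc a′) (≡-from (2 ⊗ h₁ ⊕ sym h₂) (x e (suc a′)))
      where
      x : ∀ e a → a * a + (2 * (a + 1 + 0 + 0) + (2 * e + a)) ≡ a * 3 + (2 * (1 + e + 0 + 0) + a * a)
      x = solve-∀

    -- Euler's relation and 2e = 3t give e = 3a - 6. With e = a(a - 1)/2 this is (a - 3)(a - 4) = 0,
    -- which for a = 4 + d reads d + d² = 0.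
    arith₄ : ∀ a e t → 1 + e + 1 + 0 ≡ a + t + 0 + 0 → e * 2 ≡ t * 3 → 2 * e + a ≡ a * a → 4 ≤ a → a ≡ 4
    arith₄ a e t h₁ h₂ h₃ 4≤a with m≤n⇒∃[o]m+o≡n 4≤a
    ... | d , refl = cong (4 +_) (m+n≡0⇒m≡0 d (≡-from {d + d * d} (6 ⊗ h₁ ⊕ 2 ⊗ sym h₂ ⊕ sym h₃) (x e t d)))
      where
      x : ∀ e t d → (d + d * d) + (6 * (4 + d + t + 0 + 0) + 2 * (e * 2) + (2 * e + (4 + d)))
                  ≡ 0 + (6 * (1 + e + 1 + 0) + 2 * (t * 3) + (4 + d) * (4 + d))
      x = solve-∀

  module Simplices (P : EulerianPoset) (nb : Neighborly P) where
    open EulerianPoset P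
    open Intervals P
    open Thin P
    open NB P nb

    atoms≥′ : ∀ ℓ {B} → ρ B ≡ suc ℓ → suc ℓ ≤ c bot B 1
    atoms≥′ ℓ {B} h = subst (λ r → suc ℓ ≤ c bot B (suc r)) ρ-bot
      (atoms≥ ℓ (bot-min B) (trans h (trans (sym (+0 (suc ℓ))) (cong (suc ℓ +_) (sym ρ-bot)))))

    euler₀ : ∀ b {B} → ρ B ≡ suc b → EulerEq 0 (suc b) (c bot B)
    euler₀ b h = euler-at 0 (suc b) (bot-min _) ρ-bot h (s≤s z≤n)

    tri₁ : ∀ {T} → ρ T ≡ 3 → c bot T 1 ≡ 3
    tri₁ {T} h = arith₃ (c bot T 1) (c bot T 2) (euler₀ 2 h) (edges T) (atoms≥′ 2 h)

    tri₂ : ∀ {T} → ρ T ≡ 3 → c bot T 2 ≡ 3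
    tri₂ {T} h = trans (≡-from (euler₀ 2 h) (x (c bot T 2) (c bot T 1))) (tri₁ h)
      where
      x : ∀ e a → e + (a + 1 + 0 + 0) ≡ a + (1 + e + 0 + 0)
      x = solve-∀

    tet₁ : ∀ {Y} → ρ Y ≡ 4 → c bot Y 1 ≡ 4
    tet₁ {Y} h = arith₄ (c bot Y 1) (c bot Y 2) (c bot Y 3) (euler₀ 3 h)
      (flags-const bot Y 2 3 2 3 (λ _ eY he → thin 2 eY he h) (λ _ _ → tri₂)) (edges Y) (atoms≥′ 3 h)

    tet₂ : ∀ {Y} → ρ Y ≡ 4 → c bot Y 2 ≡ 6
    tet₂ {Y} h = go (tet₁ h) (edges Y)
      where
      go : ∀ {a e} → a ≡ 4 → 2 * e + a ≡ a * a → e ≡ 6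
      go refl q = *-cancelˡ-≡ _ _ 2 (+-cancelʳ-≡ 4 _ _ q)

    tet₃ : ∀ {Y} → ρ Y ≡ 4 → c bot Y 3 ≡ 4
    tet₃ {Y} h = go (tet₁ h) (tet₂ h) (euler₀ 3 h)
      where
      go : ∀ {a e t} → a ≡ 4 → e ≡ 6 → 1 + e + 1 + 0 ≡ a + t + 0 + 0 → t ≡ 4
      go refl refl q = sym (+-cancelˡ-≡ 4 _ _ (trans q (trans (+0 _) (+0 _))))

    tet-star₂ : ∀ {v Y} → ρ v ≡ 1 → ρ Y ≡ 4 → v ⊑ Y → c v Y 2 ≡ 3
    tet-star₂ {v} {Y} hv h p = +-cancelʳ-≡ 1 _ _ (trans (edges-at hv p) (tet₁ h))

    tet-star₃ : ∀ {v Y} → ρ v ≡ 1 → ρ Y ≡ 4 → v ⊑ Y → c v Y 3 ≡ 3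
    tet-star₃ {v} {Y} hv h p = go (tet-star₂ hv h p) (euler-at 1 4 p hv h (s≤s (s≤s z≤n)))
      where
      go : ∀ {e t} → e ≡ 3 → 0 + e + 1 + 0 ≡ 1 + t + 0 + 0 → t ≡ 3
      go refl q = suc-injective (trans (sym (trans (+0 _) (+0 _))) (sym q))

    simplices≤ : c bot top 3 ≤ c bot top 4
    simplices≤ = *-cancelʳ-≤ _ _ 4 (begin
      c bot top 3 * 4 ≡⟨ sym (S-const bot top 3 4) ⟩
      S bot top 3 (λ _ → 4) ≤⟨ S-mono {bot} {top} {3} (λ {T} _ q s → ≤-trans (four q s) (≤-reflexive (sym (S-one T top 4)))) ⟩
      S bot top 3 (λ T → S T top 4 (λ _ → 1)) ≡⟨ flags bot top 3 4 (λ _ _ → 1) ⟩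
      S bot top 4 (λ Y → S bot Y 3 (λ _ → 1)) ≡⟨ S-cong {bot} {top} {4} (λ {Y} _ _ s → trans (S-one bot Y 3) (tet₃ s)) ⟩
      S bot top 4 (λ _ → 4) ≡⟨ S-const bot top 4 4 ⟩
      c bot top 4 * 4 ∎)
      where
      open ≤-Reasoning
      -- The interval above `T` has length 7 - 3 = 4 and therefore at least four atoms.
      four : ∀ {T} → T ⊑ top → ρ T ≡ 3 → 4 ≤ c T top 4
      four {T} q s = subst (λ r → 4 ≤ c T top (suc r)) s (atoms≥ 3 q (trans ρ-top (cong (4 +_) (sym s))))

  private
    -- Euler's relation and the bounds give g(a₁) ≤ g(a₆) for g(t) = t(t - 3), which is increasing
    -- for t ≥ 2. If a₁ = a₆ + 1 + d, then g(a₁) - g(a₆) is at least its value 12 + 13d + d² at a₆ =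
    -- 7.
    arith-main : ∀ a₁ a₂ a₃ a₄ a₅ a₆ → 1 + a₂ + a₄ + a₆ ≡ a₁ + a₃ + a₅ + 1 → 2 * a₂ + a₁ ≡ a₁ * a₁ →
      2 * a₅ + a₆ ≤ a₆ * a₆ → a₃ ≤ a₄ → 7 ≤ a₆ → a₁ ≤ a₆
    arith-main a₁ a₂ a₃ a₄ a₅ a₆ h₁ h₂ h₃ h₄ h₅ with a₁ ≤? a₆
    ... | yes p = p
    ... | no ¬p with m≤n⇒∃[o]m+o≡n (≰⇒> ¬p)
    ...   | d , refl = contradiction (≤-from′ {12} {0} (13 * d + d * d)
            (≤-reflexive (2 ⊗ h₁ ⊕ sym h₂) ⊞ h₃ ⊞ *-monoʳ-≤ 2 h₄ ⊞ *-monoʳ-≤ (2 + 2 * d) h₅)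
            (x a₂ a₃ a₄ a₅ a₆ d)) λ ()
      where
      x : ∀ a₂ a₃ a₄ a₅ a₆ d → 12 + (2 * (suc a₆ + d + a₃ + a₅ + 1) + (2 * a₂ + (suc a₆ + d)) + a₆ * a₆ + 2 * a₄ + (2 + 2 * d) * a₆)
          + (13 * d + d * d)
        ≡ 0 + (2 * (1 + a₂ + a₄ + a₆) + (suc a₆ + d) * (suc a₆ + d) + (2 * a₅ + a₆) + 2 * a₃ + (2 + 2 * d) * 7)
      x = solve-∀

  module Primal (P : EulerianPoset) where
    open EulerianPoset P
    open Intervals P
    open Dual P public

    ρᵒ-of : ∀ {x} r → ρ x ≡ r → ρᵒ x ≡ 7 ∸ r
    ρᵒ-of r h = cong (7 ∸_) h

    co-edges≤ : 2 * c bot top 5 + c bot top 6 ≤ c bot top 6 * c bot top 6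
    co-edges≤ = subst₂ (λ p q → 2 * p + q ≤ q * q) (c-op bot top 2 (s≤s (s≤s z≤n))) (c-op bot top 1 (s≤s z≤n))
      (Edges.edges≤ op bot)

    coatoms≥7 : 7 ≤ c bot top 6
    coatoms≥7 = subst (7 ≤_) (c-op bot top 1 (s≤s z≤n))
      (subst (λ r → 7 ≤ Intervals.c op top bot (suc r)) (ρᵒ-of 7 ρ-top)
        (Thin.atoms≥ op 6 (top-max bot) (trans (ρᵒ-of 0 ρ-bot) (cong (7 +_) (sym (ρᵒ-of 7 ρ-top))))))

    co-edges-max⇒neighborly : 2 * c bot top 5 + c bot top 6 ≡ c bot top 6 * c bot top 6 → Neighborly op
    co-edges-max⇒neighborly h = Edges.edges-max⇒neighborly op
      (subst₂ (λ p q → 2 * p + q ≡ q * q) (sym (c-op bot top 2 (s≤s (s≤s z≤n)))) (sym (c-op bot top 1 (s≤s z≤n))) h)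

  rankCount : EulerianPoset → ℕ → ℕ
  rankCount P = Intervals.c P (EulerianPoset.bot P) (EulerianPoset.top P)

  atoms≤coatoms : ∀ P → Neighborly P → rankCount P 1 ≤ rankCount P 6
  atoms≤coatoms P nb = arith-main (a 1) (a 2) (a 3) (a 4) (a 5) (a 6)
      (euler₀ 6 ρ-top) (edges top) co-edges≤ simplices≤ coatoms≥7
    where
    open EulerianPoset P
    open Intervals P
    open Primal P
    open Simplices P nb
    open NB P nb
    a : ℕ → ℕ
    a = c bot top

  private
    -- With a₁ = a₆ Euler's relation reads a₅ = a₂ + (a₄ - a₃) ≥ a₁(a₁ - 1)/2, so the dual has as
    -- many edges as it can.
    arith-eq : ∀ a₁ a₂ a₃ a₄ a₅ → 1 + a₂ + a₄ + a₁ ≡ a₁ + a₃ + a₅ + 1 → 2 * a₂ + a₁ ≡ a₁ * a₁ →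
      2 * a₅ + a₁ ≤ a₁ * a₁ → a₃ ≤ a₄ → 2 * a₅ + a₁ ≡ a₁ * a₁
    arith-eq a₁ a₂ a₃ a₄ a₅ h₁ h₂ h₃ h₄ = ≤-antisym h₃
      (≤-from (≤-reflexive (2 ⊗ h₁ ⊕ sym h₂) ⊞ *-monoʳ-≤ 2 h₄) (x a₁ a₂ a₃ a₄ a₅))
      where
      x : ∀ a₁ a₂ a₃ a₄ a₅ → a₁ * a₁ + (2 * (a₁ + a₃ + a₅ + 1) + (2 * a₂ + a₁) + 2 * a₄)
        ≡ 2 * a₅ + a₁ + (2 * (1 + a₂ + a₄ + a₁) + a₁ * a₁ + 2 * a₃)
      x = solve-∀

  equal⇒dual : ∀ P → Neighborly P → rankCount P 6 ≡ rankCount P 1 → Neighborly (Dual.op P)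
  equal⇒dual P nb h = co-edges-max⇒neighborly (subst (λ n → 2 * a 5 + n ≡ n * n) (sym h)
      (arith-eq (a 1) (a 2) (a 3) (a 4) (a 5)
        (subst (λ n → 1 + a 2 + a 4 + n ≡ a 1 + a 3 + a 5 + 1) h (euler₀ 6 ρ-top)) (edges top)
        (subst (λ n → 2 * a 5 + n ≤ n * n) h co-edges≤) simplices≤))
    where
    open EulerianPoset P
    open Intervals P
    open Primal P
    open Simplices P nb
    open NB P nb
    a : ℕ → ℕ
    a = c bot top

  dual⇒equal : ∀ P → Neighborly P → Neighborly (Dual.op P) → rankCount P 6 ≡ rankCount P 1
  dual⇒equal P nb conb = ≤-antisym
      (subst₂ _≤_ (c-op bot top 1 (s≤s z≤n)) (c-op bot top 6 (s≤s (s≤s (s≤s (s≤s (s≤s (s≤s z≤n))))))) (atoms≤coatoms op conb))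
      (atoms≤coatoms P nb)
    where
    open EulerianPoset P
    open Intervals P
    open Dual P

  -- Incidence counts when both poset and dual are 2-neighborly

  1≤7 : 1 ≤ 7
  1≤7 = s≤s z≤n

  2≤7 : 2 ≤ 7
  2≤7 = s≤s (s≤s z≤n)

  3≤7 : 3 ≤ 7
  3≤7 = s≤s (s≤s (s≤s z≤n))

  private
    -- A ridge is a simplicial 2-neighborly 4-polytope. From c₃ = 2θ and Euler's relation, θ = c₂ -
    -- k = k(k - 3)/2.
    arith-θ : ∀ k c₂ c₃ θ → 1 + c₂ + θ + 0 ≡ k + c₃ + 1 + 0 → c₃ * 2 ≡ θ * 4 → 2 * c₂ + k ≡ k * k → 2 * θ + 3 * k ≡ k * k
    arith-θ k c₂ c₃ θ h₁ h₂ h₃ = ≡-from (2 ⊗ sym h₁ ⊕ sym h₂ ⊕ h₃) (x k c₂ c₃ θ)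
      where
      x : ∀ k c₂ c₃ θ → 2 * θ + 3 * k + (2 * (1 + c₂ + θ + 0) + c₃ * 2 + k * k)
        ≡ k * k + (2 * (k + c₃ + 1 + 0) + θ * 4 + (2 * c₂ + k))
      x = solve-∀

    -- The numbers of edges and triangles are eliminated, which expresses the number of tetrahedra
    -- of a facet through m and s.
    arith-F : ∀ m c₂ c₃ c₄ s → 1 + c₂ + c₄ + 1 ≡ m + c₃ + s + 0 → c₃ * 3 ≡ c₄ * 4 → 2 * c₂ + m ≡ m * m →
      2 * c₄ + 9 * m + 6 * s ≡ 12 + 3 * (m * m)
    arith-F m c₂ c₃ c₄ s h₁ h₂ h₃ = ≡-from (6 ⊗ sym h₁ ⊕ 2 ⊗ sym h₂ ⊕ 3 ⊗ h₃) (x m c₂ c₃ c₄ s)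
      where
      x : ∀ m c₂ c₃ c₄ s → 2 * c₄ + 9 * m + 6 * s + (6 * (1 + c₂ + c₄ + 1) + 2 * (c₃ * 3) + 3 * (m * m))
        ≡ 12 + 3 * (m * m) + (6 * (m + c₃ + s + 0) + 2 * (c₄ * 4) + 3 * (2 * c₂ + m))
      x = solve-∀

    arith-star : ∀ c₂ c₃ c₄ c₅ → 0 + c₂ + c₄ + 1 ≡ 1 + c₃ + c₅ + 0 → c₃ * 3 ≡ c₄ * 3 → c₂ ≡ c₅
    arith-star c₂ c₃ c₄ c₅ h₁ h₂ with *-cancelʳ-≡ c₃ c₄ 3 h₂
    ... | refl = ≡-from h₁ (x c₂ c₃ c₅)
      where
      x : ∀ c₂ c₃ c₅ → c₂ + (1 + c₃ + c₅ + 0) ≡ c₅ + (0 + c₂ + c₃ + 1)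
      x = solve-∀

    arith-edge : ∀ c₃ c₄ c₅ → 0 + 1 + c₄ + 1 ≡ 0 + c₃ + c₅ + 0 → c₃ * 3 ≡ c₄ * 2 → c₃ + 4 ≡ 2 * c₅
    arith-edge c₃ c₄ c₅ h₁ h₂ = ≡-from (2 ⊗ h₁ ⊕ h₂) (x c₃ c₄ c₅)
      where
      x : ∀ c₃ c₄ c₅ → c₃ + 4 + (2 * (0 + c₃ + c₅ + 0) + c₄ * 2) ≡ 2 * c₅ + (2 * (0 + 1 + c₄ + 1) + c₃ * 3)
      x = solve-∀

    arith-deg : ∀ a h m → a + 4 ≡ 2 * h → a * 3 + 2 ≤ m + 2 * a → 2 * h ≤ m + 2
    arith-deg a h m h₁ h₂ = ≤-from (≤-reflexive (sym h₁) ⊞ h₂) (x a h m)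
      where
      x : ∀ a h m → 2 * h + (a + 4 + (m + 2 * a)) ≡ m + 2 + (2 * h + (a * 3 + 2))
      x = solve-∀

  module Both (P : EulerianPoset) (nb : Neighborly P) (conb : Neighborly (Dual.op P)) where
    open EulerianPoset P
    open Intervals P
    open Thin P
    open Edges P
    open NB P nb
    open Simplices P nb
    open Primal P

    private
      module O = Simplices op conb

    co-edges-at : ∀ {A F} → ρ F ≡ 6 → A ⊑ F → c A F 5 + 1 ≡ c A top 6
    co-edges-at {A} {F} hF p = subst₂ (λ p q → p + 1 ≡ q) (c-op A F 2 2≤7) (c-op A top 1 1≤7)
      (NB.edges-at op conb (ρᵒ-of 6 hF) p)

    -- In the dual, `T` has rank 4 and is a tetrahedron with vertex `F`. The elements of rank 4
    -- between `T` and `F` are its three triangles at that vertex.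
    co-tet-star : ∀ {T F} → ρ T ≡ 3 → ρ F ≡ 6 → T ⊑ F → c T F 4 ≡ 3
    co-tet-star {T} {F} hT hF p = trans (sym (c-op T F 3 3≤7)) (O.tet-star₃ (ρᵒ-of 6 hF) (ρᵒ-of 3 hT) p)

    tetrahedra : ∀ {G} → ρ G ≡ 5 → 2 * c bot G 4 + 3 * c bot G 1 ≡ c bot G 1 * c bot G 1
    tetrahedra {G} hG = arith-θ (c bot G 1) (c bot G 2) (c bot G 3) (c bot G 4) (euler₀ 4 hG)
      (flags-const bot G 3 4 2 4 (λ _ TG hT → thin 3 TG hT hG) (λ _ _ → tet₃)) (edges G)

    facet-count : ∀ {F} → ρ F ≡ 6 → 2 * c bot F 4 + 9 * c bot F 1 + 6 * c bot F 5 ≡ 12 + 3 * (c bot F 1 * c bot F 1)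
    facet-count {F} hF = arith-F (c bot F 1) (c bot F 2) (c bot F 3) (c bot F 4) (c bot F 5) (euler₀ 5 hF)
      (flags-const bot F 3 4 3 4 (λ _ TF hT → co-tet-star hT hF TF) (λ _ _ → tet₃)) (edges F)

    -- At `v` every triangle of `F` lies in three tetrahedra of `F`, and every tetrahedron has three
    -- triangles. These cancel in Euler's relation for the interval from `v` to `F`, so `v` is on as
    -- many ridges of `F` as edges.
    star-size : ∀ {v F} → ρ v ≡ 1 → ρ F ≡ 6 → v ⊑ F → c v F 5 + 1 ≡ c bot F 1
    star-size {v} {F} hv hF p = trans (cong (_+ 1) (sym
        (arith-star (c v F 2) (c v F 3) (c v F 4) (c v F 5) (euler-at 1 6 p hv hF (s≤s (s≤s z≤n)))
          (flags-const v F 3 4 3 3 (λ _ TF hT → co-tet-star hT hF TF) (λ vY _ hY → tet-star₃ hv hY vY)))))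
      (edges-at hv p)

    -- Ridges of `F` at `v` correspond to the other facets at `v`. Hence `v`, seen as a facet of the
    -- dual, has the same m as `F`.
    coatoms-above : ∀ {v F} → ρ v ≡ 1 → ρ F ≡ 6 → v ⊑ F → c v top 6 ≡ c bot F 1
    coatoms-above hv hF p = trans (sym (co-edges-at hF p)) (star-size hv hF p)

    -- The interval from `e` to `F` counts like a simple 3-polytope with V = `c e F 3` vertices and
    -- f = `c e F 5` facets: 3V = 2E and V - E + f = 2 give V + 4 = 2f.
    edge-star : ∀ {e F} → ρ e ≡ 2 → ρ F ≡ 6 → e ⊑ F → c e F 3 + 4 ≡ 2 * c e F 5
    edge-star {e} {F} he hF p = arith-edge (c e F 3) (c e F 4) (c e F 5) (euler-at 2 6 p he hF (s≤s (s≤s (s≤s z≤n))))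
      (flags-const e F 3 4 3 2 (λ _ TF hT → co-tet-star hT hF TF) (λ eY _ hY → thin 2 eY he hY))

    S-below : ∀ {A e B r} → e ⊑ B → S A B r (λ y → ⟦ y ⊑? e ⟧) ≡ c A e r
    S-below {A} {e} {B} {r} eB = sum-cong-≗ pt
      where
      pt : ∀ y → W A B r y * ⟦ y ⊑? e ⟧ ≡ W A e r y
      pt y with view A e r y
      ... | in- p q s w rewrite w | W-yes {A} {B} {r} {y} p (⊑-trans q eB) s | ⟦⟧-yes (y ⊑? e) q = refl
      ... | out- n w rewrite w with y ⊑? e
      ...   | no _ = *-zeroʳ (W A B r y)
      ...   | yes q rewrite W-no {A} {B} {r} {y} (λ (p , _ , s) → n (p , q , s)) = refl

    triangle-unique : ∀ {e y T T′} → ρ e ≡ 2 → ¬ (y ⊑ e) → ρ T ≡ 3 → ρ T′ ≡ 3 →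
                      e ⊑ T → y ⊑ T → e ⊑ T′ → y ⊑ T′ → T′ ≡ T
    triangle-unique {e} {y} {T} {T′} he y⋢e hT hT′ eT yT eT′ yT′ with between eT eT′ yT yT′
    ... | z , ez , yz , zT , zT′ = trans (sym (same-rank zT′ (≤-trans (≤-reflexive hT′) 3≤z))) (same-rank zT (≤-trans (≤-reflexive hT) 3≤z))
      where
      3≤z : 3 ≤ ρ z
      3≤z = subst (_< ρ z) he (ρ-strict ez λ { refl → y⋢e yz })

    -- The triangles through an edge e of F have distinct third vertices.
    edge-degree : ∀ {e F} → ρ e ≡ 2 → ρ F ≡ 6 → e ⊑ F → 2 * c e F 5 ≤ c bot F 1 + 2
    edge-degree {e} {F} he hF p = arith-deg (c e F 3) (c e F 5) (c bot F 1) (edge-star he hF p) (begin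
      c e F 3 * 3 + 2
        ≡⟨ cong₂ _+_ (sym (S-const e F 3 3)) (sym (trans (S-below {bot} {e} {F} {1} p) (T2 he))) ⟩
      S e F 3 (λ _ → 3) + S bot F 1 (λ y → ⟦ y ⊑? e ⟧)
        ≡⟨ cong (_+ S bot F 1 (λ y → ⟦ y ⊑? e ⟧)) (S-cong {e} {F} {3} λ _ _ hT → sym (tri₁ hT)) ⟩
      S e F 3 (λ T → c bot T 1) + S bot F 1 (λ y → ⟦ y ⊑? e ⟧)
        ≡⟨ cong (_+ S bot F 1 (λ y → ⟦ y ⊑? e ⟧)) (flags′ bot e F 1 3) ⟩
      S bot F 1 (λ y → J e y F 3) + S bot F 1 (λ y → ⟦ y ⊑? e ⟧)
        ≡⟨ sym (S-+ bot F 1 _ _) ⟩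
      S bot F 1 (λ y → J e y F 3 + ⟦ y ⊑? e ⟧)
        ≤⟨ S-mono {bot} {F} {1} (λ {y} _ _ _ → pt y) ⟩
      -- A vertex of `e` lies in all the `c e F 3` triangles, any other vertex in at most one.
      S bot F 1 (λ y → 1 + c e F 3 * ⟦ y ⊑? e ⟧)
        ≡⟨ S-+ bot F 1 _ _ ⟩
      S bot F 1 (λ _ → 1) + S bot F 1 (λ y → c e F 3 * ⟦ y ⊑? e ⟧)
        ≡⟨ cong₂ _+_ (S-one bot F 1) (S-*ˡ bot F 1 (c e F 3) _) ⟩
      c bot F 1 + c e F 3 * S bot F 1 (λ y → ⟦ y ⊑? e ⟧)
        ≡⟨ cong (λ t → c bot F 1 + c e F 3 * t) (trans (S-below {bot} {e} {F} {1} p) (T2 he)) ⟩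
      c bot F 1 + c e F 3 * 2
        ≡⟨ cong (c bot F 1 +_) (*-comm (c e F 3) 2) ⟩
      c bot F 1 + 2 * c e F 3 ∎)
      where
      open ≤-Reasoning
      go : ∀ y (d : Dec (y ⊑ e)) → J e y F 3 + ⟦ d ⟧ ≤ 1 + c e F 3 * ⟦ d ⟧
      go y (yes q) = ≤-reflexive (trans (+-comm _ 1) (cong suc (trans (J-below {e} {y} {F} {3} q) (sym (*-identityʳ _)))))
      go y (no y⋢e) = ≤-trans (≤-reflexive (+0 _)) (≤-trans
        (J≤1 {e} {y} {F} {3} λ eT hT yT eT′ hT′ yT′ → triangle-unique he y⋢e hT hT′ eT yT eT′ yT′) (m≤m+n 1 _))
      pt : ∀ y → J e y F 3 + ⟦ y ⊑? e ⟧ ≤ 1 + c e F 3 * ⟦ y ⊑? e ⟧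
      pt y = go y (y ⊑? e)

    c-witness : ∀ {A B r} → 1 ≤ c A B r → ∃ λ z → A ⊑ z × z ⊑ B × ρ z ≡ r
    c-witness {A} {B} {r} h with FinP.any? (λ z → (A ⊑? z) ×-dec (z ⊑? B) ×-dec (ρ z ≟ r))
    ... | yes w = w
    ... | no n = contradiction (subst (1 ≤_) (c-zero {A} {B} {r} λ p q s → n (_ , p , q , s)) h) λ ()

  -- Possible sizes of a facet

  private
    -- The ridges satisfy Σk = m(m - 1) and Σθ = 2c₄ with 2θ = k² - 3k. As c₄ is known from
    -- `arith-F`, this determines Z = Σ(k - 5)².
    arith-Z : ∀ m s X Z c₄ → 5 * s + X + m ≡ m * m → 2 * (c₄ * 2) + 3 * (5 * s + X) ≡ 25 * s + 10 * X + Z →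
              2 * c₄ + 9 * m + 6 * s ≡ 12 + 3 * (m * m) → Z + m * m + 11 * m ≡ 24 + 13 * s
    arith-Z m s X Z c₄ h₁ h₂ h₃ = ≡-from (7 ⊗ sym h₁ ⊕ sym h₂ ⊕ 2 ⊗ h₃) (x m s X Z c₄)
      where
      x : ∀ m s X Z c₄ → Z + m * m + 11 * m + (7 * (5 * s + X + m) + (2 * (c₄ * 2) + 3 * (5 * s + X)) + 2 * (12 + 3 * (m * m)))
        ≡ 24 + 13 * s + (7 * (m * m) + (25 * s + 10 * X + Z) + 2 * (2 * c₄ + 9 * m + 6 * s))
      x = solve-∀

  -- The possible numbers m of vertices and s of ridges of a facet.
  data Shape (m s : ℕ) : Set where
    simplex : m ≡ 6 → s ≡ 6 → Shape m s
    large   : 26 ≤ s → Shape m s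
    m₁₁s₁₉  : m ≡ 11 → s ≡ 19 → Shape m s
    m₁₂s₂₂  : m ≡ 12 → s ≡ 22 → Shape m s
    m₁₂s₂₃  : m ≡ 12 → s ≡ 23 → Shape m s

  private
    -- Elimination of X = Σy and Z = Σy² by the two moment equations turns bounds on the excess into
    -- bounds on s: from below in `L₁` and `L₃`, from above in `L₂`.
    L₁ : ∀ m s X Z → 5 * s + X + m ≡ m * m → Z + m * m + 11 * m ≡ 24 + 13 * s → X ≤ Z →
         2 * (m * m) + 10 * m ≤ 18 * s + 24
    L₁ m s X Z h₁ h₂ h = ≤-from (≤-reflexive (sym h₁ ⊕ h₂) ⊞ h) (x m s X Z)
      where
      x : ∀ m s X Z → 2 * (m * m) + 10 * m + (5 * s + X + m + (24 + 13 * s) + Z) ≡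
        18 * s + 24 + (m * m + (Z + m * m + 11 * m) + X)
      x = solve-∀

    L₂ : ∀ m s X Z K → 5 * s + X + m ≡ m * m → Z + m * m + 11 * m ≡ 24 + 13 * s → Z ≤ K * X →
         (13 + 5 * K) * s + (24 + K * m) ≤ K * (m * m) + m * m + 11 * m
    L₂ m s X Z K h₁ h₂ h = ≤-from (≤-reflexive (K ⊗ h₁ ⊕ sym h₂) ⊞ h) (x m s X Z K)
      where
      x : ∀ m s X Z K → (13 + 5 * K) * s + (24 + K * m) + (K * (m * m) + (Z + m * m + 11 * m) + K * X) ≡
        K * (m * m) + m * m + 11 * m + (K * (5 * s + X + m) + (24 + 13 * s) + Z)
      x = solve-∀

    L₃ : ∀ m s X Z → 5 * s + X + m ≡ m * m → Z + m * m + 11 * m ≡ 24 + 13 * s → 3 * X ≤ Z + 2 * s →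
         4 * (m * m) + 8 * m ≤ 30 * s + 24
    L₃ m s X Z h₁ h₂ h = ≤-from (≤-reflexive (3 ⊗ sym h₁ ⊕ h₂) ⊞ h) (x m s X Z)
      where
      x : ∀ m s X Z → 4 * (m * m) + 8 * m + (3 * (5 * s + X + m) + (24 + 13 * s) + (Z + 2 * s)) ≡
        30 * s + 24 + (3 * (m * m) + (Z + m * m + 11 * m) + 3 * X)
      x = solve-∀

    -- The implicit argument is a closed numerical comparison, settled by evaluation: the bound `t`
    -- is read off the linear inequality for s.
    lo : ∀ k s B t {_ : Data.Bool.T (k * t + 24 <ᵇ B)} → B ≤ k * s + 24 → t < s
    lo k s B t {p} h = *-cancelˡ-< k t s (+-cancelʳ-< 24 (k * t) (k * s) (<-≤-trans (<ᵇ⇒< (k * t + 24) B p) h))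

    hi : ∀ k s d B t {_ : Data.Bool.T (B <ᵇ k * suc t + d)} → k * s + d ≤ B → s ≤ t
    hi k s d B t {p} h = ≤-pred (*-cancelˡ-< k s (suc t) (+-cancelʳ-< d (k * s) (k * suc t) (≤-<-trans h (<ᵇ⇒< B (k * suc t + d) p))))

    lit : ∀ {a b} {_ : Data.Bool.T (a ≤ᵇ b)} → a ≤ b
    lit {a} {b} {p} = ≤ᵇ⇒≤ a b p

  -- For m ≥ 13, `L₃` yields s ≥ 26. For every smaller m, take the least K with m ≤ 7 + 2K in `L₂`:
  -- together with `L₁` it pins s down to the listed values, or is contradictory for 7 ≤ m ≤ 10.
  shape : ∀ m s X Z → 6 ≤ m → 5 * s + X + m ≡ m * m → Z + m * m + 11 * m ≡ 24 + 13 * s → X ≤ Z →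
          (∀ K → m ≤ 7 + 2 * K → Z ≤ K * X) → 3 * X ≤ Z + 2 * s → Shape m s
  shape m s X Z 6≤m h₁ h₂ h h′ h″ = at6 (m≤n⇒m<n∨m≡n 6≤m)
    where
    at12 : 12 < m ⊎ 12 ≡ m → Shape m s
    at12 (inj₁ l) = large (lo 30 s 780 25 (≤-trans (+-mono-≤ (*-monoʳ-≤ 4 (*-mono-≤ l l)) (*-monoʳ-≤ 8 l)) (L₃ m s X Z h₁ h₂ h″)))
    at12 (inj₂ refl) = [ (λ l → m₁₂s₂₃ refl (≤-antisym (hi 28 s 60 708 23 (L₂ 12 s X Z 3 h₁ h₂ (h′ 3 lit))) l))
                         , (λ e → m₁₂s₂₂ refl (sym e)) ]′ (m≤n⇒m<n∨m≡n (lo 18 s 408 21 (L₁ 12 s X Z h₁ h₂ h)))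

    at11 : 11 < m ⊎ 11 ≡ m → Shape m s
    at11 (inj₁ l) = at12 (m≤n⇒m<n∨m≡n l)
    at11 (inj₂ refl) = m₁₁s₁₉ refl (≤-antisym (hi 23 s 46 484 19 (L₂ 11 s X Z 2 h₁ h₂ (h′ 2 lit)))
                                        (lo 18 s 352 18 (L₁ 11 s X Z h₁ h₂ h)))

    at10 : 10 < m ⊎ 10 ≡ m → Shape m s
    at10 (inj₁ l) = at11 (m≤n⇒m<n∨m≡n l)
    at10 (inj₂ refl) = contradiction (≤-trans (lo 18 s 300 15 (L₁ 10 s X Z h₁ h₂ h))
                                          (hi 23 s 44 410 15 (L₂ 10 s X Z 2 h₁ h₂ (h′ 2 lit)))) (<-irrefl refl)

    at9 : 9 < m ⊎ 9 ≡ m → Shape m s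
    at9 (inj₁ l) = at10 (m≤n⇒m<n∨m≡n l)
    at9 (inj₂ refl) = contradiction (≤-trans (lo 18 s 252 12 (L₁ 9 s X Z h₁ h₂ h))
                                          (hi 18 s 33 261 12 (L₂ 9 s X Z 1 h₁ h₂ (h′ 1 lit)))) (<-irrefl refl)

    at8 : 8 < m ⊎ 8 ≡ m → Shape m s
    at8 (inj₁ l) = at9 (m≤n⇒m<n∨m≡n l)
    at8 (inj₂ refl) = contradiction (≤-trans (lo 18 s 208 10 (L₁ 8 s X Z h₁ h₂ h))
                                          (hi 18 s 32 216 10 (L₂ 8 s X Z 1 h₁ h₂ (h′ 1 lit)))) (<-irrefl refl)

    at7 : 7 < m ⊎ 7 ≡ m → Shape m s
    at7 (inj₁ l) = at8 (m≤n⇒m<n∨m≡n l)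
    at7 (inj₂ refl) = contradiction (≤-trans (lo 18 s 168 7 (L₁ 7 s X Z h₁ h₂ h))
                                          (hi 13 s 24 126 7 (L₂ 7 s X Z 0 h₁ h₂ (h′ 0 lit)))) (<-irrefl refl)

    at6 : 6 < m ⊎ 6 ≡ m → Shape m s
    at6 (inj₁ l) = at7 (m≤n⇒m<n∨m≡n l)
    at6 (inj₂ refl) = simplex refl (≤-antisym (hi 13 s 24 102 6 (L₂ 6 s X Z 0 h₁ h₂ (h′ 0 lit)))
                                        (lo 18 s 132 5 (L₁ 6 s X Z h₁ h₂ h)))

  -- The product (d - a)(d - a - 1) of two consecutive integers is nonnegative.
  sq-lemma : ∀ a d → (2 * a + 1) * d ≤ d * d + a * (a + 1)
  sq-lemma a d with ≤-total d a
  ... | inj₁ d≤a with m≤n⇒∃[o]m+o≡n d≤a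
  ...   | e , refl = ≤-trans (m≤m+n _ (e * e + e)) (≤-reflexive (x d e))
    where
    x : ∀ d e → (2 * (d + e) + 1) * d + (e * e + e) ≡ d * d + (d + e) * (d + e + 1)
    x = solve-∀
  sq-lemma a d | inj₂ a≤d with m≤n⇒∃[o]m+o≡n a≤d
  ...   | zero , refl = ≤-reflexive (x a)
    where
    x : ∀ a → (2 * a + 1) * (a + 0) ≡ (a + 0) * (a + 0) + a * (a + 1)
    x = solve-∀
  ...   | suc e , refl = ≤-trans (m≤m+n _ (e * e + e)) (≤-reflexive (x a e))
    where
    x : ∀ a e → (2 * a + 1) * (a + suc e) + (e * e + e) ≡ (a + suc e) * (a + suc e) + a * (a + 1)
    x = solve-∀

  -- The rank in the double dual is 7 ∸ (7 ∸ ρ x), which agrees with ρ x only up to a proof.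
  op-op : ∀ P → Neighborly P → Neighborly (Dual.op (Dual.op P))
  op-op P nb hx hy x≢y with nb (back hx) (back hy) x≢y
    where
    open EulerianPoset P
    back : ∀ {x r} → 7 ∸ (7 ∸ ρ x) ≡ r → ρ x ≡ r
    back {x} h = trans (sym (7∸-inv (Intervals.ρ≤7 P x))) h
  ... | e , he , xe , ye = e , cong (λ r → 7 ∸ (7 ∸ r)) he , xe , ye

  -- Moments of the ridge sizes of a facet

  module Facet (P : EulerianPoset) (nb : Neighborly P) (conb : Neighborly (Dual.op P))
               {F : Fin (EulerianPoset.N P)} (hF : EulerianPoset.ρ P F ≡ 6) where
    open EulerianPoset P
    open Intervals P
    open Thin P
    open NB P nb
    open Simplices P nb
    open Primal P
    open Both P nb conb

    m s : ℕ
    m = c bot F 1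
    s = c bot F 5

    -- A ridge is a 4-polytope and has at least five vertices, so on ridges the truncated
    -- subtraction is exact.
    excess : X → ℕ
    excess G = c bot G 1 ∸ 5

    Σy Σy² : ℕ
    Σy  = S bot F 5 excess
    Σy² = S bot F 5 (λ G → excess G * excess G)

    5+excess : ∀ {G} → ρ G ≡ 5 → c bot G 1 ≡ 5 + excess G
    5+excess hG = sym (m+[n∸m]≡n (atoms≥′ 4 hG))

    S-affine : ∀ A B r f a b → S A B r (λ z → a + b * f z) ≡ a * c A B r + b * S A B r f
    S-affine A B r f a b = trans (S-+ A B r (λ _ → a) (λ z → b * f z))
      (cong₂ _+_ (trans (S-const A B r a) (*-comm (c A B r) a)) (S-*ˡ A B r b f))

    Σk : S bot F 5 (λ G → c bot G 1) ≡ 5 * s + Σy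
    Σk = trans (S-cong {bot} {F} {5} λ {G} _ _ hG → trans (5+excess hG) (cong (5 +_) (sym (*-identityˡ (excess G)))))
               (trans (S-affine bot F 5 excess 5 1) (cong (5 * s +_) (*-identityˡ Σy)))

    -- Each of the m vertices of `F` lies in m - 1 of its ridges, by `star-size`.
    Σk-eq : S bot F 5 (λ G → c bot G 1) + m ≡ m * m
    Σk-eq = begin
      S bot F 5 (λ G → c bot G 1) + m
        ≡⟨ cong (_+ m) (S-cong {bot} {F} {5} λ {G} _ _ _ → sym (S-one bot G 1)) ⟩
      S bot F 5 (λ G → S bot G 1 (λ _ → 1)) + m
        ≡⟨ cong (_+ m) (sym (flags bot F 1 5 (λ _ _ → 1))) ⟩
      S bot F 1 (λ v → S v F 5 (λ _ → 1)) + m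
        ≡⟨ cong (S bot F 1 (λ v → S v F 5 (λ _ → 1)) +_) (sym (S-one bot F 1)) ⟩
      S bot F 1 (λ v → S v F 5 (λ _ → 1)) + S bot F 1 (λ _ → 1)
        ≡⟨ sym (S-+ bot F 1 _ _) ⟩
      S bot F 1 (λ v → S v F 5 (λ _ → 1) + 1)
        ≡⟨ S-cong {bot} {F} {1} (λ {v} _ vF hv → trans (cong (_+ 1) (S-one v F 5)) (star-size hv hF vF)) ⟩
      S bot F 1 (λ _ → m)
        ≡⟨ S-const bot F 1 m ⟩
      m * m ∎
      where open ≡-Reasoning

    Σθ : S bot F 5 (λ G → c bot G 4) ≡ c bot F 4 * 2
    Σθ = begin
      S bot F 5 (λ G → c bot G 4)
        ≡⟨ S-cong {bot} {F} {5} (λ {G} _ _ _ → sym (S-one bot G 4)) ⟩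
      S bot F 5 (λ G → S bot G 4 (λ _ → 1))
        ≡⟨ sym (flags bot F 4 5 (λ _ _ → 1)) ⟩
      S bot F 4 (λ Y → S Y F 5 (λ _ → 1))
        ≡⟨ S-cong {bot} {F} {4} (λ {Y} _ YF hY → trans (S-one Y F 5) (thin 4 YF hY hF)) ⟩
      S bot F 4 (λ _ → 2)
        ≡⟨ S-const bot F 4 2 ⟩
      c bot F 4 * 2 ∎
      where open ≡-Reasoning

    Σk² : S bot F 5 (λ G → c bot G 1 * c bot G 1) ≡ 25 * s + 10 * Σy + Σy²
    Σk² = begin
      S bot F 5 (λ G → c bot G 1 * c bot G 1)
        ≡⟨ S-cong {bot} {F} {5} (λ {G} _ _ hG → trans (cong (λ k → k * k) (5+excess hG)) (x (excess G))) ⟩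
      S bot F 5 (λ G → 25 + 10 * excess G + excess G * excess G)
        ≡⟨ S-+ bot F 5 _ _ ⟩
      S bot F 5 (λ G → 25 + 10 * excess G) + Σy²
        ≡⟨ cong (_+ Σy²) (S-affine bot F 5 excess 25 10) ⟩
      25 * s + 10 * Σy + Σy² ∎
      where
      open ≡-Reasoning
      x : ∀ y → (5 + y) * (5 + y) ≡ 25 + 10 * y + y * y
      x = solve-∀

    -- A tetrahedron of `F` lies in exactly two ridges, and a ridge satisfies 2θ + 3k = k²; summing
    -- over the ridges ties Σk² to the number of tetrahedra.
    Σθ-eq : 2 * (c bot F 4 * 2) + 3 * (5 * s + Σy) ≡ 25 * s + 10 * Σy + Σy²
    Σθ-eq = begin
      2 * (c bot F 4 * 2) + 3 * (5 * s + Σy)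
        ≡⟨ cong₂ (λ p q → 2 * p + 3 * q) (sym Σθ) (sym Σk) ⟩
      2 * S bot F 5 (λ G → c bot G 4) + 3 * S bot F 5 (λ G → c bot G 1)
        ≡⟨ sym (cong₂ _+_ (S-*ˡ bot F 5 2 _) (S-*ˡ bot F 5 3 _)) ⟩
      S bot F 5 (λ G → 2 * c bot G 4) + S bot F 5 (λ G → 3 * c bot G 1)
        ≡⟨ sym (S-+ bot F 5 _ _) ⟩
      S bot F 5 (λ G → 2 * c bot G 4 + 3 * c bot G 1)
        ≡⟨ S-cong {bot} {F} {5} (λ {G} _ _ hG → tetrahedra {G} hG) ⟩
      S bot F 5 (λ G → c bot G 1 * c bot G 1)
        ≡⟨ Σk² ⟩
      25 * s + 10 * Σy + Σy² ∎
      where open ≡-Reasoning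

    first-moment : 5 * s + Σy + m ≡ m * m
    first-moment = trans (cong (_+ m) (sym Σk)) Σk-eq

    second-moment : Σy² + m * m + 11 * m ≡ 24 + 13 * s
    second-moment = arith-Z m s Σy Σy² (c bot F 4) first-moment Σθ-eq (facet-count hF)

    -- This is 2k ≤ m + 4, obtained from `edge-degree` in the dual: there `G` is an edge of the
    -- facet `v`, for any vertex `v` of `G`. The k - 1 edges of `G` at `v` are the dual ridges of
    -- `v` through `G`, and `v` has m dual vertices.
    excess≤ : ∀ {G} → ρ G ≡ 5 → G ⊑ F → ∀ K → m ≤ 7 + 2 * K → excess G ≤ K
    excess≤ {G} hG GF K hm = from-vertex (c-witness {bot} {G} {1} (≤-trans (s≤s z≤n) (atoms≥′ 4 hG)))
      where
      5≤7 : 5 ≤ 7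
      5≤7 = s≤s (s≤s 3≤5)
        where
        3≤5 : 3 ≤ 5
        3≤5 = s≤s (s≤s (s≤s z≤n))
      dual-degree : ∀ {v} → ρ v ≡ 1 → v ⊑ G → 2 * Intervals.c op G v 5 ≤ Intervals.c op top v 1 + 2
      dual-degree hv vG = Both.edge-degree op conb (op-op P nb) (ρᵒ-of 5 hG) (ρᵒ-of 1 hv) vG
      arith : ∀ d y → d + 1 ≡ 5 + y → 2 * d ≤ m + 2 → 2 * y < 2 * suc K
      arith d y e h = ≤-from (≤-reflexive (2 ⊗ sym e) ⊞ h ⊞ hm) (x d y m K)
        where
        x : ∀ d y m K → suc (2 * y) + (2 * (d + 1) + (m + 2) + (7 + 2 * K)) ≡ 2 * suc K + (2 * (5 + y) + 2 * d + m)
        x = solve-∀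
      from-vertex : (∃ λ v → bot ⊑ v × v ⊑ G × ρ v ≡ 1) → excess G ≤ K
      from-vertex (v , _ , vG , hv) = ≤-pred (*-cancelˡ-< 2 (excess G) (suc K) (arith (c v G 2) (excess G)
        (trans (edges-at hv vG) (5+excess hG)) (subst₂ (λ p q → 2 * p ≤ q + 2) (c-op v G 5 5≤7) (trans (c-op v top 1 1≤7)
          (coatoms-above hv hF (⊑-trans vG GF))) (dual-degree hv vG))))

    private
      y≤y² : ∀ y → y ≤ y * y
      y≤y² zero = z≤n
      y≤y² (suc y) = m≤m+n (suc y) _

    Σy≤Σy² : Σy ≤ Σy²
    Σy≤Σy² = S-mono {bot} {F} {5} (λ {G} _ _ _ → y≤y² (excess G))

    Σy²≤ : ∀ K → m ≤ 7 + 2 * K → Σy² ≤ K * Σy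
    Σy²≤ K h = ≤-trans (S-mono {bot} {F} {5} (λ {G} _ GF hG → *-monoˡ-≤ (excess G) (excess≤ hG GF K h)))
                       (≤-reflexive (S-*ˡ bot F 5 K excess))

    3Σy≤ : 3 * Σy ≤ Σy² + 2 * s
    3Σy≤ = begin
      3 * Σy ≡⟨ sym (S-*ˡ bot F 5 3 excess) ⟩
      -- `sq-lemma` at 1 is (y - 1)(y - 2) ≥ 0.
      S bot F 5 (λ G → 3 * excess G) ≤⟨ S-mono {bot} {F} {5} (λ {G} _ _ _ → sq-lemma 1 (excess G)) ⟩
      S bot F 5 (λ G → excess G * excess G + 2) ≡⟨ S-+ bot F 5 _ _ ⟩
      Σy² + S bot F 5 (λ _ → 2) ≡⟨ cong (Σy² +_) (trans (S-const bot F 5 2) (*-comm s 2)) ⟩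
      Σy² + 2 * s ∎
      where open ≤-Reasoning

    facet-shape : Shape m s
    facet-shape = shape m s Σy Σy² (atoms≥′ 5 hF) first-moment second-moment Σy≤Σy² Σy²≤ 3Σy≤

  -- Overlaps of ridges, and the exceptional sizes

  private
    -- The moments are X = 15 and Z = 29, so there are q = 7 ridges with seven vertices. Then 9 · 49
    -- = 441 exceeds 7 · 31 + 220 = 437.
    arith₁₁ : ∀ m s X Z q → m ≡ 11 → s ≡ 19 → 5 * s + X + m ≡ m * m → Z + m * m + 11 * m ≡ 24 + 13 * s →
              Z ≡ X + 2 * q → 9 * (7 * q) ≤ q * (4 * q + 3) + 20 * m → 0 < 0
    arith₁₁ _ _ X Z q refl refl h₁ h₂ h₃ = go X Z q
        (+-cancelˡ-≡ 95 X 15 (+-cancelʳ-≡ 11 (95 + X) 110 h₁)) (+-cancelʳ-≡ 121 Z 29 (+-cancelʳ-≡ 121 (Z + 121) 150 h₂)) h₃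
      where
      go : ∀ X Z q → X ≡ 15 → Z ≡ 29 → Z ≡ X + 2 * q → 9 * (7 * q) ≤ q * (4 * q + 3) + 20 * 11 → 0 < 0
      go _ _ q refl refl e h with *-cancelˡ-≡ 7 q 2 (+-cancelˡ-≡ 15 14 (2 * q) e)
      ... | refl = contradiction h (<⇒≱ (<ᵇ⇒< 437 441 _))

    -- The moments are X = 17 and Z = 47. The two bounds on Z give 13 ≤ 3q and 6q ≤ 30, so q = 5,
    -- and 7 · 40 = 280 exceeds 5 · 24 + 144 = 264.
    arith₁₂ : ∀ m s X Z q → m ≡ 12 → s ≡ 23 → 5 * s + X + m ≡ m * m → Z + m * m + 11 * m ≡ 24 + 13 * s →
              Z ≤ 2 * X + 3 * q → X + 6 * q ≤ Z → 7 * (8 * q) ≤ q * (4 * q + 4) + 12 * m → 0 < 0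
    arith₁₂ _ _ X Z q refl refl h₁ h₂ h₃ h₄ = go X Z q
        (+-cancelˡ-≡ 115 X 17 (+-cancelʳ-≡ 12 (115 + X) 132 h₁)) (+-cancelʳ-≡ 144 Z 47 (+-cancelʳ-≡ 132 (Z + 144) 191 h₂)) h₃ h₄
      where
      go : ∀ X Z q → X ≡ 17 → Z ≡ 47 → Z ≤ 2 * X + 3 * q → X + 6 * q ≤ Z → 7 * (8 * q) ≤ q * (4 * q + 4) + 12 * 12 → 0 < 0
      go _ _ q refl refl l u h with ≤-antisym
        (*-cancelˡ-≤ {q} {5} 6 (+-cancelˡ-≤ 17 (6 * q) 30 u))
        (*-cancelˡ-< 3 4 q (<-≤-trans (<ᵇ⇒< 12 13 _) (+-cancelˡ-≤ 34 13 (3 * q) l)))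
      ... | refl = contradiction h (<⇒≱ (<ᵇ⇒< 264 280 _))

    arith-gap : ∀ m s Y g → m ≡ 12 → s ≡ 22 → 5 * s + Y + m ≡ m * m → g + Y + m * m + 11 * m ≡ 24 + 13 * s → g ≤ 12
    arith-gap _ _ Y g refl refl h₁ h₂ = go Y g (+-cancelˡ-≡ 110 Y 22 (+-cancelʳ-≡ 12 (110 + Y) 132 h₁))
        (+-cancelʳ-≡ 144 (g + Y) 34 (+-cancelʳ-≡ 132 (g + Y + 144) 178 h₂))
      where
      go : ∀ Y g → Y ≡ 22 → g + Y ≡ 34 → g ≤ 12
      go _ g refl e = ≤-reflexive (+-cancelʳ-≡ 22 g 12 e)

    -- All quantities but g are forced: X = 22, c₂ = 66, c₄ = 102, Y = 72, h₁ = 1452, h₄ = 408. With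
    -- g ≤ 72 the Bonferroni inequality would say 2676 ≤ 2668.
    arith₂₂ : ∀ m s X c₂ c₄ Y g h₁ h₂ h₄ → m ≡ 12 → s ≡ 22 → 5 * s + X + m ≡ m * m →
              2 * c₄ + 9 * m + 6 * s ≡ 12 + 3 * (m * m) → 2 * c₂ + m ≡ m * m → 4 * c₂ + Y ≡ 5 * s + X + c₄ * 2 →
              h₂ ≡ 16 * c₂ + 9 * Y + g → 2 * g ≤ 12 * m → h₁ + 2 * (m * m) ≡ m + m * (m * m) → h₄ ≡ c₄ * 4 →
              h₁ + 3 * h₄ ≤ h₂ + s * s + 2 * (c₄ * 2) → 0 < 0
    arith₂₂ _ _ X c₂ c₄ Y g h₁ h₂ h₄ refl refl e₁ e₂ e₃ e₄ e₅ e₆ e₇ e₈ e₉ =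
      go X c₂ c₄ Y g h₁ h₂ h₄ (+-cancelˡ-≡ 110 X 22 (+-cancelʳ-≡ 12 (110 + X) 132 e₁))
        (*-cancelˡ-≡ c₄ 102 2 (+-cancelʳ-≡ 108 (2 * c₄) 204 (+-cancelʳ-≡ 132 (2 * c₄ + 108) 312 e₂)))
        (*-cancelˡ-≡ c₂ 66 2 (+-cancelʳ-≡ 12 (2 * c₂) 132 e₃)) e₄ e₅ (*-cancelˡ-≤ {g} {72} 2 e₆)
        (+-cancelʳ-≡ 288 h₁ 1452 e₇) e₈ e₉
      where
      go : ∀ X c₂ c₄ Y g h₁ h₂ h₄ → X ≡ 22 → c₄ ≡ 102 → c₂ ≡ 66 → 4 * c₂ + Y ≡ 110 + X + c₄ * 2 →
           h₂ ≡ 16 * c₂ + 9 * Y + g → g ≤ 72 → h₁ ≡ 1452 → h₄ ≡ c₄ * 4 → h₁ + 3 * h₄ ≤ h₂ + 484 + 2 * (c₄ * 2) → 0 < 0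
      go _ _ _ Y g _ _ _ refl refl refl e₄ refl l refl refl h with +-cancelˡ-≡ 264 Y 72 e₄
      ... | refl = contradiction (≤-trans h (+-monoˡ-≤ 408 (+-monoˡ-≤ 484 (+-monoʳ-≤ 1704 l)))) (<⇒≱ (<ᵇ⇒< 2668 2676 _))

    pieces : ∀ c₂ k θ → 2 * θ + 3 * k ≡ k * k → 2 * c₂ + k ≡ k * k → c₂ ≡ k + θ
    pieces c₂ k θ h₁ h₂ = *-cancelˡ-≡ c₂ (k + θ) 2 (≡-from (sym h₁ ⊕ h₂) (x c₂ k θ))
      where
      x : ∀ c₂ k θ → 2 * c₂ + (2 * θ + 3 * k + k * k) ≡ 2 * (k + θ) + (k * k + (2 * c₂ + k))
      x = solve-∀

  -- `between` chooses a middle element for four given ones only. Counting the common faces of two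
  -- ridges takes a genuine meet, which for a polytope is the intersection of vertex sets.
  module Packing (P : EulerianPoset) (nb : Neighborly P) (conb : Neighborly (Dual.op P))
    (meet : Fin (EulerianPoset.N P) → Fin (EulerianPoset.N P) → Fin (EulerianPoset.N P))
    (meet-ˡ : ∀ x y → EulerianPoset._⊑_ P (meet x y) x)
    (meet-ʳ : ∀ x y → EulerianPoset._⊑_ P (meet x y) y)
    (meet-glb : ∀ {x y z} → EulerianPoset._⊑_ P z x → EulerianPoset._⊑_ P z y → EulerianPoset._⊑_ P z (meet x y)) where
    open EulerianPoset P
    open Intervals P
    open Thin P
    open Edges P
    open NB P nb
    open Simplices P nb
    open Primal P
    open Both P nb conb

    c-above : ∀ {z} r → ρ z < r → c bot z r ≡ 0
    c-above {z} r h = c-zero λ _ q s → <⇒≱ h (subst (_≤ ρ z) s (ρ-mono q))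

    atoms≤4 : ∀ {z} r → ρ z ≡ r → r ≤ 4 → c bot z 1 ≤ 4
    atoms≤4 0 h _ = ≤-trans (≤-reflexive (c-above 1 (≤-reflexive (cong suc h)))) z≤n
    atoms≤4 {z} 1 h _ = ≤-trans (≤-reflexive (subst (λ r → c bot z r ≡ 1) h (c-hi (bot-min z)))) (s≤s z≤n)
    atoms≤4 2 h _ = ≤-trans (≤-reflexive (T2 h)) (s≤s (s≤s z≤n))
    atoms≤4 3 h _ = ≤-trans (≤-reflexive (tri₁ h)) (s≤s (s≤s (s≤s z≤n)))
    atoms≤4 4 h _ = ≤-reflexive (tet₁ h)
    atoms≤4 (suc (suc (suc (suc (suc _))))) h (s≤s (s≤s (s≤s (s≤s ()))))

    -- Bonferroni: 1 - i + C(i , 2) ≥ 3 [i = 4] for the number i of common vertices.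
    bonferroni-pt : ∀ {z} r → ρ z ≡ r → r ≤ 4 → c bot z 1 + 3 * c bot z 4 ≤ c bot z 2 + 1
    bonferroni-pt 0 h _ = ≤-trans (≤-reflexive (cong₂ (λ p q → p + 3 * q) (c-above 1 (≤-reflexive (cong suc h)))
      (c-above 4 (≤-trans (≤-reflexive (cong suc h)) (s≤s z≤n))))) z≤n
    bonferroni-pt {z} 1 h _ = ≤-trans (≤-reflexive (cong₂ (λ p q → p + 3 * q) (subst (λ r → c bot z r ≡ 1) h (c-hi (bot-min z)))
      (c-above 4 (≤-trans (≤-reflexive (cong suc h)) (s≤s (s≤s z≤n)))))) (m≤n+m 1 _)
    bonferroni-pt {z} 2 h _ = ≤-reflexive (trans (cong₂ (λ p q → p + 3 * q) (T2 h)
      (c-above 4 (≤-trans (≤-reflexive (cong suc h)) (s≤s (s≤s (s≤s z≤n)))))) (cong (_+ 1) (sym (subst (λ r → c bot z r ≡ 1) h (c-hi (bot-min z))))))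
    bonferroni-pt {z} 3 h _ = ≤-trans (≤-reflexive (cong₂ (λ p q → p + 3 * q) (tri₁ h) (c-above 4 (≤-reflexive (cong suc h)))))
      (≤-trans (n≤1+n 3) (≤-reflexive (cong (_+ 1) (sym (tri₂ h)))))
    bonferroni-pt {z} 4 h _ = ≤-reflexive (trans (cong₂ (λ p q → p + 3 * q) (tet₁ h) (subst (λ r → c bot z r ≡ 1) h (c-hi (bot-min z))))
      (cong (_+ 1) (sym (tet₂ h))))
    bonferroni-pt (suc (suc (suc (suc (suc _))))) h (s≤s (s≤s (s≤s (s≤s ()))))

    meet-self : ∀ x → meet x x ≡ x
    meet-self x = antisym (meet-ˡ x x) (meet-glb ⊑-refl ⊑-refl)

    meet-rank : ∀ {G G′} → ρ G ≡ 5 → ρ G′ ≡ 5 → G′ ≢ G → ρ (meet G G′) ≤ 4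
    meet-rank {G} {G′} hG hG′ ne = ≤-pred (subst (ρ (meet G G′) <_) hG (ρ-strict (meet-ˡ G G′) λ e →
      ne (sym (same-rank (subst (_⊑ G′) e (meet-ʳ G G′)) (≤-reflexive (trans hG′ (sym hG)))))))

    edges-pieces : ∀ {G} → ρ G ≡ 5 → c bot G 2 ≡ c bot G 1 + c bot G 4
    edges-pieces {G} hG = pieces (c bot G 2) (c bot G 1) (c bot G 4) (tetrahedra hG) (edges G)

    module _ {F : X} (hF : ρ F ≡ 6) where
      open Facet P nb conb hF

      private
        swap-pt : ∀ G r x G′ → W bot G r x * W x F 5 G′ ≡ W bot F 5 G′ * W bot (meet G G′) r x
        swap-pt G r x G′ = go (view bot G r x) (view x F 5 G′) (view bot F 5 G′) (view bot (meet G G′) r x)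
          where
          go : View bot G r x → View x F 5 G′ → View bot F 5 G′ → View bot (meet G G′) r x →
               W bot G r x * W x F 5 G′ ≡ W bot F 5 G′ * W bot (meet G G′) r x
          go (in- _ _ _ e₁) (in- _ _ _ e₂) (in- _ _ _ e₃) (in- _ _ _ e₄) rewrite e₁ | e₂ | e₃ | e₄ = refl
          go (in- _ xG hx _) (in- xG′ _ _ _) _ (out- n _) = contradiction (bot-min x , meet-glb xG xG′ , hx) n
          go _ (in- _ G′F h _) (out- n _) _ = contradiction (bot-min G′ , G′F , h) n
          go (out- n _) _ _ (in- _ xm hx _) = contradiction (bot-min x , ⊑-trans xm (meet-ˡ G G′) , hx) n
          go _ (out- n _) (in- _ G′F h _) (in- _ xm _ _) = contradiction (⊑-trans xm (meet-ʳ G G′) , G′F , h) n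
          go (out- _ e₁) _ (out- _ e₃) _ rewrite e₁ | e₃ = refl
          go (out- _ e₁) _ _ (out- _ e₄) rewrite e₁ | e₄ = sym (*-zeroʳ (W bot F 5 G′))
          go _ (out- _ e₂) (out- _ e₃) _ rewrite e₂ | e₃ = *-zeroʳ (W bot G r x)
          go _ (out- _ e₂) _ (out- _ e₄) rewrite e₂ | e₄ = trans (*-zeroʳ (W bot G r x)) (sym (*-zeroʳ (W bot F 5 G′)))

      S-meet : ∀ G r f → S bot G r (λ x → S x F 5 f) ≡ S bot F 5 (λ G′ → f G′ * c bot (meet G G′) r)
      S-meet G r f = begin
        sum (λ x → W bot G r x * sum (λ G′ → W x F 5 G′ * f G′))
          ≡⟨ sum-cong-≗ (λ x → *-distribˡ-sum (W bot G r x) (λ G′ → W x F 5 G′ * f G′)) ⟩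
        sum (λ x → sum (λ G′ → W bot G r x * (W x F 5 G′ * f G′)))
          ≡⟨ ∑-comm (λ x G′ → W bot G r x * (W x F 5 G′ * f G′)) ⟩
        sum (λ G′ → sum (λ x → W bot G r x * (W x F 5 G′ * f G′)))
          ≡⟨ sum-cong-≗ (λ G′ → sum-cong-≗ (λ x → pt x G′)) ⟩
        sum (λ G′ → sum (λ x → W bot F 5 G′ * f G′ * W bot (meet G G′) r x))
          ≡⟨ sum-cong-≗ (λ G′ → trans (sym (*-distribˡ-sum (W bot F 5 G′ * f G′) (W bot (meet G G′) r)))
                                      (*-assoc (W bot F 5 G′) (f G′) (c bot (meet G G′) r))) ⟩
        sum (λ G′ → W bot F 5 G′ * (f G′ * c bot (meet G G′) r)) ∎
        where
        open ≡-Reasoning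
        pt : ∀ x G′ → W bot G r x * (W x F 5 G′ * f G′) ≡ W bot F 5 G′ * f G′ * W bot (meet G G′) r x
        pt x G′ = trans (sym (*-assoc (W bot G r x) (W x F 5 G′) (f G′)))
                 (trans (cong (_* f G′) (swap-pt G r x G′)) (exch (W bot F 5 G′) (W bot (meet G G′) r x) (f G′)))
          where
          exch : ∀ a b d → a * b * d ≡ a * d * b
          exch = solve-∀

      -- The square is expanded over pairs of ridges through x. Such an x is a face below the meet
      -- of the two ridges, so each pair counts the faces of its meet.
      moment : ∀ r f → S bot F r (λ x → S x F 5 f * S x F 5 f)
                     ≡ S bot F 5 (λ G → f G * S bot F 5 (λ G′ → f G′ * c bot (meet G G′) r))
      moment r f = begin
        S bot F r (λ x → S x F 5 f * S x F 5 f)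
          ≡⟨ S-cong {bot} {F} {r} (λ {x} _ _ _ → sym (S-*ˡ x F 5 (S x F 5 f) f)) ⟩
        S bot F r (λ x → S x F 5 (λ G → S x F 5 f * f G))
          ≡⟨ flags bot F r 5 (λ x G → S x F 5 f * f G) ⟩
        S bot F 5 (λ G → S bot G r (λ x → S x F 5 f * f G))
          ≡⟨ S-cong {bot} {F} {5} (λ {G} _ _ _ → trans (S-cong {bot} {G} {r} (λ {x} _ _ _ → *-comm (S x F 5 f) (f G)))
               (trans (S-*ˡ bot G r (f G) (λ x → S x F 5 f)) (cong (f G *_) (S-meet G r f)))) ⟩
        S bot F 5 (λ G → f G * S bot F 5 (λ G′ → f G′ * c bot (meet G G′) r)) ∎
        where open ≡-Reasoning

      -- Second moment of the number of G with 5 + j vertices at a vertex of F; distinct G share at most four vertices.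
      packing : ∀ j a → let q = S bot F 5 (λ G → ⟦ excess G ≟ j ⟧) in
                (2 * a + 1) * ((5 + j) * q) ≤ q * (4 * q + (1 + j)) + a * (a + 1) * m
      packing j a = begin
        (2 * a + 1) * ((5 + j) * q)
          ≡⟨ cong ((2 * a + 1) *_) (sym Σd) ⟩
        (2 * a + 1) * S bot F 1 (λ v → S v F 5 f)
          ≡⟨ sym (S-*ˡ bot F 1 (2 * a + 1) _) ⟩
        S bot F 1 (λ v → (2 * a + 1) * S v F 5 f)
          ≤⟨ S-mono {bot} {F} {1} (λ {v} _ _ _ → sq-lemma a (S v F 5 f)) ⟩
        S bot F 1 (λ v → S v F 5 f * S v F 5 f + a * (a + 1))
          ≡⟨ S-+ bot F 1 _ _ ⟩
        S bot F 1 (λ v → S v F 5 f * S v F 5 f) + S bot F 1 (λ _ → a * (a + 1))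
          ≡⟨ cong₂ _+_ (moment 1 f) (trans (S-const bot F 1 (a * (a + 1))) (*-comm m (a * (a + 1)))) ⟩
        S bot F 5 (λ G → f G * S bot F 5 (λ G′ → f G′ * c bot (meet G G′) 1)) + a * (a + 1) * m
          ≤⟨ +-monoˡ-≤ (a * (a + 1) * m) (S-mono {bot} {F} {5} (λ {G} _ GF hG → row G GF hG)) ⟩
        S bot F 5 (λ G → (4 * q + (1 + j)) * f G) + a * (a + 1) * m
          ≡⟨ cong (_+ a * (a + 1) * m) (trans (S-*ˡ bot F 5 (4 * q + (1 + j)) f) (*-comm (4 * q + (1 + j)) q)) ⟩
        q * (4 * q + (1 + j)) + a * (a + 1) * m ∎
        where
        open ≤-Reasoning
        f : X → ℕ
        f G = ⟦ excess G ≟ j ⟧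
        q : ℕ
        q = S bot F 5 f
        on-support : ∀ {k y} (d : Dec (y ≡ j)) → k ≡ 5 + y → k * ⟦ d ⟧ ≡ (5 + j) * ⟦ d ⟧
        on-support (yes refl) e = cong (_* 1) e
        on-support {k} (no _) _ = trans (*-zeroʳ k) (sym (*-zeroʳ (5 + j)))
        Σd : S bot F 1 (λ v → S v F 5 f) ≡ (5 + j) * q
        Σd = trans (flags bot F 1 5 (λ _ G → f G))
            (trans (S-cong {bot} {F} {5} λ {G} _ _ hG → trans (S-const bot G 1 (f G)) (on-support (excess G ≟ j) (5+excess hG)))
                   (S-*ˡ bot F 5 (5 + j) f))
        -- Distinct ridges share at most four vertices, whereas `G` shares 5 + j = 4 + (1 + j) with
        -- itself.
        cell : ∀ {G G′} → ρ G ≡ 5 → excess G ≡ j → ρ G′ ≡ 5 → f G′ * c bot (meet G G′) 1 ≤ 4 * f G′ + ⟦ G′ FinP.≟ G ⟧ * (1 + j)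
        cell {G} {G′} hG e hG′ = go (G′ FinP.≟ G)
          where
          go : (d : Dec (G′ ≡ G)) → f G′ * c bot (meet G G′) 1 ≤ 4 * f G′ + ⟦ d ⟧ * (1 + j)
          go (yes refl) = ≤-reflexive (trans (cong₂ _*_ f1 (trans (cong (λ z → c bot z 1) (meet-self G)) (trans (5+excess hG) (cong (5 +_) e))))
              (trans (x j) (cong (λ t → 4 * t + 1 * (1 + j)) (sym f1))))
            where
            f1 : f G ≡ 1
            f1 = ⟦⟧-yes (excess G ≟ j) e
            x : ∀ j → 1 * (5 + j) ≡ 4 * 1 + 1 * (1 + j)
            x = solve-∀
          go (no ne) = ≤-trans (≤-trans (*-monoʳ-≤ (f G′) (atoms≤4 _ refl (meet-rank hG hG′ ne))) (≤-reflexive (*-comm (f G′) 4))) (m≤m+n _ 0)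
        row : ∀ G → G ⊑ F → ρ G ≡ 5 → f G * S bot F 5 (λ G′ → f G′ * c bot (meet G G′) 1) ≤ (4 * q + (1 + j)) * f G
        row G GF hG = go (excess G ≟ j)
          where
          go : (d : Dec (excess G ≡ j)) → ⟦ d ⟧ * S bot F 5 (λ G′ → f G′ * c bot (meet G G′) 1) ≤ (4 * q + (1 + j)) * ⟦ d ⟧
          go (no _) = z≤n
          go (yes e) = ≤-trans (≤-reflexive (+0 _)) (≤-trans
            (S-mono {bot} {F} {5} (λ {G′} _ _ hG′ → cell {G} {G′} hG e hG′))
            (≤-reflexive (trans (S-+ bot F 5 _ _) (trans
              (cong₂ _+_ (S-*ˡ bot F 5 4 f) (S-at {bot} {F} {5} G (λ _ → 1 + j) (bot-min G) GF hG)) (sym (*-identityʳ _))))))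

      -- The sum of `bonferroni-pt` over ordered pairs of ridges, where `moment` turns common faces
      -- into squares. A ridge paired with itself has k vertices, k + θ edges and θ tetrahedra, so
      -- the inequality needs the extra 2θ on the diagonal.
      bonferroni : let h = λ r → S bot F r (λ x → c x F 5 * c x F 5) in
                   h 1 + 3 * h 4 ≤ h 2 + s * s + 2 * (c bot F 4 * 2)
      bonferroni = begin
        h 1 + 3 * h 4
          ≡⟨ cong₂ (λ p q → p + 3 * q) (moment₁ 1) (moment₁ 4) ⟩
        M 1 + 3 * M 4
          ≡⟨ cong (M 1 +_) (sym (S-*ˡ bot F 5 3 _)) ⟩
        M 1 + S bot F 5 (λ G → 3 * R G 4)
          ≡⟨ sym (S-+ bot F 5 _ _) ⟩
        S bot F 5 (λ G → R G 1 + 3 * R G 4)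
          ≤⟨ S-mono {bot} {F} {5} (λ {G} _ GF hG → row G GF hG) ⟩
        S bot F 5 (λ G → R G 2 + s + 2 * c bot G 4)
          ≡⟨ S-+ bot F 5 _ _ ⟩
        S bot F 5 (λ G → R G 2 + s) + S bot F 5 (λ G → 2 * c bot G 4)
          ≡⟨ cong₂ _+_ (trans (S-+ bot F 5 _ _) (cong (M 2 +_) (S-const bot F 5 s)))
                       (trans (S-*ˡ bot F 5 2 _) (cong (2 *_) Σθ)) ⟩
        M 2 + s * s + 2 * (c bot F 4 * 2)
          ≡⟨ cong (λ t → t + s * s + 2 * (c bot F 4 * 2)) (sym (moment₁ 2)) ⟩
        h 2 + s * s + 2 * (c bot F 4 * 2) ∎
        where
        open ≤-Reasoning
        h : ℕ → ℕ
        h r = S bot F r (λ x → c x F 5 * c x F 5)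
        R : X → ℕ → ℕ
        R G r = S bot F 5 (λ G′ → c bot (meet G G′) r)
        M : ℕ → ℕ
        M r = S bot F 5 (λ G → R G r)
        moment₁ : ∀ r → h r ≡ M r
        moment₁ r = trans (S-cong {bot} {F} {r} (λ {x} _ _ _ → sym (cong₂ _*_ (S-one x F 5) (S-one x F 5))))
                   (trans (moment r (λ _ → 1))
                   (S-cong {bot} {F} {5} (λ {G} _ _ _ → trans (*-identityˡ _)
                     (S-cong {bot} {F} {5} (λ {G′} _ _ _ → *-identityˡ (c bot (meet G G′) r))))))
        cell : ∀ {G G′} → ρ G ≡ 5 → ρ G′ ≡ 5 →
               c bot (meet G G′) 1 + 3 * c bot (meet G G′) 4 ≤ c bot (meet G G′) 2 + 1 + ⟦ G′ FinP.≟ G ⟧ * (2 * c bot G 4)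
        cell {G} {G′} hG hG′ = go (G′ FinP.≟ G)
          where
          go : (d : Dec (G′ ≡ G)) →
               c bot (meet G G′) 1 + 3 * c bot (meet G G′) 4 ≤ c bot (meet G G′) 2 + 1 + ⟦ d ⟧ * (2 * c bot G 4)
          go (no ne) = ≤-trans (bonferroni-pt _ refl (meet-rank hG hG′ ne)) (m≤m+n _ 0)
          go (yes refl) = subst (λ z → c bot z 1 + 3 * c bot z 4 ≤ c bot z 2 + 1 + 1 * (2 * c bot G 4)) (sym (meet-self G))
            (≤-trans (n≤1+n _) (≤-reflexive (trans (x (c bot G 1) (c bot G 4)) (cong (λ t → t + 1 + 1 * (2 * c bot G 4)) (sym (edges-pieces hG))))))
            where
            x : ∀ k θ → suc (k + 3 * θ) ≡ k + θ + 1 + 1 * (2 * θ)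
            x = solve-∀
        row : ∀ G → G ⊑ F → ρ G ≡ 5 → R G 1 + 3 * R G 4 ≤ R G 2 + s + 2 * c bot G 4
        row G GF hG = begin
          R G 1 + 3 * R G 4
            ≡⟨ cong (R G 1 +_) (sym (S-*ˡ bot F 5 3 _)) ⟩
          R G 1 + S bot F 5 (λ G′ → 3 * c bot (meet G G′) 4)
            ≡⟨ sym (S-+ bot F 5 _ _) ⟩
          S bot F 5 (λ G′ → c bot (meet G G′) 1 + 3 * c bot (meet G G′) 4)
            ≤⟨ S-mono {bot} {F} {5} (λ {G′} _ _ hG′ → cell {G} {G′} hG hG′) ⟩
          S bot F 5 (λ G′ → c bot (meet G G′) 2 + 1 + ⟦ G′ FinP.≟ G ⟧ * (2 * c bot G 4))
            ≡⟨ S-+ bot F 5 _ _ ⟩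
          S bot F 5 (λ G′ → c bot (meet G G′) 2 + 1) + S bot F 5 (λ G′ → ⟦ G′ FinP.≟ G ⟧ * (2 * c bot G 4))
            ≡⟨ cong₂ _+_ (trans (S-+ bot F 5 _ _) (cong (R G 2 +_) (S-one bot F 5)))
                         (S-at {bot} {F} {5} G (λ _ → 2 * c bot G 4) (bot-min G) GF hG) ⟩
          R G 2 + s + 2 * c bot G 4 ∎

      -- Every other facet meets `F` in a ridge of its own, and there are as many facets as
      -- vertices.
      coatom-count : s + 1 ≡ c bot top 1
      coatom-count = trans (co-edges-at hF (bot-min F)) (dual⇒equal P nb conb)

      excessᵒ : X → ℕ
      excessᵒ e = c e top 6 ∸ 5

      facets-at-edge : ∀ {e} → ρ e ≡ 2 → e ⊑ F → c e F 5 ≡ 4 + excessᵒ e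
      facets-at-edge {e} he eF = +-cancelʳ-≡ 1 _ _ (trans (co-edges-at hF eF)
        (trans (sym (m+[n∸m]≡n five)) (x (excessᵒ e))))
        where
        five : 5 ≤ c e top 6
        five = subst (5 ≤_) (c-op e top 1 1≤7) (Simplices.atoms≥′ op conb 4 (ρᵒ-of 2 he))
        x : ∀ y → 5 + y ≡ 4 + y + 1
        x = solve-∀

      -- This is y(y - 1), never truncated. Being nonnegative, its sum over the edges of `F` at a
      -- vertex is at most the sum over all edges at that vertex, which the dual moments determine.
      gap : X → ℕ
      gap e = excessᵒ e * excessᵒ e ∸ excessᵒ e

      gap+ : ∀ e → gap e + excessᵒ e ≡ excessᵒ e * excessᵒ e
      gap+ e = m∸n+n≡m (y≤y² (excessᵒ e))
        where
        y≤y² : ∀ y → y ≤ y * y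
        y≤y² zero = z≤n
        y≤y² (suc y) = m≤m+n (suc y) _

      module _ {v : X} (hv : ρ v ≡ 1) (vF : v ⊑ F) where
        private
          module V = Facet op conb (op-op P nb) {v} (ρᵒ-of 1 hv)

          m° : V.m ≡ m
          m° = trans (c-op v top 1 1≤7) (coatoms-above hv hF vF)

          s° : V.s ≡ s
          s° = trans (c-op v top 5 (s≤s (s≤s 3≤5))) (+-cancelʳ-≡ 1 _ _ (trans (edges-at hv (top-max v)) (sym coatom-count)))
            where
            3≤5 : 3 ≤ 5
            3≤5 = s≤s (s≤s (s≤s z≤n))

          excess° : ∀ e → V.excess e ≡ excessᵒ e
          excess° e = cong (_∸ 5) (c-op e top 1 1≤7)

          5≤7 : 5 ≤ 7
          5≤7 = s≤s (s≤s (s≤s (s≤s (s≤s z≤n))))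

          Σy° : V.Σy ≡ S v top 2 excessᵒ
          Σy° = trans (S-op v top 5 V.excess 5≤7) (S-cong {v} {top} {2} (λ {e} _ _ _ → excess° e))

          Σy²° : V.Σy² ≡ S v top 2 (λ e → excessᵒ e * excessᵒ e)
          Σy²° = trans (S-op v top 5 (λ e → V.excess e * V.excess e) 5≤7)
                       (S-cong {v} {top} {2} (λ {e} _ _ _ → cong₂ _*_ (excess° e) (excess° e)))

        -- The vertex `v` is a facet of the dual with the same m and s; its ridges there are the
        -- edges at `v`, of size the number of facets through the edge.
        dual-first : 5 * s + S v top 2 excessᵒ + m ≡ m * m
        dual-first = trans (cong₂ (λ p q → p + q) (cong₂ (λ p q → 5 * p + q) (sym s°) (sym Σy°)) (sym m°))
                    (trans V.first-moment (cong₂ _*_ m° m°))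

        dual-second : S v top 2 gap + S v top 2 excessᵒ + m * m + 11 * m ≡ 24 + 13 * s
        dual-second = trans (cong₂ _+_ (cong₂ _+_ (trans (sym (S-+ v top 2 gap excessᵒ))
                        (trans (S-cong {v} {top} {2} (λ {e} _ _ _ → gap+ e)) (sym Σy²°))) (sym (cong₂ _*_ m° m°))) (cong (11 *_) (sym m°)))
                     (trans V.second-moment (cong (λ t → 24 + 13 * t) s°))

      S-mono-top : ∀ {v r} f → S v F r f ≤ S v top r f
      S-mono-top {v} {r} f = sum-mono λ z → *-monoˡ-≤ (f z) (pt z)
        where
        pt : ∀ z → W v F r z ≤ W v top r z
        pt z with view v F r z
        ... | in- p q s w rewrite w | W-yes {v} {top} {r} {z} p (top-max z) s = ≤-refl
        ... | out- _ w rewrite w = z≤n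

      -- Every edge of `F` is seen from its two endpoints.
      Σgap≤ : ∀ g → (∀ {v} → ρ v ≡ 1 → v ⊑ F → S v top 2 gap ≤ g) → 2 * S bot F 2 gap ≤ g * m
      Σgap≤ g h = begin
        2 * S bot F 2 gap
          ≡⟨ sym (S-*ˡ bot F 2 2 gap) ⟩
        S bot F 2 (λ e → 2 * gap e)
          ≡⟨ S-cong {bot} {F} {2} (λ {e} _ _ he → trans (cong (_* gap e) (sym (T2 he))) (sym (S-const bot e 1 (gap e)))) ⟩
        S bot F 2 (λ e → S bot e 1 (λ _ → gap e))
          ≡⟨ sym (flags bot F 1 2 (λ _ e → gap e)) ⟩
        S bot F 1 (λ v → S v F 2 gap)
          ≤⟨ S-mono {bot} {F} {1} (λ {v} _ vF hv → ≤-trans (S-mono-top {v} gap) (h hv vF)) ⟩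
        S bot F 1 (λ _ → g)
          ≡⟨ trans (S-const bot F 1 g) (*-comm m g) ⟩
        g * m ∎
        where open ≤-Reasoning

      -- Pairs of an edge and a ridge of `F`: there are `4 + excessᵒ e` ridges at an edge, and k + θ
      -- edges on a ridge.
      Σh : 4 * c bot F 2 + S bot F 2 excessᵒ ≡ 5 * s + Σy + c bot F 4 * 2
      Σh = begin
        4 * c bot F 2 + S bot F 2 excessᵒ
          ≡⟨ cong (4 * c bot F 2 +_) (sym (*-identityˡ _)) ⟩
        4 * c bot F 2 + 1 * S bot F 2 excessᵒ
          ≡⟨ sym (S-affine bot F 2 excessᵒ 4 1) ⟩
        S bot F 2 (λ e → 4 + 1 * excessᵒ e)
          ≡⟨ S-cong {bot} {F} {2} (λ {e} _ eF he → trans (cong (4 +_) (*-identityˡ _)) (trans (sym (facets-at-edge he eF)) (sym (S-one e F 5)))) ⟩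
        S bot F 2 (λ e → S e F 5 (λ _ → 1))
          ≡⟨ flags bot F 2 5 (λ _ _ → 1) ⟩
        S bot F 5 (λ G → S bot G 2 (λ _ → 1))
          ≡⟨ S-cong {bot} {F} {5} (λ {G} _ _ hG → trans (S-one bot G 2) (edges-pieces hG)) ⟩
        S bot F 5 (λ G → c bot G 1 + c bot G 4)
          ≡⟨ S-+ bot F 5 _ _ ⟩
        S bot F 5 (λ G → c bot G 1) + S bot F 5 (λ G → c bot G 4)
          ≡⟨ cong₂ _+_ Σk Σθ ⟩
        5 * s + Σy + c bot F 4 * 2 ∎
        where open ≡-Reasoning

      Σh² : S bot F 2 (λ e → c e F 5 * c e F 5) ≡ 16 * c bot F 2 + 9 * S bot F 2 excessᵒ + S bot F 2 gap
      Σh² = begin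
        S bot F 2 (λ e → c e F 5 * c e F 5)
          ≡⟨ S-cong {bot} {F} {2} (λ {e} _ eF he → trans (cong (λ h → h * h) (facets-at-edge he eF))
               (trans (x (excessᵒ e)) (trans (cong (16 + 8 * excessᵒ e +_) (sym (gap+ e))) (x′ (excessᵒ e) (gap e))))) ⟩
        S bot F 2 (λ e → 16 + 9 * excessᵒ e + gap e)
          ≡⟨ S-+ bot F 2 _ _ ⟩
        S bot F 2 (λ e → 16 + 9 * excessᵒ e) + S bot F 2 gap
          ≡⟨ cong (_+ S bot F 2 gap) (S-affine bot F 2 excessᵒ 16 9) ⟩
        16 * c bot F 2 + 9 * S bot F 2 excessᵒ + S bot F 2 gap ∎
        where
        open ≡-Reasoning
        x : ∀ y → (4 + y) * (4 + y) ≡ 16 + 8 * y + y * y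
        x = solve-∀
        x′ : ∀ y g → 16 + 8 * y + (g + y) ≡ 16 + 9 * y + g
        x′ = solve-∀

      Σstars : S bot F 1 (λ v → c v F 5 * c v F 5) + 2 * (m * m) ≡ m + m * (m * m)
      Σstars = begin
        S bot F 1 (λ v → c v F 5 * c v F 5) + 2 * (m * m)
          ≡⟨ cong (S bot F 1 (λ v → c v F 5 * c v F 5) +_) (trans (x m) (sym (S-const bot F 1 (2 * m)))) ⟩
        S bot F 1 (λ v → c v F 5 * c v F 5) + S bot F 1 (λ _ → 2 * m)
          ≡⟨ sym (S-+ bot F 1 _ _) ⟩
        S bot F 1 (λ v → c v F 5 * c v F 5 + 2 * m)
          ≡⟨ S-cong {bot} {F} {1} (λ {v} _ vF hv → x′ (c v F 5) m (star-size hv hF vF)) ⟩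
        S bot F 1 (λ _ → 1 + m * m)
          ≡⟨ trans (S-const bot F 1 (1 + m * m)) (*-distribˡ-+ m 1 (m * m)) ⟩
        m * 1 + m * (m * m)
          ≡⟨ cong (_+ m * (m * m)) (*-identityʳ m) ⟩
        m + m * (m * m) ∎
        where
        open ≡-Reasoning
        x : ∀ m → 2 * (m * m) ≡ m * (2 * m)
        x = solve-∀
        x′ : ∀ h m → h + 1 ≡ m → h * h + 2 * m ≡ 1 + m * m
        x′ h _ refl = x″ h
          where
          x″ : ∀ h → h * h + 2 * (h + 1) ≡ 1 + (h + 1) * (h + 1)
          x″ = solve-∀

      Σtet : S bot F 4 (λ Y → c Y F 5 * c Y F 5) ≡ c bot F 4 * 4
      Σtet = trans (S-cong {bot} {F} {4} (λ {Y} _ YF hY → cong₂ _*_ (thin 4 YF hY hF) (thin 4 YF hY hF))) (S-const bot F 4 4)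

      not₁₁ : m ≡ 11 → s ≡ 19 → 0 < 0
      -- A vertex of `F` lies on average in 7q/m = 49/11 of the ridges with seven vertices; the
      -- strongest choice in `packing` is the integer part 4.
      not₁₁ hm hs = arith₁₁ m s Σy Σy² q hm hs first-moment second-moment Σy²≡ (packing 2 4)
        where
        q = S bot F 5 (λ G → ⟦ excess G ≟ 2 ⟧)
        pt : ∀ y → y ≤ 2 → y * y ≡ y + 2 * ⟦ y ≟ 2 ⟧
        pt 0 _ = refl
        pt 1 _ = refl
        pt 2 _ = refl
        pt (suc (suc (suc _))) (s≤s (s≤s ()))
        Σy²≡ : Σy² ≡ Σy + 2 * q
        Σy²≡ = trans (S-cong {bot} {F} {5} (λ {G} _ GF hG → pt (excess G) (excess≤ {G} hG GF 2 (≤-reflexive hm))))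
              (trans (S-+ bot F 5 _ _) (cong (Σy +_) (S-*ˡ bot F 5 2 _)))

      not₁₂,₂₃ : m ≡ 12 → s ≡ 23 → 0 < 0
      -- Here the average is 8q/m = 40/12, with integer part 3.
      not₁₂,₂₃ hm hs = arith₁₂ m s Σy Σy² q hm hs first-moment second-moment upper lower (packing 3 3)
        where
        q = S bot F 5 (λ G → ⟦ excess G ≟ 3 ⟧)
        y≤3 : ∀ {G} → G ⊑ F → ρ G ≡ 5 → excess G ≤ 3
        y≤3 {G} GF hG = excess≤ {G} hG GF 3 (≤-trans (≤-reflexive hm) (n≤1+n 12))
        pt : ∀ y → y ≤ 3 → y * y ≤ 2 * y + 3 * ⟦ y ≟ 3 ⟧ × y + 6 * ⟦ y ≟ 3 ⟧ ≤ y * y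
        pt 0 _ = z≤n , z≤n
        pt 1 _ = s≤s z≤n , ≤-refl
        pt 2 _ = ≤-refl , s≤s (s≤s z≤n)
        pt 3 _ = ≤-refl , ≤-refl
        pt (suc (suc (suc (suc _)))) (s≤s (s≤s (s≤s ())))
        upper : Σy² ≤ 2 * Σy + 3 * q
        upper = ≤-trans (S-mono {bot} {F} {5} (λ {G} _ GF hG → proj₁ (pt (excess G) (y≤3 GF hG))))
               (≤-reflexive (trans (S-+ bot F 5 _ _) (cong₂ _+_ (S-*ˡ bot F 5 2 _) (S-*ˡ bot F 5 3 _))))
        lower : Σy + 6 * q ≤ Σy²
        lower = ≤-trans (≤-reflexive (sym (trans (S-+ bot F 5 _ _) (cong (Σy +_) (S-*ˡ bot F 5 6 _)))))
                        (S-mono {bot} {F} {5} (λ {G} _ GF hG → proj₂ (pt (excess G) (y≤3 GF hG))))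

      -- Let h be the number of ridges of `F` at an edge. Incidences inside `F` fix Σh, and Σh² up
      -- to the sum of the gaps, which the dual moments bound by 12 at every vertex.
      not₁₂,₂₂ : m ≡ 12 → s ≡ 22 → 0 < 0
      not₁₂,₂₂ hm hs = arith₂₂ m s Σy (c bot F 2) (c bot F 4) (S bot F 2 excessᵒ) (S bot F 2 gap)
        (S bot F 1 (λ v → c v F 5 * c v F 5)) (S bot F 2 (λ e → c e F 5 * c e F 5)) (S bot F 4 (λ Y → c Y F 5 * c Y F 5))
        hm hs first-moment (facet-count hF) (edges F) Σh Σh²
        (Σgap≤ 12 λ {v} hv vF → arith-gap m s (S v top 2 excessᵒ) (S v top 2 gap) hm hs (dual-first hv vF) (dual-second hv vF))
        Σstars Σtet bonferroni

      7∨27≤ : c bot top 1 ≡ 7 ⊎ 27 ≤ c bot top 1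
      7∨27≤ = go facet-shape
        where
        go : Shape m s → c bot top 1 ≡ 7 ⊎ 27 ≤ c bot top 1
        go (simplex _ e) = inj₁ (trans (sym coatom-count) (cong (_+ 1) e))
        go (large l) = inj₂ (≤-trans (+-monoˡ-≤ 1 l) (≤-reflexive coatom-count))
        go (m₁₁s₁₉ e e′) = contradiction (not₁₁ e e′) λ ()
        go (m₁₂s₂₂ e e′) = contradiction (not₁₂,₂₂ e e′) λ ()
        go (m₁₂s₂₃ e e′) = contradiction (not₁₂,₂₃ e e′) λ ()

    atoms-7∨27≤ : c bot top 1 ≡ 7 ⊎ 27 ≤ c bot top 1
    atoms-7∨27≤ = go (c-witness {bot} {top} {6} (≤-trans (s≤s z≤n) coatoms≥7))
      where
      go : (∃ λ F → bot ⊑ F × F ⊑ top × ρ F ≡ 6) → c bot top 1 ≡ 7 ⊎ 27 ≤ c bot top 1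
      go (F , _ , _ , hF) = 7∨27≤ hF

-- Geometry over an ordered field; a ring solver

module Geometry where

  open import Level using (_⊔_)
  open import Data.Nat as ℕ using (ℕ; zero; suc)
  import Data.Nat.Properties as ℕₚ
  import Data.Nat.Tactic.RingSolver as ℕSolver
  import Data.Integer as ℤ
  import Data.Integer.Properties as ℤₚ
  import Data.Integer.Tactic.RingSolver as ℤSolver
  open import Data.Bool using (Bool; true; false)
  import Data.Bool.Properties as BoolP
  open import Data.Fin using (Fin; zero; suc; punchIn; punchOut)
  import Data.Fin.Properties as FinP
  open import Data.Fin.Subset using (Subset; inside; outside; _⊆_; ∁; ⁅_⁆; _∩_; _∪_)
    renaming (_∈_ to _∈ˢ_; _∉_ to _∉ˢ_; ⊥ to ∅; ⊤ to full)
  open import Data.Fin.Subset.Properties using (_∈?_; _⊆?_; ⊆-antisym; ⊆-refl; x∈p∩q⁺; x∈p∩q⁻; p∩q⊆p; p∩q⊆q;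
    x∈⁅x⁆; x∈⁅y⁆⇒x≡y; ∉⊥; ∈⊤; x∉p⇒x∈∁p; x∈∁p⇒x∉p; x∈p∪q⁺)
  open import Data.Product hiding (map)
  open import Data.Sum using (_⊎_; inj₁; inj₂; [_,_]′)
  open import Data.Empty using (⊥; ⊥-elim)
  open import Data.Maybe using (Maybe; just; nothing)
  open import Data.List using (List; []; _∷_; _++_; map; tabulate; cartesianProductWith; filter; allFin; length; lookup)
  open import Data.List.Properties using (map-++; map-∘; map-cong; filter-accept; filter-reject; length-map; length-tabulate)
  open import Data.List.Relation.Unary.All as All using (All; []; _∷_)
  import Data.List.Relation.Unary.All.Properties as AllP
  open AllP using (tabulate⁺)
  import Data.List.Relation.Unary.AllPairs as AllPairs
  import Data.List.Relation.Unary.Any as Any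
  open import Data.List.Relation.Unary.Any using (here; there)
  import Data.List.Relation.Unary.Any.Properties as AnyP
  open import Data.List.Relation.Unary.Unique.Propositional using (Unique)
  import Data.List.Relation.Unary.Unique.Propositional.Properties as UniqueP
  open import Data.List.Membership.Propositional using (_∈_)
  open import Data.List.Membership.Propositional.Properties using (∈-map⁺; ∈-map⁻; ∈-++⁺ˡ; ∈-++⁺ʳ; ∈-++⁻;
    ∈-cartesianProductWith⁺; ∈-cartesianProductWith⁻; ∈-filter⁺; ∈-filter⁻; ∈-allFin; ∈-lookup)
  open import Data.List.Membership.Propositional.Properties.WithK using (unique∧set⇒bag)
  open import Data.List.Relation.Binary.BagAndSetEquality using (∼bag⇒↭)
  open import Data.List.Relation.Binary.Permutation.Propositional using (_↭_; prep; swap)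
  import Data.List.Relation.Binary.Permutation.Propositional as Perm
  open import Data.List.Relation.Binary.Permutation.Propositional.Properties using (All-resp-↭; ++-comm; ↭-length)
  open import Data.Vec as Vec using (_∷_; []; here; there)
  import Data.Vec.Properties as VecP
  open import Relation.Nullary
  open import Relation.Binary.PropositionalEquality as ≡ using (_≡_; _≢_)
  open import Relation.Binary.Definitions using (tri<; tri≈; tri>)
  open import Relation.Binary.Structures using (IsStrictTotalOrder)
  import Relation.Binary.Reasoning.Setoid
  open import Function using (_∘_; id; case_of_)
  open import Function.Bundles using (_⇔_; mk⇔; Equivalence)
  open import Algebra.Bundles using (CommutativeRing; RawRing)
  import Algebra.Solver.Ring
  import Algebra.Solver.Ring.AlmostCommutativeRing as ACR
  import Algebra.Solver.Ring.NaturalCoefficients.Default as NatSolver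
  import Algebra.Properties.Semiring.Mult
  import Algebra.Properties.Ring
  open import Algebra.Properties.Semiring.Sum ℕₚ.+-*-semiring using (sum)

  -- Coefficients are integers, written as formal differences of naturals.
  module IntegerSolver {c ℓ} (R : CommutativeRing c ℓ) where
    open CommutativeRing R
    open Algebra.Properties.Semiring.Mult semiring using (×-homo-+; ×1-homo-*; ×-congˡ) renaming (_×_ to _⨯_)
    open Algebra.Properties.Ring ring using (-0#≈0#)
    open Relation.Binary.Reasoning.Setoid setoid
    private
      module N = NatSolver commutativeSemiring

      reduce : ℕ × ℕ → ℕ × ℕ
      reduce (suc a , suc b) = reduce (a , b)
      reduce p = p

      Coeff : RawRing _ _
      Coeff = record
        { Carrier = ℕ × ℕ ; _≈_ = _≡_
        ; _+_ = λ (a , b) (c , d) → reduce (a ℕ.+ c , b ℕ.+ d)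
        ; _*_ = λ (a , b) (c , d) → reduce (a ℕ.* c ℕ.+ b ℕ.* d , a ℕ.* d ℕ.+ b ℕ.* c)
        ; -_ = swap′
        ; 0# = 0 , 0 ; 1# = 1 , 0 }
        where
        swap′ : ℕ × ℕ → ℕ × ℕ
        swap′ (a , b) = b , a

      ⟦_⟧ : ℕ → Carrier
      ⟦ a ⟧ = a ⨯ 1#

      value : ℕ × ℕ → Carrier
      value (a , b) = ⟦ a ⟧ - ⟦ b ⟧

      move : ∀ {x y z} → x ≈ z + y → x - y ≈ z
      move {x} {y} {z} h = begin
        x - y         ≈⟨ +-congʳ h ⟩
        z + y - y     ≈⟨ +-assoc z y (- y) ⟩
        z + (y - y)   ≈⟨ +-congˡ (-‿inverseʳ y) ⟩
        z + 0#        ≈⟨ +-identityʳ z ⟩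
        z             ∎

      unmove : ∀ x y → x ≈ (x - y) + y
      unmove x y = sym (trans (+-assoc x (- y) y) (trans (+-congˡ (-‿inverseˡ y)) (+-identityʳ x)))

      reduce≈ : ∀ p → value (reduce p) ≈ value p
      reduce≈ (zero , b) = refl
      reduce≈ (suc a , zero) = refl
      reduce≈ (suc a , suc b) = trans (reduce≈ (a , b)) (sym (move (begin
        1# + ⟦ a ⟧                        ≈⟨ +-congˡ (unmove ⟦ a ⟧ ⟦ b ⟧) ⟩
        1# + ((⟦ a ⟧ - ⟦ b ⟧) + ⟦ b ⟧)    ≈⟨ N.solve 3 (λ o p b → o N.:+ (p N.:+ b) N.:= p N.:+ (o N.:+ b)) refl 1# (⟦ a ⟧ - ⟦ b ⟧) ⟦ b ⟧ ⟩
        (⟦ a ⟧ - ⟦ b ⟧) + (1# + ⟦ b ⟧)    ∎)))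

      +-homo : ∀ p q → value (RawRing._+_ Coeff p q) ≈ value p + value q
      +-homo (a , b) (c , d) = trans (reduce≈ (a ℕ.+ c , b ℕ.+ d)) (move (begin
        ⟦ a ℕ.+ c ⟧ ≈⟨ ×-homo-+ 1# a c ⟩
        ⟦ a ⟧ + ⟦ c ⟧ ≈⟨ +-cong (unmove ⟦ a ⟧ ⟦ b ⟧) (unmove ⟦ c ⟧ ⟦ d ⟧) ⟩
        ((⟦ a ⟧ - ⟦ b ⟧) + ⟦ b ⟧) + ((⟦ c ⟧ - ⟦ d ⟧) + ⟦ d ⟧)
          ≈⟨ N.solve 4 (λ p b q d → (p N.:+ b) N.:+ (q N.:+ d) N.:= (p N.:+ q) N.:+ (b N.:+ d)) refl _ _ _ _ ⟩
        ((⟦ a ⟧ - ⟦ b ⟧) + (⟦ c ⟧ - ⟦ d ⟧)) + (⟦ b ⟧ + ⟦ d ⟧) ≈⟨ +-congˡ (×-homo-+ 1# b d) ⟨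
        ((⟦ a ⟧ - ⟦ b ⟧) + (⟦ c ⟧ - ⟦ d ⟧)) + ⟦ b ℕ.+ d ⟧ ∎))

      ×-sum : ∀ a b c d → ⟦ a ℕ.* b ℕ.+ c ℕ.* d ⟧ ≈ ⟦ a ⟧ * ⟦ b ⟧ + ⟦ c ⟧ * ⟦ d ⟧
      ×-sum a b c d = trans (×-homo-+ 1# (a ℕ.* b) (c ℕ.* d)) (+-cong (×1-homo-* a b) (×1-homo-* c d))

      *-homo : ∀ p q → value (RawRing._*_ Coeff p q) ≈ value p * value q
      *-homo (a , b) (c , d) = trans (reduce≈ (a ℕ.* c ℕ.+ b ℕ.* d , a ℕ.* d ℕ.+ b ℕ.* c)) (move (begin
        ⟦ a ℕ.* c ℕ.+ b ℕ.* d ⟧ ≈⟨ ×-sum a c b d ⟩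
        ⟦ a ⟧ * ⟦ c ⟧ + ⟦ b ⟧ * ⟦ d ⟧ ≈⟨ +-congʳ (*-cong (unmove ⟦ a ⟧ ⟦ b ⟧) (unmove ⟦ c ⟧ ⟦ d ⟧)) ⟩
        (p + ⟦ b ⟧) * (q + ⟦ d ⟧) + ⟦ b ⟧ * ⟦ d ⟧
          ≈⟨ N.solve 4 (λ p b q d → (p N.:+ b) N.:* (q N.:+ d) N.:+ b N.:* d N.:=
                                     p N.:* q N.:+ ((p N.:+ b) N.:* d N.:+ b N.:* (q N.:+ d))) refl p ⟦ b ⟧ q ⟦ d ⟧ ⟩
        p * q + ((p + ⟦ b ⟧) * ⟦ d ⟧ + ⟦ b ⟧ * (q + ⟦ d ⟧))
          ≈⟨ +-congˡ (+-cong (*-congʳ (unmove ⟦ a ⟧ ⟦ b ⟧)) (*-congˡ (unmove ⟦ c ⟧ ⟦ d ⟧))) ⟨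
        p * q + (⟦ a ⟧ * ⟦ d ⟧ + ⟦ b ⟧ * ⟦ c ⟧) ≈⟨ +-congˡ (×-sum a d b c) ⟨
        p * q + ⟦ a ℕ.* d ℕ.+ b ℕ.* c ⟧ ∎))
        where
        p = ⟦ a ⟧ - ⟦ b ⟧
        q = ⟦ c ⟧ - ⟦ d ⟧

      -‿homo : ∀ p → value (RawRing.-_ Coeff p) ≈ - value p
      -‿homo (a , b) = move (begin
        ⟦ b ⟧ ≈⟨ +-identityˡ _ ⟨
        0# + ⟦ b ⟧ ≈⟨ +-congʳ (-‿inverseˡ (⟦ a ⟧ - ⟦ b ⟧)) ⟨
        - (⟦ a ⟧ - ⟦ b ⟧) + (⟦ a ⟧ - ⟦ b ⟧) + ⟦ b ⟧ ≈⟨ +-assoc _ _ _ ⟩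
        - (⟦ a ⟧ - ⟦ b ⟧) + ((⟦ a ⟧ - ⟦ b ⟧) + ⟦ b ⟧) ≈⟨ +-congˡ (unmove ⟦ a ⟧ ⟦ b ⟧) ⟨
        - (⟦ a ⟧ - ⟦ b ⟧) + ⟦ a ⟧ ∎)

      -- value, except that the solver's constants for 0 and 1 are 0# and 1# on the nose
      constant : ℕ × ℕ → Carrier
      constant (0 , 0) = 0#
      constant (1 , 0) = 1#
      constant p = value p

      constant≈ : ∀ p → constant p ≈ value p
      constant≈ (0 , 0) = sym (-‿inverseʳ 0#)
      constant≈ (1 , 0) = sym (trans (+-cong (+-identityʳ 1#) -0#≈0#) (+-identityʳ 1#))
      constant≈ (0 , suc _) = refl
      constant≈ (1 , suc _) = refl
      constant≈ (suc (suc _) , _) = refl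

      morphism : Coeff ACR.-Raw-AlmostCommutative⟶ ACR.fromCommutativeRing R
      morphism = record
        { ⟦_⟧ = constant
        ; +-homo = λ p q → trans (constant≈ (RawRing._+_ Coeff p q)) (trans (+-homo p q) (sym (+-cong (constant≈ p) (constant≈ q))))
        ; *-homo = λ p q → trans (constant≈ (RawRing._*_ Coeff p q)) (trans (*-homo p q) (sym (*-cong (constant≈ p) (constant≈ q))))
        ; -‿homo = λ p → trans (constant≈ (RawRing.-_ Coeff p)) (trans (-‿homo p) (sym (-‿cong (constant≈ p))))
        ; 0-homo = refl ; 1-homo = refl }

      coeff≟ : ∀ p q → Maybe (constant p ≈ constant q)
      coeff≟ p@(a , b) q@(c , d) with a ℕ.+ d ℕ.≟ c ℕ.+ b
      ... | no _ = nothing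
      ... | yes e = just (trans (constant≈ p) (trans (move (begin
        ⟦ a ⟧                     ≈⟨ unmove ⟦ a ⟧ (- ⟦ d ⟧) ⟩
        ⟦ a ⟧ - - ⟦ d ⟧ - ⟦ d ⟧   ≈⟨ +-congʳ (+-congˡ (-‿involutive ⟦ d ⟧)) ⟩
        ⟦ a ⟧ + ⟦ d ⟧ - ⟦ d ⟧     ≈⟨ +-congʳ (×-homo-+ 1# a d) ⟨
        ⟦ a ℕ.+ d ⟧ - ⟦ d ⟧       ≈⟨ +-congʳ (×-congˡ e) ⟩
        ⟦ c ℕ.+ b ⟧ - ⟦ d ⟧       ≈⟨ +-congʳ (×-homo-+ 1# c b) ⟩
        ⟦ c ⟧ + ⟦ b ⟧ - ⟦ d ⟧     ≈⟨ N.solve 3 (λ c b d → (c N.:+ b) N.:+ d N.:= (c N.:+ d) N.:+ b) refl ⟦ c ⟧ ⟦ b ⟧ (- ⟦ d ⟧) ⟩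
        ⟦ c ⟧ - ⟦ d ⟧ + ⟦ b ⟧     ∎)) (sym (constant≈ q))))
        where open Algebra.Properties.Ring ring using (-‿involutive)

    open Algebra.Solver.Ring Coeff (ACR.fromCommutativeRing R) morphism coeff≟ public
      using (solve; _:+_; _:*_; _:-_; :-_; _:=_; con)

  -- Functionals, spans and rank

  module OrderedLinear {c ℓ₁ ℓ₂} (F : OrderedField c ℓ₁ ℓ₂) where
    open OrderedField F hiding (zero) renaming (_<_ to infix 4 _<_; _≤_ to infix 4 _≤_)
    open Polytopes F using (∑; Point) renaming (_·_ to infixl 8 _·_)
    open IntegerSolver commutativeRing
    open IsStrictTotalOrder isStrictTotalOrder using (compare; _≟_; <-resp-≈)
      renaming (trans to <-trans; irrefl to <-irrefl)
    open import Relation.Binary.Reasoning.Setoid setoid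

    private
      variable
        d n : ℕ

    <-cong : ∀ {x x′ y y′} → x ≈ x′ → y ≈ y′ → x < y → x′ < y′
    <-cong p q = proj₂ <-resp-≈ p ∘ proj₁ <-resp-≈ q

    >0-cong : ∀ {x x′} → x ≈ x′ → 0# < x → 0# < x′
    >0-cong = <-cong refl

    +-pos : ∀ {x y} → 0# < x → 0# < y → 0# < x + y
    +-pos {x} {y} p q = <-trans q (<-cong (+-identityˡ y) refl (+-monoˡ-< y p))

    -pos : ∀ {x} → x < 0# → 0# < - x
    -pos {x} p = <-cong (-‿inverseʳ x) (+-identityˡ (- x)) (+-monoˡ-< (- x) p)

    -neg : ∀ {x} → 0# < x → - x < 0#
    -neg {x} p = <-cong (+-identityˡ (- x)) (-‿inverseʳ x) (+-monoˡ-< (- x) p)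

    <⇒0<- : ∀ {x y} → x < y → 0# < y - x
    <⇒0<- {x} {y} p = <-cong (-‿inverseʳ x) refl (+-monoˡ-< (- x) p)

    0<-⇒< : ∀ {x y} → 0# < y - x → x < y
    0<-⇒< {x} {y} p = <-cong (+-identityˡ x) (solve 2 (λ x y → (y :- x) :+ x := y) refl x y) (+-monoˡ-< x p)

    0<1 : 0# < 1#
    0<1 with compare 0# 1#
    ... | tri< p _ _ = p
    ... | tri≈ _ p _ = contradiction p 0≉1
    ... | tri> _ _ p = >0-cong (solve 0 ((:- con (1 , 0)) :* (:- con (1 , 0)) := con (1 , 0)) refl) (*-pos (-pos p) (-pos p))

    <⇒≉ : ∀ {x} → 0# < x → ¬ x ≈ 0#
    <⇒≉ p e = <-irrefl (sym e) p

    abstract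
      inv-pos : ∀ {x} → 0# < x → ∃ λ y → x * y ≈ 1# × 0# < y
      inv-pos {x} p with inverse x (<⇒≉ p)
      ... | y , e with compare 0# y
      ...   | tri< q _ _ = y , e , q
      ...   | tri≈ _ q _ = contradiction (trans (trans (sym (zeroʳ x)) (*-congˡ q)) e) 0≉1
      ...   | tri> _ _ q = contradiction (+-pos 0<1 (>0-cong (trans (solve 2 (λ x y → x :* (:- y) := :- (x :* y)) refl x y) (-‿cong e)) (*-pos p (-pos q))))
                             (λ h → <-irrefl refl (>0-cong (-‿inverseʳ 1#) h))

    ∑-cong : {f g : Fin n → Carrier} → (∀ i → f i ≈ g i) → ∑ f ≈ ∑ g
    ∑-cong {zero} h = refl
    ∑-cong {suc n} h = +-cong (h zero) (∑-cong (h ∘ suc))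

    ∑-zero : {f : Fin n → Carrier} → (∀ i → f i ≈ 0#) → ∑ f ≈ 0#
    ∑-zero {zero} h = refl
    ∑-zero {suc n} h = trans (+-cong (h zero) (∑-zero (h ∘ suc))) (+-identityˡ 0#)

    lin : Carrier → Point d → Carrier → Point d → Point d
    lin a u b w k = a * u k + b * w k

    ∑-lin : ∀ a (f : Fin n → Carrier) b g → ∑ (lin a f b g) ≈ a * ∑ f + b * ∑ g
    ∑-lin {zero} a f b g = solve 2 (λ a b → con (0 , 0) := a :* con (0 , 0) :+ b :* con (0 , 0)) refl a b
    ∑-lin {suc n} a f b g = trans (+-congˡ (∑-lin a (f ∘ suc) b (g ∘ suc)))
      (solve 6 (λ a b f₀ f₁ g₀ g₁ → (a :* f₀ :+ b :* g₀) :+ (a :* f₁ :+ b :* g₁) := a :* (f₀ :+ f₁) :+ b :* (g₀ :+ g₁)) refl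
         a b (f zero) (∑ (f ∘ suc)) (g zero) (∑ (g ∘ suc)))

    ·-congʳ : ∀ (y : Point d) {u w} → (∀ k → u k ≈ w k) → y · u ≈ y · w
    ·-congʳ y h = ∑-cong (λ k → *-congˡ (h k))

    ·-linʳ : ∀ (y : Point d) a u b w → y · lin a u b w ≈ a * (y · u) + b * (y · w)
    ·-linʳ y a u b w = trans (∑-cong (λ k → solve 5 (λ y a b u w → y :* (a :* u :+ b :* w) := a :* (y :* u) :+ b :* (y :* w)) refl
        (y k) a b (u k) (w k))) (∑-lin a (λ k → y k * u k) b (λ k → y k * w k))

    ·-linˡ : ∀ a (y : Point d) b z u → lin a y b z · u ≈ a * (y · u) + b * (z · u)
    ·-linˡ a y b z u = trans (∑-cong (λ k → solve 5 (λ u a b y z → (a :* y :+ b :* z) :* u := a :* (y :* u) :+ b :* (z :* u)) refl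
        (u k) a b (y k) (z k))) (∑-lin a (λ k → y k * u k) b (λ k → z k * u k))

    scale : Carrier → Point d → Point d
    scale a u k = a * u k

    ∑-scale : ∀ a (f : Fin n → Carrier) → ∑ (scale a f) ≈ a * ∑ f
    ∑-scale {zero} a f = sym (zeroʳ a)
    ∑-scale {suc n} a f = trans (+-congˡ (∑-scale a (f ∘ suc))) (sym (distribˡ a _ _))

    ·-scaleˡ : ∀ a (y : Point d) u → scale a y · u ≈ a * (y · u)
    ·-scaleˡ a y u = trans (∑-cong (λ k → *-assoc a (y k) (u k))) (∑-scale a (λ k → y k * u k))

    ·-scaleʳ : ∀ a (y u : Point d) → y · scale a u ≈ a * (y · u)
    ·-scaleʳ a y u = trans (∑-cong (λ k → solve 3 (λ a y u → y :* (a :* u) := (a :* y) :* u) refl a (y k) (u k))) (·-scaleˡ a y u)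

    ·-zeroʳ : ∀ (y : Point d) {u} → (∀ k → u k ≈ 0#) → y · u ≈ 0#
    ·-zeroʳ y h = ∑-zero (λ k → trans (*-congˡ (h k)) (zeroʳ (y k)))

    ·-zeroˡ : ∀ (u : Point d) → (λ _ → 0#) · u ≈ 0#
    ·-zeroˡ u = ∑-zero (λ k → zeroˡ (u k))

    unit : Fin d → Point d
    unit zero zero = 1#
    unit zero (suc _) = 0#
    unit (suc k) zero = 0#
    unit (suc k) (suc l) = unit k l

    ·-unit : ∀ k (u : Point d) → unit k · u ≈ u k
    ·-unit zero u = trans (+-cong (*-identityˡ _) (∑-zero (λ k → zeroˡ (u (suc k))))) (+-identityʳ _)
    ·-unit (suc k) u = trans (+-cong (zeroˡ _) (·-unit k (u ∘ suc))) (+-identityˡ _)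

    Null : Point d → List (Point d) → Set _
    Null y = All (λ e → y · e ≈ 0#)

    Positive : Point d → List (Point d) → Set _
    Positive y = All (λ q → 0# < y · q)

    -- This is membership of `h` in the span of `E`, expressed by functionals; `Dual E h` is a
    -- witness against it. Spans are thus handled without coefficients.
    Kills : List (Point d) → Point d → Set _
    Kills E h = ∀ y → Null y E → y · h ≈ 0#

    Dual : List (Point d) → Point d → Set _
    Dual E h = ∃ λ y → Null y E × y · h ≈ 1#

    Null-lin : ∀ {E : List (Point d)} a {y} b {z} → Null y E → Null z E → Null (lin a y b z) E
    Null-lin a b [] [] = []
    Null-lin a {y} b {z} (_∷_ {e} p ps) (q ∷ qs) = trans (·-linˡ a y b z e)
      (trans (+-cong (trans (*-congˡ p) (zeroʳ a)) (trans (*-congˡ q) (zeroʳ b))) (+-identityˡ 0#)) ∷ Null-lin a b ps qs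

    Null-scale : ∀ {E : List (Point d)} a {y} → Null y E → Null (scale a y) E
    Null-scale a [] = []
    Null-scale a {y} (_∷_ {e} p ps) = trans (·-scaleˡ a y e) (trans (*-congˡ p) (zeroʳ a)) ∷ Null-scale a ps

    -- h made orthogonal to z along e, given z · e = 1
    shear : Point d → Point d → Point d → Point d
    shear z e h = lin 1# h (- (z · h)) e

    ·-shear : ∀ (y z e h : Point d) → y · shear z e h ≈ y · h - (z · h) * (y · e)
    ·-shear y z e h = trans (·-linʳ y 1# h (- (z · h)) e)
      (solve 3 (λ yh zh ye → con (1 , 0) :* yh :+ (:- zh) :* ye := yh :- zh :* ye) refl (y · h) (z · h) (y · e))

    ·-shear-null : ∀ (y z e h : Point d) → y · e ≈ 0# → y · shear z e h ≈ y · h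
    ·-shear-null y z e h p = trans (·-shear y z e h) (trans (+-congˡ (-‿cong (*-congˡ p)))
      (solve 2 (λ yh zh → yh :- zh :* con (0 , 0) := yh) refl (y · h) (z · h)))

    project : Point d → Point d → Point d → Point d
    project z e y = lin 1# y (- (y · e)) z

    project-null : ∀ {E : List (Point d)} {z e y} → Null z E → z · e ≈ 1# → Null y E → Null (project z e y) (e ∷ E)
    project-null {z = z} {e} {y} zE ze yE = trans (·-linˡ 1# y (- (y · e)) z e) (trans (+-congˡ (*-congˡ ze))
      (solve 1 (λ t → con (1 , 0) :* t :+ (:- t) :* con (1 , 0) := con (0 , 0)) refl (y · e))) ∷ Null-lin 1# (- (y · e)) yE zE

    -- `project` and `shear` are adjoint: restricting functionals to those vanishing on `e` amounts
    -- to shearing the vectors. The eliminations in `dual?` and `real?` rest on this.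
    ·-project : ∀ (y z e h : Point d) → project z e y · h ≈ y · shear z e h
    ·-project y z e h = trans (·-linˡ 1# y (- (y · e)) z h) (trans
      (solve 3 (λ yh zh ye → con (1 , 0) :* yh :+ (:- ye) :* zh := yh :- zh :* ye) refl (y · h) (z · h) (y · e)) (sym (·-shear y z e h)))

    normalise : ∀ {E : List (Point d)} {y h} → Null y E → ¬ y · h ≈ 0# → Dual E h
    normalise {y = y} {h} yE yh with inverse (y · h) yh
    ... | a , e = scale a y , Null-scale a yE , trans (·-scaleˡ a y h) (trans (*-comm a (y · h)) e)

    -- Gaussian elimination: an equation dependent on the later ones is dropped, and an independent
    -- one is removed by shearing `h` along it.
    dual? : (E : List (Point d)) (h : Point d) → Dual E h ⊎ Kills E h
    dual? [] h with FinP.any? (λ k → ¬? (h k ≟ 0#))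
    ... | yes (k , hk) = inj₁ (normalise [] (λ e → hk (trans (sym (·-unit k h)) e)))
    ... | no ¬p = inj₂ λ y _ → ·-zeroʳ y (λ k → decidable-stable (h k ≟ 0#) (λ hk → ¬p (k , hk)))
    dual? (e ∷ E) h with dual? E e
    ... | inj₂ kills with dual? E h
    ...   | inj₁ (y , yE , yh) = inj₁ (y , kills y yE ∷ yE , yh)
    ...   | inj₂ kills′ = inj₂ λ { y (_ ∷ yE) → kills′ y yE }
    dual? (e ∷ E) h | inj₁ (z , zE , ze) with dual? E (shear z e h)
    ...   | inj₁ (y , yE , yh) = inj₁ (project z e y , project-null zE ze yE , trans (·-project y z e h) yh)
    ...   | inj₂ kills = inj₂ λ { y (ye ∷ yE) → trans (sym (·-shear-null y z e h ye)) (kills y yE) }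

    dual-kills : ∀ {E : List (Point d)} {h} → Dual E h → ¬ Kills E h
    dual-kills (y , yE , yh) k = 0≉1 (trans (sym (k y yE)) yh)

    -- Counts the vectors independent of those after them. That the order is immaterial is `rank-↭`,
    -- and that only the annihilator matters is `rank-cong`.
    rank : List (Point d) → ℕ
    rank [] = 0
    rank (h ∷ E) = [ (λ _ → suc (rank E)) , (λ _ → rank E) ]′ (dual? E h)

    rank-dual : ∀ {E : List (Point d)} {h} → Dual E h → rank (h ∷ E) ≡ suc (rank E)
    rank-dual {E = E} {h} p with dual? E h
    ... | inj₁ _ = ≡.refl
    ... | inj₂ k = contradiction k (dual-kills p)

    rank-kills : ∀ {E : List (Point d)} {h} → Kills E h → rank (h ∷ E) ≡ rank E
    rank-kills {E = E} {h} k with dual? E h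
    ... | inj₁ p = contradiction k (dual-kills p)
    ... | inj₂ _ = ≡.refl

    rank-∷≤ : ∀ h (E : List (Point d)) → rank (h ∷ E) ℕ.≤ suc (rank E)
    rank-∷≤ h E with dual? E h
    ... | inj₁ _ = ℕₚ.≤-refl
    ... | inj₂ _ = ℕₚ.n≤1+n _

    rank-prep : ∀ {E E′ : List (Point d)} x → (∀ y → Null y E → Null y E′) → (∀ y → Null y E′ → Null y E) →
                rank E ≡ rank E′ → rank (x ∷ E) ≡ rank (x ∷ E′)
    rank-prep {E = E} {E′} x f g e with dual? E x
    ... | inj₁ (y , yE , yx) = ≡.trans (≡.cong suc e) (≡.sym (rank-dual (y , f y yE , yx)))
    ... | inj₂ k = ≡.trans e (≡.sym (rank-kills (λ y yE → k y (g y yE))))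

    private
      -- Steinitz exchange: a functional `z` with value 1 on `b` is corrected by a multiple of `y`,
      -- which vanishes on `b`, so as to vanish on `a`.
      swap-dual : ∀ {E : List (Point d)} {a b} → Dual E b → Dual (b ∷ E) a → Dual (a ∷ E) b
      swap-dual {a = a} {b} (z , zE , zb) (y , yb ∷ yE , ya) = project y a z , project-null yE ya zE ,
        trans (·-project z y a b) (trans (·-shear z y a b) (trans (+-cong zb (-‿cong (*-congʳ yb)))
          (solve 1 (λ t → con (1 , 0) :- con (0 , 0) :* t := con (1 , 0)) refl (z · a))))

    rank-swap : ∀ (E : List (Point d)) a b → rank (a ∷ b ∷ E) ≡ rank (b ∷ a ∷ E)
    rank-swap E a b = go (dual? E a) (dual? E b) (dual? (b ∷ E) a) (dual? (a ∷ E) b)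
      where
      go : Dual E a ⊎ Kills E a → Dual E b ⊎ Kills E b → Dual (b ∷ E) a ⊎ Kills (b ∷ E) a → Dual (a ∷ E) b ⊎ Kills (a ∷ E) b →
           rank (a ∷ b ∷ E) ≡ rank (b ∷ a ∷ E)
      go (inj₂ ka) (inj₂ kb) _ _ = ≡.trans (rank-kills (λ { y (_ ∷ yE) → ka y yE })) (≡.trans (rank-kills kb)
        (≡.sym (≡.trans (rank-kills (λ { y (_ ∷ yE) → kb y yE })) (rank-kills ka))))
      go (inj₂ ka) (inj₁ pb@(y , yE , yb)) _ _ = ≡.trans (rank-kills (λ { y (_ ∷ yE) → ka y yE })) (≡.trans (rank-dual pb)
        (≡.sym (≡.trans (rank-dual (y , ka y yE ∷ yE , yb)) (≡.cong suc (rank-kills ka)))))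
      go (inj₁ pa@(y , yE , ya)) (inj₂ kb) _ _ = ≡.trans (rank-dual (y , kb y yE ∷ yE , ya)) (≡.trans (≡.cong suc (rank-kills kb))
        (≡.sym (≡.trans (rank-kills (λ { y (_ ∷ yE) → kb y yE })) (rank-dual pa))))
      go (inj₁ pa) (inj₁ pb) (inj₁ p) _ = ≡.trans (rank-dual p) (≡.trans (≡.cong suc (rank-dual pb))
        (≡.sym (≡.trans (rank-dual (swap-dual pb p)) (≡.cong suc (rank-dual pa)))))
      go (inj₁ pa) (inj₁ pb) (inj₂ k) (inj₁ p) = contradiction k (dual-kills (swap-dual pa p))
      go (inj₁ pa) (inj₁ pb) (inj₂ k) (inj₂ k′) = ≡.trans (rank-kills k) (≡.trans (rank-dual pb)
        (≡.sym (≡.trans (rank-kills k′) (rank-dual pa))))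

    rank-↭ : ∀ {E E′ : List (Point d)} → E ↭ E′ → rank E ≡ rank E′
    rank-↭ Perm.refl = ≡.refl
    rank-↭ (prep x p) = rank-prep x (λ _ → All-resp-↭ p) (λ _ → All-resp-↭ (Perm.↭-sym p)) (rank-↭ p)
    rank-↭ (swap {xs} {ys} x y p) = ≡.trans (rank-swap xs x y) (rank-↭′ p)
      where
      rank-↭′ : xs ↭ ys → rank (y ∷ x ∷ xs) ≡ rank (y ∷ x ∷ ys)
      rank-↭′ q = rank-prep y (λ _ → All-resp-↭ (prep x q)) (λ _ → All-resp-↭ (Perm.↭-sym (prep x q)))
        (rank-prep x (λ _ → All-resp-↭ q) (λ _ → All-resp-↭ (Perm.↭-sym q)) (rank-↭ p))
    rank-↭ (Perm.trans p q) = ≡.trans (rank-↭ p) (rank-↭ q)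

    rank-++-kills : ∀ (E′ : List (Point d)) {E} → All (Kills E) E′ → rank (E′ ++ E) ≡ rank E
    rank-++-kills [] [] = ≡.refl
    rank-++-kills (e ∷ E′) (k ∷ ks) = ≡.trans (rank-kills (λ y yE → k y (AllP.++⁻ʳ E′ yE))) (rank-++-kills E′ ks)

    rank-++ : ∀ (E′ E : List (Point d)) → rank E ℕ.≤ rank (E′ ++ E)
    rank-++ [] E = ℕₚ.≤-refl
    rank-++ (e ∷ E′) E with dual? (E′ ++ E) e
    ... | inj₁ _ = ℕₚ.m≤n⇒m≤1+n (rank-++ E′ E)
    ... | inj₂ _ = rank-++ E′ E

    -- Putting `E` in front of `E′` cannot lower the rank, and putting `E′` in front of `E` adds
    -- only vectors in the span of `E`; the two lists are permutations of each other.
    rank-mono : ∀ {E E′ : List (Point d)} → (∀ y → Null y E → Null y E′) → rank E′ ℕ.≤ rank E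
    rank-mono {E = E} {E′} h = ℕₚ.≤-trans (rank-++ E E′) (ℕₚ.≤-reflexive (≡.trans (rank-↭ (++-comm E E′))
      (rank-++-kills E′ (All.tabulate λ {e} e∈ y yE → All.lookup (h y yE) e∈))))

    rank-cong : ∀ {E E′ : List (Point d)} → (∀ y → Null y E → Null y E′) → (∀ y → Null y E′ → Null y E) → rank E ≡ rank E′
    rank-cong f g = ℕₚ.≤-antisym (rank-mono g) (rank-mono f)

    Span : List (Point d) → Point d → Set _
    Span [] h = Lift′ (∀ k → h k ≈ 0#)
      where
      Lift′ : Set ℓ₁ → Set (c ⊔ ℓ₁)
      Lift′ A = Level.Lift c A
    Span (e ∷ E) h = ∃ λ a → Span E (lin 1# h a e)

    -- Returns from functionals to coefficients, in which affine independence is stated.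
    kills⇒span : ∀ (E : List (Point d)) {h} → Kills E h → Span E h
    kills⇒span [] {h} k = Level.lift λ i → trans (sym (·-unit i h)) (k (unit i) [])
    kills⇒span (e ∷ E) {h} k with dual? E e
    ... | inj₁ (z , zE , ze) = - (z · h) , kills⇒span E (λ y yE → trans (sym (·-project y z e h)) (k (project z e y) (project-null zE ze yE)))
    ... | inj₂ ke = 0# , kills⇒span E (λ y yE → trans (·-linʳ y 1# h 0# e) (trans (+-cong (*-congˡ (k y (ke y yE ∷ yE))) (zeroˡ _))
              (solve 0 (con (1 , 0) :* con (0 , 0) :+ con (0 , 0) := con (0 , 0)) refl)))

    Independent : ∀ {m} → (Fin m → Point d) → Set _
    Independent {m = m} g = (a : Fin m → Carrier) → (∀ k → ∑ (λ i → a i * g i k) ≈ 0#) → ∀ i → a i ≈ 0#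

    infixr 5 _◂_
    _◂_ : ∀ {a} {A : Set a} {m} → A → (Fin m → A) → Fin (suc m) → A
    (x ◂ f) zero = x
    (x ◂ f) (suc i) = f i

    span⇒dependency : ∀ m (g : Fin m → Point d) {h} → Span (tabulate g) h → ∃ λ (a : Fin m → Carrier) → ∀ k → h k + ∑ (λ i → a i * g i k) ≈ 0#
    span⇒dependency zero g (Level.lift p) = (λ ()) , λ k → trans (+-identityʳ _) (p k)
    span⇒dependency (suc m) g {h} (a , s) with span⇒dependency m (g ∘ suc) s
    ... | b , e = a ◂ b , λ k → trans
      (solve 4 (λ h a g s → h :+ (a :* g :+ s) := (con (1 , 0) :* h :+ a :* g) :+ s) refl (h k) a (g zero k) (∑ (λ i → b i * g (suc i) k))) (e k)

    independent⇒rank : ∀ m (g : Fin m → Point d) → Independent g → rank (tabulate g) ≡ m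
    independent⇒rank zero g ind = ≡.refl
    independent⇒rank (suc m) g ind with dual? (tabulate (g ∘ suc)) (g zero)
    ... | inj₁ _ = ≡.cong suc (independent⇒rank m (g ∘ suc) λ a e i → ind (0# ◂ a)
            (λ k → trans (+-cong (zeroˡ _) (e k)) (+-identityˡ 0#)) (suc i))
    ... | inj₂ k with span⇒dependency m (g ∘ suc) (kills⇒span (tabulate (g ∘ suc)) k)
    ...   | b , e = contradiction (sym (ind (1# ◂ b) (λ k → trans (+-congʳ (*-identityˡ _)) (e k)) zero)) 0≉1

    rank-tabulate≤ : ∀ m (g : Fin m → Point d) → rank (tabulate g) ℕ.≤ m
    rank-tabulate≤ zero g = ℕ.z≤n
    rank-tabulate≤ (suc m) g with dual? (tabulate (g ∘ suc)) (g zero)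
    ... | inj₁ _ = ℕ.s≤s (rank-tabulate≤ m (g ∘ suc))
    ... | inj₂ _ = ℕₚ.m≤n⇒m≤1+n (rank-tabulate≤ m (g ∘ suc))

    rank⇒independent : ∀ m (g : Fin m → Point d) → rank (tabulate g) ≡ m → Independent g
    rank⇒independent zero g r a e ()
    rank⇒independent (suc m) g r a e with dual? (tabulate (g ∘ suc)) (g zero)
    ... | inj₂ _ = contradiction (≡.subst (ℕ._≤ m) r (rank-tabulate≤ m (g ∘ suc))) (ℕₚ.<⇒≱ (ℕₚ.n<1+n m))
    -- As `y` vanishes on the later vectors, applying it to the dependency isolates the first
    -- coefficient.
    ... | inj₁ (y , yE , yg) = λ { zero → a₀ ; (suc i) → rank⇒independent m (g ∘ suc) (ℕₚ.suc-injective r) (a ∘ suc) e′ i }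
      where
      combine : ∀ m (g : Fin m → Point _) (a : Fin m → Carrier) → Null y (tabulate g) → y · (λ k → ∑ (λ i → a i * g i k)) ≈ 0#
      combine zero g a _ = ·-zeroʳ y (λ _ → refl)
      combine (suc m) g a (p ∷ ps) = begin
        y · (λ k → a zero * g zero k + ∑ (λ i → a (suc i) * g (suc i) k))
          ≈⟨ ·-congʳ y (λ k → +-congˡ (sym (*-identityˡ _))) ⟩
        y · lin (a zero) (g zero) 1# (λ k → ∑ (λ i → a (suc i) * g (suc i) k))
          ≈⟨ ·-linʳ y (a zero) (g zero) 1# (λ k → ∑ (λ i → a (suc i) * g (suc i) k)) ⟩
        a zero * (y · g zero) + 1# * (y · (λ k → ∑ (λ i → a (suc i) * g (suc i) k)))
          ≈⟨ +-cong (*-congˡ p) (*-congˡ (combine m (g ∘ suc) (a ∘ suc) ps)) ⟩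
        a zero * 0# + 1# * 0# ≈⟨ solve 1 (λ a → a :* con (0 , 0) :+ con (1 , 0) :* con (0 , 0) := con (0 , 0)) refl (a zero) ⟩
        0# ∎
      tail : Point _
      tail k = ∑ (λ i → a (suc i) * g (suc i) k)
      a₀ : a zero ≈ 0#
      a₀ = begin
        a zero                              ≈⟨ solve 1 (λ a → a := a :* con (1 , 0) :+ con (1 , 0) :* con (0 , 0)) refl (a zero) ⟩
        a zero * 1# + 1# * 0#               ≈⟨ +-cong (*-congˡ yg) (*-congˡ (combine m (g ∘ suc) (a ∘ suc) yE)) ⟨
        a zero * (y · g zero) + 1# * (y · tail) ≈⟨ ·-linʳ y (a zero) (g zero) 1# tail ⟨
        y · lin (a zero) (g zero) 1# tail   ≈⟨ ·-zeroʳ y (λ k → trans (+-congˡ (*-identityˡ _)) (e k)) ⟩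
        0# ∎
      e′ : ∀ k → tail k ≈ 0#
      e′ k = trans (trans (sym (+-identityˡ _)) (+-congʳ (sym (trans (*-congʳ a₀) (zeroˡ _))))) (e k)

  -- Systems of linear inequalities and signed counts of cones

  sgn : ℕ → ℤ.ℤ
  sgn zero = ℤ.+ 1
  sgn (suc n) = ℤ.- sgn n

  weight : ∀ {a} {A : Set a} → Dec A → ℤ.ℤ → ℤ.ℤ
  weight (yes _) x = x
  weight (no _) x = ℤ.+ 0

  weight-yes : ∀ {a} {A : Set a} (p : Dec A) x → A → weight p x ≡ x
  weight-yes (yes _) x _ = ≡.refl
  weight-yes (no n) x p = contradiction p n

  weight-no : ∀ {a} {A : Set a} (p : Dec A) x → ¬ A → weight p x ≡ ℤ.+ 0
  weight-no (yes p) x n = contradiction p n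
  weight-no (no _) x _ = ≡.refl

  module Systems {c ℓ₁ ℓ₂} (F : OrderedField c ℓ₁ ℓ₂) where
    open OrderedField F hiding (zero) renaming (_<_ to infix 4 _<_; _≤_ to infix 4 _≤_)
    open Polytopes F using (∑; Point) renaming (_·_ to infixl 8 _·_)
    open IntegerSolver commutativeRing
    open Algebra.Properties.Ring ring using (-‿involutive)
    open IsStrictTotalOrder isStrictTotalOrder using (compare; _≟_; <-resp-≈)
      renaming (trans to <-trans; irrefl to <-irrefl)
    open import Relation.Binary.Reasoning.Setoid setoid
    open OrderedLinear F

    private
      variable
        d n : ℕ

    Null-map⁺ : ∀ {i} {I : Set i} (w : I → Point d) js {y} → (∀ {j} → j ∈ js → y · w j ≈ 0#) → Null y (map w js)
    Null-map⁺ w js h = AllP.map⁺ (All.tabulate h)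

    -- A basis chosen from the list. Indices rather than vectors are recorded, because `AffDim`
    -- speaks of maps into `Fin n`.
    select : ∀ {i} {I : Set i} (w : I → Point d) (js : List I) → ∃ λ m → ∃ λ (g : Fin m → I) → (∀ k → g k ∈ js) ×
             (∀ y → Null y (tabulate (w ∘ g)) → Null y (map w js)) × rank (tabulate (w ∘ g)) ≡ m
    select w [] = 0 , (λ ()) , (λ ()) , (λ _ _ → []) , ≡.refl
    select w (j ∷ js) with select w js
    ... | m , g , g∈ , null , r with dual? (tabulate (w ∘ g)) (w j)
    ...   | inj₁ p = suc m , j ◂ g , (λ { zero → here ≡.refl ; (suc k) → there (g∈ k) }) ,
                     (λ { y (q ∷ qs) → q ∷ null y qs }) , ≡.trans (rank-dual p) (≡.cong suc r)
    ...   | inj₂ k = m , g , (λ i → there (g∈ i)) , (λ y ps → k y ps ∷ null y ps) , r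

    Null-tabulate : ∀ {i} {I : Set i} (w : I → Point d) {js m} (g : Fin m → I) → (∀ k → g k ∈ js) →
                    ∀ y → Null y (map w js) → Null y (tabulate (w ∘ g))
    Null-tabulate w g g∈ y h = AllP.tabulate⁺ (λ k → All.lookup h (∈-map⁺ w (g∈ k)))

    rank-select : ∀ {i} {I : Set i} (w : I → Point d) js → proj₁ (select w js) ≡ rank (map w js)
    rank-select w js with select w js
    ... | m , g , g∈ , null , r = ≡.trans (≡.sym r) (rank-cong null (Null-tabulate w g g∈))

    private
      abstract
        outweigh : ∀ x z → 0# < x → ∃ λ t → 0# < t × 0# < t * x + 1# * z
        outweigh x z p with compare 0# z
        ... | tri< q _ _ = 1# , 0<1 , +-pos (*-pos 0<1 p) (*-pos 0<1 q)
        ... | tri≈ _ q _ = 1# , 0<1 , >0-cong (trans (sym (+-identityʳ _)) (+-congˡ (trans q (sym (*-identityˡ z))))) (*-pos 0<1 p)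
        ... | tri> _ _ q with inv-pos p
        -- The choice t = (1 - z)/x makes the combination equal to 1.
        ...   | y , e , y>0 = (1# - z) * y , *-pos (+-pos 0<1 (-pos q)) y>0 , >0-cong (begin
                1# ≈⟨ solve 1 (λ z → con (1 , 0) := (con (1 , 0) :- z) :* con (1 , 0) :+ con (1 , 0) :* z) refl z ⟩
                (1# - z) * 1# + 1# * z ≈⟨ +-congʳ (*-congˡ e) ⟨
                (1# - z) * (x * y) + 1# * z ≈⟨ solve 3 (λ x y z → (con (1 , 0) :- z) :* (x :* y) :+ con (1 , 0) :* z := (con (1 , 0) :- z) :* y :* x :+ con (1 , 0) :* z) refl x y z ⟩
                (1# - z) * y * x + 1# * z ∎) 0<1

    -- Positivity is open: a large multiple of `y` outweighs `z` at each vector of `Q`. The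
    -- multipliers found for single vectors may be added, since a larger one only helps.
    enlarge : ∀ (y z : Point d) Q → Positive y Q → ∃ λ t → 0# < t × Positive (lin t y 1# z) Q
    enlarge y z [] [] = 1# , 0<1 , []
    enlarge y z (q ∷ Q) (p ∷ ps) with outweigh (y · q) (z · q) p | enlarge y z Q ps
    ... | s , s>0 , hs | t , t>0 , ht = s + t , +-pos s>0 t>0 ,
          >0-cong (sym (trans (·-linˡ (s + t) y 1# z q) (x s t (y · q) (z · q)))) (+-pos hs (*-pos t>0 p)) ∷ more Q ps ht
      where
      x : ∀ s t a b → (s + t) * a + 1# * b ≈ (s * a + 1# * b) + t * a
      x s t a b = solve 4 (λ s t a b → (s :+ t) :* a :+ con (1 , 0) :* b := (s :* a :+ con (1 , 0) :* b) :+ t :* a) refl s t a b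
      more : ∀ Q → Positive y Q → Positive (lin t y 1# z) Q → Positive (lin (s + t) y 1# z) Q
      more [] _ _ = []
      more (q ∷ Q) (p ∷ ps) (r ∷ rs) = >0-cong (begin
        lin t y 1# z · q + s * (y · q) ≈⟨ +-congʳ (·-linˡ t y 1# z q) ⟩
        t * (y · q) + 1# * (z · q) + s * (y · q)
          ≈⟨ solve 4 (λ s t a b → (t :* a :+ con (1 , 0) :* b) :+ s :* a := (s :+ t) :* a :+ con (1 , 0) :* b) refl s t (y · q) (z · q) ⟩
        (s + t) * (y · q) + 1# * (z · q) ≈⟨ ·-linˡ (s + t) y 1# z q ⟨
        lin (s + t) y 1# z · q ∎) (+-pos r (*-pos s>0 p)) ∷ more Q ps rs

    -- combinations with nonnegative coefficients, not all zero
    data Cone⁺ (Q : List (Point d)) : Point d → Set (c ⊔ ℓ₁ ⊔ ℓ₂) where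
      gen  : ∀ {q} → q ∈ Q → Cone⁺ Q q
      comb : ∀ {a b u w} → 0# < a → 0# < b → Cone⁺ Q u → Cone⁺ Q w → Cone⁺ Q (lin a u b w)
      resp : ∀ {u w} → (∀ k → u k ≈ w k) → Cone⁺ Q u → Cone⁺ Q w

    Cone⁺-positive : ∀ {Q : List (Point d)} {y u} → Positive y Q → Cone⁺ Q u → 0# < y · u
    Cone⁺-positive h (gen q∈) = All.lookup h q∈
    Cone⁺-positive {y = y} h (comb {a} {b} {u} {w} a>0 b>0 p q) = >0-cong (sym (·-linʳ y a u b w))
      (+-pos (*-pos a>0 (Cone⁺-positive h p)) (*-pos b>0 (Cone⁺-positive h q)))
    Cone⁺-positive {y = y} h (resp e p) = >0-cong (·-congʳ y e) (Cone⁺-positive h p)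

    private
      abstract
        midpoint : ∀ {l u} → l < u → ∃ λ x → l < x × x < u
        midpoint {l} {u} l<u with inv-pos (+-pos 0<1 0<1)
        ... | h , e , h>0 = l + h * (u - l) ,
              0<-⇒< (>0-cong (solve 2 (λ l t → t := (l :+ t) :- l) refl l (h * (u - l))) pos) ,
              0<-⇒< (>0-cong (begin
                h * (u - l) ≈⟨ solve 3 (λ h l u → h :* (u :- l) := (con (1 , 0) :+ con (1 , 0)) :* h :* (u :- l) :- h :* (u :- l)) refl h l u ⟩
                (1# + 1#) * h * (u - l) - h * (u - l) ≈⟨ +-congʳ (*-congʳ e) ⟩
                1# * (u - l) - h * (u - l) ≈⟨ solve 3 (λ h l u → con (1 , 0) :* (u :- l) :- h :* (u :- l) := u :- (l :+ h :* (u :- l))) refl h l u ⟩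
                u - (l + h * (u - l)) ∎) pos)
          where
          pos : 0# < h * (u - l)
          pos = *-pos h>0 (<⇒0<- l<u)

      x<x+1 : ∀ x → x < x + 1#
      x<x+1 x = 0<-⇒< (>0-cong (solve 1 (λ x → con (1 , 0) := x :+ con (1 , 0) :- x) refl x) 0<1)

      above : ∀ l U → All (l <_) U → ∃ λ x → l < x × All (x <_) U
      above l [] [] = l + 1# , x<x+1 l , []
      above l (u ∷ U) (p ∷ ps) with above l U ps
      ... | x , l<x , hx with compare x u
      ...   | tri< x<u _ _ = x , l<x , x<u ∷ hx
      ...   | tri≈ _ x≈u _ with midpoint p
      ...     | y , l<y , y<u = y , l<y , y<u ∷ All.map (<-trans (<-cong refl (sym x≈u) y<u)) hx
      above l (u ∷ U) (p ∷ ps) | x , l<x , hx | tri> _ _ u<x with midpoint p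
      ...     | y , l<y , y<u = y , l<y , y<u ∷ All.map (<-trans (<-trans y<u u<x)) hx

      any-below : ∀ U → ∃ λ x → All (x <_) U
      any-below [] = 0# , []
      any-below (u ∷ U) with any-below U
      ... | x , hx with compare x u
      ...   | tri< x<u _ _ = x , x<u ∷ hx
      ...   | tri≈ _ x≈u _ = x - 1# , <-cong refl x≈u (y x) ∷ All.map (<-trans (y x)) hx
        where
        y : ∀ x → x - 1# < x
        y x = 0<-⇒< (>0-cong (solve 1 (λ x → con (1 , 0) := x :- (x :- con (1 , 0))) refl x) 0<1)
      ...   | tri> _ _ u<x = u - 1# , y u ∷ All.map (<-trans (<-trans (y u) u<x)) hx
        where
        y : ∀ x → x - 1# < x
        y x = 0<-⇒< (>0-cong (solve 1 (λ x → con (1 , 0) := x :- (x :- con (1 , 0))) refl x) 0<1)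

      -- The order is dense and unbounded, so finitely many strict bounds on one variable are met as
      -- soon as each lower bound is below each upper one.
      between : ∀ L U → All (λ l → All (l <_) U) L → ∃ λ x → All (_< x) L × All (x <_) U
      between [] U [] = let (x , h) = any-below U in x , [] , h
      between (l ∷ L) U (p ∷ ps) with between L U ps
      ... | x , hL , hU with compare l x
      ...   | tri< l<x _ _ = x , l<x ∷ hL , hU
      ...   | tri≈ _ l≈x _ = let (y , l<y , hy) = above l U p in y , l<y ∷ All.map (λ h → <-trans h (<-cong l≈x refl l<y)) hL , hy
      ...   | tri> _ _ x<l = let (y , l<y , hy) = above l U p in y , l<y ∷ All.map (λ h → <-trans h (<-trans x<l l<y)) hL , hy

      pos-cancelˡ : ∀ {a b} → 0# < a → 0# < a * b → 0# < b
      pos-cancelˡ {a} {b} p q with compare 0# b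
      ... | tri< r _ _ = r
      ... | tri≈ _ r _ = contradiction (trans (*-congˡ (sym r)) (zeroʳ a)) (<⇒≉ q)
      ... | tri> _ _ r = contradiction (trans (+-congˡ (solve 2 (λ a b → a :* (:- b) := :- (a :* b)) refl a b)) (-‿inverseʳ (a * b)))
                           (<⇒≉ (+-pos q (*-pos p (-pos r))))

      neg*neg : ∀ {a b} → a < 0# → b < 0# → 0# < a * b
      neg*neg {a} {b} p q = >0-cong (solve 2 (λ a b → (:- a) :* (:- b) := a :* b) refl a b) (*-pos (-pos p) (-pos q))

      record Signs (Q : List (Point (suc d))) : Set (c ⊔ ℓ₁ ⊔ ℓ₂) where
        field
          {P N Z} : List (Point (suc d))
          pos  : ∀ {q} → q ∈ P → 0# < q zero × q ∈ Q
          neg  : ∀ {q} → q ∈ N → q zero < 0# × q ∈ Q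
          null : ∀ {q} → q ∈ Z → q zero ≈ 0# × q ∈ Q
          cover : ∀ {q} → q ∈ Q → q ∈ P ⊎ q ∈ N ⊎ q ∈ Z

      signs : (Q : List (Point (suc d))) → Signs Q
      signs [] = record { P = [] ; N = [] ; Z = [] ; pos = λ () ; neg = λ () ; null = λ () ; cover = λ () }
      signs (q ∷ Q) with signs Q
      ... | s with compare 0# (q zero)
      ...   | tri< h _ _ = record
              { P = q ∷ Signs.P s ; N = Signs.N s ; Z = Signs.Z s
              ; pos = λ { (here ≡.refl) → h , here ≡.refl ; (there p) → map₂ there (Signs.pos s p) }
              ; neg = λ p → map₂ there (Signs.neg s p) ; null = λ p → map₂ there (Signs.null s p)
              ; cover = λ { (here ≡.refl) → inj₁ (here ≡.refl) ; (there p) → Data.Sum.map₁ there (Signs.cover s p) } }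
      ...   | tri≈ _ h _ = record
              { P = Signs.P s ; N = Signs.N s ; Z = q ∷ Signs.Z s
              ; null = λ { (here ≡.refl) → sym h , here ≡.refl ; (there p) → map₂ there (Signs.null s p) }
              ; pos = λ p → map₂ there (Signs.pos s p) ; neg = λ p → map₂ there (Signs.neg s p)
              ; cover = λ { (here ≡.refl) → inj₂ (inj₂ (here ≡.refl)) ; (there p) → Data.Sum.map₂ (Data.Sum.map₂ there) (Signs.cover s p) } }
      ...   | tri> _ _ h = record
              { P = Signs.P s ; N = q ∷ Signs.N s ; Z = Signs.Z s
              ; neg = λ { (here ≡.refl) → h , here ≡.refl ; (there p) → map₂ there (Signs.neg s p) }
              ; pos = λ p → map₂ there (Signs.pos s p) ; null = λ p → map₂ there (Signs.null s p)
              ; cover = λ { (here ≡.refl) → inj₂ (inj₁ (here ≡.refl)) ; (there p) → Data.Sum.map₂ (Data.Sum.map₁ there) (Signs.cover s p) } }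

    -- Gordan's alternative, by Fourier–Motzkin elimination of the first coordinate.
    gordan : ∀ d (Q : List (Point d)) → (∃ λ y → Positive y Q) ⊎ Cone⁺ Q (λ _ → 0#)
    gordan zero [] = inj₁ ((λ ()) , [])
    gordan zero (q ∷ Q) = inj₂ (resp (λ ()) (gen (here ≡.refl)))
    gordan (suc d) Q = [ inj₁ ∘ extend , inj₂ ∘ lift ]′ (gordan d (map tl D))
      where
      open Signs (signs Q)
      tl : Point (suc d) → Point d
      tl q k = q (suc k)
      -- For p with positive and q with negative first coordinate this is a positive combination in
      -- which that coordinate cancels.
      elim : Point (suc d) → Point (suc d) → Point (suc d)
      elim p q = lin (- q zero) p (p zero) q
      D : List (Point (suc d))
      D = Z ++ cartesianProductWith elim P N
      D-flat : ∀ {x} → x ∈ D → Cone⁺ Q x × x zero ≈ 0#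
      D-flat x∈ with ∈-++⁻ Z x∈
      ... | inj₁ x∈Z = gen (proj₂ (null x∈Z)) , proj₁ (null x∈Z)
      ... | inj₂ x∈PN with ∈-cartesianProductWith⁻ elim P N x∈PN
      ...   | p , q , p∈ , q∈ , ≡.refl = comb (-pos (proj₁ (neg q∈))) (proj₁ (pos p∈)) (gen (proj₂ (pos p∈))) (gen (proj₂ (neg q∈))) ,
              solve 2 (λ p q → (:- q) :* p :+ p :* q := con (0 , 0)) refl (p zero) (q zero)
      raise : ∀ {u} → Cone⁺ (map tl D) u → ∃ λ x → Cone⁺ Q x × x zero ≈ 0# × (∀ k → x (suc k) ≈ u k)
      raise (gen u∈) with ∈-map⁻ tl u∈
      ... | x , x∈ , ≡.refl = x , proj₁ (D-flat x∈) , proj₂ (D-flat x∈) , λ _ → refl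
      raise (comb {a} {b} a>0 b>0 p q) with raise p | raise q
      ... | x , hx , x0 , ex | y , hy , y0 , ey = lin a x b y , comb a>0 b>0 hx hy ,
            trans (+-cong (trans (*-congˡ x0) (zeroʳ a)) (trans (*-congˡ y0) (zeroʳ b))) (+-identityˡ 0#) ,
            λ k → +-cong (*-congˡ (ex k)) (*-congˡ (ey k))
      raise (resp e p) with raise p
      ... | x , hx , x0 , ex = x , hx , x0 , λ k → trans (ex k) (e k)
      lift : Cone⁺ (map tl D) (λ _ → 0#) → Cone⁺ Q (λ _ → 0#)
      lift h with raise h
      ... | x , hx , x0 , ex = resp (λ { zero → x0 ; (suc k) → ex k }) hx
      extend : (∃ λ y → Positive y (map tl D)) → ∃ λ y → Positive y Q
      extend (y , h) = solution (between (map bound P) (map bound N) (All.tabulate λ l∈ → All.tabulate λ u∈ → separated l∈ u∈))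
        where
        h′ : ∀ {x} → x ∈ D → 0# < y · tl x
        h′ x∈ = All.lookup h (∈-map⁺ tl x∈)
        -- The value of the first coordinate at which q vanishes: a lower bound for q in `P`, an
        -- upper one for q in `N`. The default 0 covers a zero first coordinate, which occurs in
        -- neither list.
        root : ∀ q → ∃ λ b → ¬ q zero ≈ 0# → b * q zero ≈ - (y · tl q)
        root q with q zero ≟ 0#
        ... | yes e = 0# , λ n → contradiction e n
        ... | no n with inverse (q zero) n
        ...   | i , e = - (y · tl q) * i , λ _ → trans (*-assoc _ i (q zero)) (trans (*-congˡ (trans (*-comm i (q zero)) e)) (*-identityʳ _))
        bound : Point (suc d) → Carrier
        bound q = proj₁ (root q)
        at : ∀ x q → ¬ q zero ≈ 0# → (x - bound q) * q zero ≈ (x ◂ y) · q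
        at x q n = trans (solve 3 (λ x b q → (x :- b) :* q := x :* q :- b :* q) refl x (bound q) (q zero))
          (+-congˡ (trans (-‿cong (proj₂ (root q) n)) (-‿involutive _)))
        <⇒≉′ : ∀ {x} → x < 0# → ¬ x ≈ 0#
        <⇒≉′ p e = <-irrefl e p
        separated : ∀ {l u} → l ∈ map bound P → u ∈ map bound N → l < u
        separated l∈ u∈ with ∈-map⁻ bound l∈ | ∈-map⁻ bound u∈
        ... | p , p∈ , ≡.refl | q , q∈ , ≡.refl = 0<-⇒< (pos-cancelˡ (*-pos (proj₁ (pos p∈)) (-pos (proj₁ (neg q∈)))) (>0-cong (begin
          y · tl (elim p q) ≈⟨ ·-linʳ y (- q zero) (tl p) (p zero) (tl q) ⟩
          - q zero * (y · tl p) + p zero * (y · tl q) ≈⟨ +-cong (*-congˡ (-‿involutive _)) (*-congˡ (-‿involutive _)) ⟨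
          - q zero * - - (y · tl p) + p zero * - - (y · tl q)
            ≈⟨ +-cong (*-congˡ (-‿cong (proj₂ (root p) (<⇒≉ (proj₁ (pos p∈)))))) (*-congˡ (-‿cong (proj₂ (root q) (<⇒≉′ (proj₁ (neg q∈)))))) ⟨
          - q zero * - (bound p * p zero) + p zero * - (bound q * q zero)
            ≈⟨ solve 4 (λ p q b b′ → (:- q) :* (:- (b :* p)) :+ p :* (:- (b′ :* q)) := (p :* (:- q)) :* (b′ :- b)) refl (p zero) (q zero) (bound p) (bound q) ⟩
          p zero * - q zero * (bound q - bound p) ∎) (h′ (∈-++⁺ʳ Z (∈-cartesianProductWith⁺ elim p∈ q∈)))))
        solution : (∃ λ x → All (_< x) (map bound P) × All (x <_) (map bound N)) → ∃ λ y → Positive y Q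
        solution (x , hL , hU) = x ◂ y , All.tabulate (λ {q} q∈ → [ onP , [ onN , onZ ]′ ]′ (cover q∈))
          where
          onP : ∀ {q} → q ∈ P → 0# < (x ◂ y) · q
          onP {q} q∈ = >0-cong (at x q (<⇒≉ (proj₁ (pos q∈)))) (*-pos (<⇒0<- (All.lookup hL (∈-map⁺ bound q∈))) (proj₁ (pos q∈)))
          onN : ∀ {q} → q ∈ N → 0# < (x ◂ y) · q
          onN {q} q∈ = >0-cong (at x q (<⇒≉′ (proj₁ (neg q∈)))) (neg*neg (<-cong (solve 2 (λ x b → :- (b :- x) := x :- b) refl x (bound q)) refl
            (-neg (<⇒0<- (All.lookup hU (∈-map⁺ bound q∈))))) (proj₁ (neg q∈)))
          onZ : ∀ {q} → q ∈ Z → 0# < (x ◂ y) · q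
          onZ {q} q∈ = >0-cong (trans (sym (+-identityˡ _)) (+-congʳ (sym (trans (*-congˡ (proj₁ (null q∈))) (zeroʳ x))))) (h′ (∈-++⁺ˡ q∈))

    Real : List (Point d) → List (Point d) → Set _
    Real E Q = ∃ λ y → Null y E × Positive y Q

    -- The equations are eliminated one by one through `shear` and `project`, which leaves a system
    -- of strict inequalities for `gordan`.
    real? : (E Q : List (Point d)) → Dec (Real E Q)
    real? [] Q with gordan _ Q
    ... | inj₁ (y , h) = yes (y , [] , h)
    ... | inj₂ k = no λ (y , _ , h) → <-irrefl refl (>0-cong (·-zeroʳ y (λ _ → refl)) (Cone⁺-positive h k))
    real? (e ∷ E) Q with dual? E e
    ... | inj₂ k with real? E Q
    ...   | yes (y , yE , h) = yes (y , k y yE ∷ yE , h)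
    ...   | no n = no λ { (y , _ ∷ yE , h) → n (y , yE , h) }
    real? (e ∷ E) Q | inj₁ (z , zE , ze) with real? E (map (shear z e) Q)
    ...   | yes (y , yE , h) = yes (project z e y , project-null zE ze yE ,
            All.map (λ {q} → >0-cong (sym (·-project y z e q))) (AllP.map⁻ h))
    ...   | no n = no λ { (y , ye ∷ yE , h) → n (y , yE , AllP.map⁺ (All.map (λ {q} → >0-cong (sym (·-shear-null y z e q ye))) h)) }

    -- Euler characteristic, up to a global sign, of the open cone { y : y = 0 on E, y > 0 on Q }.
    cell : List (Point d) → List (Point d) → ℤ.ℤ
    cell E Q = weight (real? E Q) (sgn (rank E))

    cell-cong : ∀ {E E′ Q Q′ : List (Point d)} → rank E ≡ rank E′ → (Real E Q → Real E′ Q′) → (Real E′ Q′ → Real E Q) → cell E Q ≡ cell E′ Q′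
    cell-cong {E = E} {E′} {Q} {Q′} r f g with real? E Q
    ... | yes p = ≡.trans (≡.cong sgn r) (≡.sym (weight-yes (real? E′ Q′) _ (f p)))
    ... | no n = ≡.sym (weight-no (real? E′ Q′) _ (n ∘ g))

    -- A hyperplane crossing the cone leaves two open halves of sign s and a slice of sign -s; one
    -- that misses the cone, or contains it, leaves a single piece of the original sign. The
    -- opposite vector is separate so that both orders of a difference can be inserted.
    cell-cut : ∀ (E Q : List (Point d)) h h⁻ → (∀ y → y · h⁻ ≈ - (y · h)) →
               cell E Q ≡ cell E (h ∷ Q) ℤ.+ (cell (h ∷ E) Q ℤ.+ cell E (h⁻ ∷ Q))
    cell-cut E Q h h⁻ opp = go (dual? E h) (real? E Q)
      where
      Zero A B : Set _
      Zero = Real (h ∷ E) Q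
      A = Real E (h ∷ Q)
      B = Real E (h⁻ ∷ Q)
      a-side : ∀ {y} → 0# < y · h⁻ → y · h < 0#
      a-side {y} p = <-cong (trans (-‿cong (opp y)) (-‿involutive _)) refl (-neg p)
      b-side : ∀ {y} → y · h < 0# → 0# < y · h⁻
      b-side {y} p = >0-cong (sym (opp y)) (-pos p)
      none : ¬ Real E Q → cell E Q ≡ cell E (h ∷ Q) ℤ.+ (cell (h ∷ E) Q ℤ.+ cell E (h⁻ ∷ Q))
      none n = ≡.trans (weight-no (real? E Q) _ n) (≡.sym (≡.cong₂ ℤ._+_ (weight-no (real? E (h ∷ Q)) _ λ { (y , yE , _ ∷ yQ) → n (y , yE , yQ) })
        (≡.cong₂ ℤ._+_ (weight-no (real? (h ∷ E) Q) _ λ { (y , _ ∷ yE , yQ) → n (y , yE , yQ) })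
                       (weight-no (real? E (h⁻ ∷ Q)) _ λ { (y , yE , _ ∷ yQ) → n (y , yE , yQ) }))))
      -- By convexity the segment between points on opposite sides meets the hyperplane; the weights
      -- are the distances of the two points from it.
      both⇒zero : A → B → Zero
      both⇒zero (y , yE , yh ∷ yQ) (z , zE , zh ∷ zQ) = lin (z · h⁻) y (y · h) z ,
        trans (·-linˡ (z · h⁻) y (y · h) z h) (trans (+-congʳ (*-congʳ (opp z)))
          (solve 2 (λ y z → (:- z) :* y :+ y :* z := con (0 , 0)) refl (y · h) (z · h))) ∷ Null-lin (z · h⁻) (y · h) yE zE ,
        All.zipWith (λ {q} (p , r) → >0-cong (sym (·-linˡ (z · h⁻) y (y · h) z q)) (+-pos (*-pos zh p) (*-pos yh r))) (yQ , zQ)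
      -- A large multiple of a point on the hyperplane keeps `z` plus that multiple inside the cone
      -- and does not change the value on `h`.
      tilt : Zero → ∀ {z} → Null z E → ∃ λ y → Null y E × Positive y Q × y · h ≈ z · h
      tilt (y , yh ∷ yE , yQ) {z} zE with enlarge y z Q yQ
      ... | t , _ , p = lin t y 1# z , Null-lin t 1# yE zE , p , trans (·-linˡ t y 1# z h)
            (trans (+-cong (trans (*-congˡ yh) (zeroʳ t)) (*-identityˡ _)) (+-identityˡ _))
      go : Dual E h ⊎ Kills E h → Dec (Real E Q) → cell E Q ≡ cell E (h ∷ Q) ℤ.+ (cell (h ∷ E) Q ℤ.+ cell E (h⁻ ∷ Q))
      go _ (no n) = none n
      go (inj₂ k) (yes p) = ≡.trans (cell-cong (≡.sym (rank-kills k)) (λ { (y , yE , yQ) → y , k y yE ∷ yE , yQ }) (λ { (y , _ ∷ yE , yQ) → y , yE , yQ }))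
        (≡.sym (≡.trans (≡.cong₂ ℤ._+_ (weight-no (real? E (h ∷ Q)) _ λ { (y , yE , yh ∷ _) → <⇒≉ yh (k y yE) })
          (≡.trans (≡.cong (λ t → cell (h ∷ E) Q ℤ.+ t) (weight-no (real? E (h⁻ ∷ Q)) _ λ { (y , yE , yh ∷ _) → <-irrefl (k y yE) (a-side yh) }))
                   (ℤₚ.+-identityʳ (cell (h ∷ E) Q)))) (ℤₚ.+-identityˡ (cell (h ∷ E) Q))))
      go (inj₁ (z , zE , zh)) (yes p@(x , xE , xQ)) = sides (real? (h ∷ E) Q)
        where
        s = sgn (rank E)
        rk : rank (h ∷ E) ≡ suc (rank E)
        rk = rank-dual (z , zE , zh)
        whole : cell E Q ≡ s
        whole = weight-yes (real? E Q) s p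
        eqn : ∀ {a b e : ℤ.ℤ} → cell E (h ∷ Q) ≡ a → cell (h ∷ E) Q ≡ b → cell E (h⁻ ∷ Q) ≡ e → s ≡ a ℤ.+ (b ℤ.+ e) →
              cell E Q ≡ cell E (h ∷ Q) ℤ.+ (cell (h ∷ E) Q ℤ.+ cell E (h⁻ ∷ Q))
        eqn ha hb he e = ≡.trans whole (≡.trans e (≡.sym (≡.cong₂ ℤ._+_ ha (≡.cong₂ ℤ._+_ hb he))))
        sides : Dec Zero → cell E Q ≡ cell E (h ∷ Q) ℤ.+ (cell (h ∷ E) Q ℤ.+ cell E (h⁻ ∷ Q))
        sides (yes o) = eqn (weight-yes (real? E (h ∷ Q)) s (plus (tilt o zE))) (≡.trans (weight-yes (real? (h ∷ E) Q) _ o) (≡.cong sgn rk))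
            (weight-yes (real? E (h⁻ ∷ Q)) s (minus (tilt o (Null-scale (- 1#) zE))))
            (≡.sym (≡.trans (≡.cong (λ t → s ℤ.+ t) (ℤₚ.+-inverseˡ s)) (ℤₚ.+-identityʳ s)))
          where
          plus : (∃ λ y → Null y E × Positive y Q × y · h ≈ z · h) → A
          plus (y , yE , yQ , e) = y , yE , >0-cong (sym (trans e zh)) 0<1 ∷ yQ
          minus : (∃ λ y → Null y E × Positive y Q × y · h ≈ scale (- 1#) z · h) → B
          minus (y , yE , yQ , e) = y , yE , b-side (<-cong (sym (trans e (trans (·-scaleˡ (- 1#) z h) (trans (*-congˡ zh) (*-identityʳ _))))) refl (-neg 0<1)) ∷ yQ
        sides (no n) with compare 0# (x · h)
        ... | tri< xh _ _ = eqn (weight-yes (real? E (h ∷ Q)) s a) (weight-no (real? (h ∷ E) Q) _ n)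
                (weight-no (real? E (h⁻ ∷ Q)) s (λ b → n (both⇒zero a b))) (≡.sym (≡.trans (≡.cong (λ t → s ℤ.+ t) (ℤₚ.+-identityˡ (ℤ.+ 0))) (ℤₚ.+-identityʳ s)))
          where
          a : A
          a = x , xE , xh ∷ xQ
        ... | tri≈ _ xh _ = contradiction (x , sym xh ∷ xE , xQ) n
        ... | tri> _ _ xh = eqn (weight-no (real? E (h ∷ Q)) s (λ a → n (both⇒zero a b))) (weight-no (real? (h ∷ E) Q) _ n)
                (weight-yes (real? E (h⁻ ∷ Q)) s b) (≡.sym (≡.trans (ℤₚ.+-identityˡ _) (ℤₚ.+-identityˡ s)))
          where
          b : B
          b = x , xE , b-side xh ∷ xQ

  -- The fan of functionals sorted by where they are minimal

  Σℤ : ∀ {a} {A : Set a} → (A → ℤ.ℤ) → List A → ℤ.ℤ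
  Σℤ f [] = ℤ.+ 0
  Σℤ f (x ∷ xs) = f x ℤ.+ Σℤ f xs

  Σℤ-++ : ∀ {a} {A : Set a} (f : A → ℤ.ℤ) xs ys → Σℤ f (xs ++ ys) ≡ Σℤ f xs ℤ.+ Σℤ f ys
  Σℤ-++ f [] ys = ≡.sym (ℤₚ.+-identityˡ _)
  Σℤ-++ f (x ∷ xs) ys = ≡.trans (≡.cong (λ t → f x ℤ.+ t) (Σℤ-++ f xs ys)) (≡.sym (ℤₚ.+-assoc (f x) _ _))

  Σℤ-map : ∀ {a b} {A : Set a} {B : Set b} (f : B → ℤ.ℤ) (g : A → B) xs → Σℤ f (map g xs) ≡ Σℤ (f ∘ g) xs
  Σℤ-map f g [] = ≡.refl
  Σℤ-map f g (x ∷ xs) = ≡.cong (λ t → f (g x) ℤ.+ t) (Σℤ-map f g xs)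

  Σℤ-cong : ∀ {a} {A : Set a} {f g : A → ℤ.ℤ} {xs} → All (λ x → f x ≡ g x) xs → Σℤ f xs ≡ Σℤ g xs
  Σℤ-cong [] = ≡.refl
  Σℤ-cong (p ∷ ps) = ≡.cong₂ ℤ._+_ p (Σℤ-cong ps)

  Σℤ-+ : ∀ {a} {A : Set a} (f g : A → ℤ.ℤ) xs → Σℤ (λ x → f x ℤ.+ g x) xs ≡ Σℤ f xs ℤ.+ Σℤ g xs
  Σℤ-+ f g [] = ≡.refl
  Σℤ-+ f g (x ∷ xs) = ≡.trans (≡.cong (λ t → f x ℤ.+ g x ℤ.+ t) (Σℤ-+ f g xs)) (exch (f x) (g x) (Σℤ f xs) (Σℤ g xs))
    where
    exch : ∀ a b c d → a ℤ.+ b ℤ.+ (c ℤ.+ d) ≡ a ℤ.+ c ℤ.+ (b ℤ.+ d)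
    exch = ℤSolver.solve-∀

  -- For an interval from A to B: the indices in A, those in B but not in A, and those outside B.
  data Status : Set where
    fixed free absent : Status

  -- The cones { y : the least values y · u i over the free i are attained exactly on the free i in `face` },
  -- where `face` contains all fixed and no absent indices.
  module Fan {c ℓ₁ ℓ₂} (F : OrderedField c ℓ₁ ℓ₂) where
    open OrderedField F hiding (zero) renaming (_<_ to infix 4 _<_; _≤_ to infix 4 _≤_)
    open Polytopes F using (∑; Point) renaming (_·_ to infixl 8 _·_)
    open IntegerSolver commutativeRing
    open OrderedLinear F
    open Systems F

    private
      variable
        k d : ℕ

    -- `rep` is one of the minimal free vectors, `ties` are the further minimal ones and `others`
    -- the rest: the cone is y · (x - rep) = 0 for ties x and y · (x - rep) > 0 for others x.
    record Cone (k d : ℕ) : Set c where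
      constructor cone
      field
        face : Subset k
        rep  : Point d
        ties others : List (Point d)

    base : (Fin k → Status) → Subset k
    base {zero} σ = []
    base {suc k} σ = side (σ zero) ∷ base (σ ∘ suc)
      where
      side : Status → Bool
      side fixed = inside
      side free = outside
      side absent = outside

    put : Bool → Cone k d → Cone (suc k) d
    put b (cone f r t o) = cone (b ∷ f) r t o

    tie apart : Point d → Cone k d → Cone (suc k) d
    tie x (cone f r t o) = cone (inside ∷ f) r (x ∷ t) o
    apart x (cone f r t o) = cone (outside ∷ f) r t (x ∷ o)

    -- A new free vector can be the only minimal one, which is the first cone listed; or it ties
    -- with the old minimum, or lies above it.
    grow : Status → Point d → Subset k → List (Point d) → List (Cone k d) → List (Cone (suc k) d)
    grow fixed x b f cs = map (put inside) cs
    grow absent x b f cs = map (put outside) cs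
    grow free x b f cs = cone (inside ∷ b) x [] f ∷ map (tie x) cs ++ map (apart x) cs

    add : Status → Point d → List (Point d) → List (Point d)
    add free x f = x ∷ f
    add fixed x f = f
    add absent x f = f

    frees : (Fin k → Status) → (Fin k → Point d) → List (Point d)
    frees {zero} σ u = []
    frees {suc k} σ u = add (σ zero) (u zero) (frees (σ ∘ suc) (u ∘ suc))

    cones : (Fin k → Status) → (Fin k → Point d) → List (Cone k d)
    cones {zero} σ u = []
    cones {suc k} σ u = grow (σ zero) (u zero) (base (σ ∘ suc)) (frees (σ ∘ suc) (u ∘ suc)) (cones (σ ∘ suc) (u ∘ suc))

    diff : Point d → Point d → Point d
    diff x z = lin 1# x (- 1#) z

    ·-diff : ∀ (y x z : Point d) → y · diff x z ≈ y · x - y · z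
    ·-diff y x z = trans (·-linʳ y 1# x (- 1#) z) (solve 2 (λ a b → con (1 , 0) :* a :+ (:- con (1 , 0)) :* b := a :- b) refl (y · x) (y · z))

    eqs ineqs : Cone k d → List (Point d)
    eqs (cone f r t o) = map (λ x → diff x r) t
    ineqs (cone f r t o) = map (λ x → diff x r) o

    value : List (Point d) → List (Point d) → Cone k d → ℤ.ℤ
    value E Q c = cell (eqs c ++ E) (ineqs c ++ Q)

    record Fits (f : List (Point d)) (γ : Cone k d) : Set c where
      open Cone γ
      field
        rep∈ : rep ∈ f
        cover : ∀ {x} → x ∈ f → x ∈ rep ∷ ties ⊎ x ∈ others
        others⊆ : ∀ {x} → x ∈ others → x ∈ f
        ties⊆ : ∀ {x} → x ∈ ties → x ∈ f

    private
      fits-grow : ∀ s (x : Point d) (b : Subset k) f {cs} → All (Fits f) cs → All (Fits (add s x f)) (grow s x b f cs)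
      fits-grow fixed x b f hs = AllP.map⁺ (All.map (λ h → record { Fits h }) hs)
      fits-grow absent x b f hs = AllP.map⁺ (All.map (λ h → record { Fits h }) hs)
      fits-grow free x b f hs = record { rep∈ = here ≡.refl ; others⊆ = there ; ties⊆ = λ ()
          ; cover = λ { (here p) → inj₁ (here p) ; (there p) → inj₂ p } }
        ∷ AllP.++⁺ (AllP.map⁺ (All.map tie-fits hs)) (AllP.map⁺ (All.map apart-fits hs))
        where
        tie-fits : ∀ {c} → Fits f c → Fits (x ∷ f) (tie x c)
        tie-fits h = record { rep∈ = there (Fits.rep∈ h) ; others⊆ = there ∘ Fits.others⊆ h
          ; ties⊆ = λ { (here p) → here p ; (there p) → there (Fits.ties⊆ h p) }
          ; cover = λ { (here p) → inj₁ (there (here p)) ; (there p) → Data.Sum.map₁ shift (Fits.cover h p) } }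
          where
          shift : ∀ {z r t} → z ∈ r ∷ t → z ∈ r ∷ x ∷ t
          shift (here p) = here p
          shift (there p) = there (there p)
        apart-fits : ∀ {c} → Fits f c → Fits (x ∷ f) (apart x c)
        apart-fits h = record { rep∈ = there (Fits.rep∈ h) ; ties⊆ = there ∘ Fits.ties⊆ h
          ; others⊆ = λ { (here p) → here p ; (there p) → there (Fits.others⊆ h p) }
          ; cover = λ { (here p) → inj₂ (here p) ; (there p) → Data.Sum.map₂ there (Fits.cover h p) } }

    fits : (σ : Fin k → Status) (u : Fin k → Point d) → All (Fits (frees σ u)) (cones σ u)
    fits {zero} σ u = []
    fits {suc k} σ u = fits-grow (σ zero) (u zero) (base (σ ∘ suc)) _ (fits (σ ∘ suc) (u ∘ suc))

    private
      no-cones : (σ : Fin k → Status) (u : Fin k → Point d) → frees σ u ≡ [] → cones σ u ≡ []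
      no-cones {zero} σ u e = ≡.refl
      no-cones {suc k} σ u e with σ zero
      ... | fixed = ≡.cong (map (put inside)) (no-cones (σ ∘ suc) (u ∘ suc) e)
      ... | absent = ≡.cong (map (put outside)) (no-cones (σ ∘ suc) (u ∘ suc) e)

      -- Once `x` is below the minimum it is below all free vectors. The condition can therefore be
      -- replaced by one that no longer mentions the representative, so that the pieces can be
      -- summed over all cones.
      below-all : ∀ {f} {c : Cone k d} E Q x → Fits f c →
        cell (eqs c ++ E) (diff (Cone.rep c) x ∷ ineqs c ++ Q) ≡ value E (map (λ z → diff z x) f ++ Q) c
      below-all {f = f} {c} E Q x h = cell-cong ≡.refl to from
        where
        open Cone c
        open Fits h
        to : Real (eqs c ++ E) (diff rep x ∷ ineqs c ++ Q) → Real (eqs c ++ E) (ineqs c ++ map (λ z → diff z x) f ++ Q)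
        to (y , yE , yr ∷ yQ) = y , yE , AllP.++⁺ (AllP.++⁻ˡ (ineqs c) yQ) (AllP.++⁺ (AllP.map⁺ (All.tabulate λ z∈ → go (cover z∈))) (AllP.++⁻ʳ (ineqs c) yQ))
          where
          shift : ∀ z → y · diff rep x + y · diff z rep ≈ y · diff z x
          shift z = trans (+-cong (·-diff y rep x) (·-diff y z rep)) (trans
            (solve 3 (λ r x z → (r :- x) :+ (z :- r) := z :- x) refl (y · rep) (y · x) (y · z)) (sym (·-diff y z x)))
          go : ∀ {z} → z ∈ rep ∷ ties ⊎ z ∈ others → 0# < y · diff z x
          go (inj₁ (here ≡.refl)) = yr
          go {z} (inj₁ (there z∈)) = >0-cong (trans (sym (+-identityʳ _)) (trans (+-congˡ (sym (All.lookup (AllP.map⁻ (AllP.++⁻ˡ (eqs c) yE)) z∈))) (shift z))) yr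
          go {z} (inj₂ z∈) = >0-cong (shift z) (+-pos yr (All.lookup (AllP.map⁻ (AllP.++⁻ˡ (ineqs c) yQ)) z∈))
        from : Real (eqs c ++ E) (ineqs c ++ map (λ z → diff z x) f ++ Q) → Real (eqs c ++ E) (diff rep x ∷ ineqs c ++ Q)
        from (y , yE , yQ) = y , yE , All.lookup (AllP.map⁻ (AllP.++⁻ˡ (map (λ z → diff z x) f) yQ′)) rep∈ ∷
            AllP.++⁺ (AllP.++⁻ˡ (ineqs c) yQ) (AllP.++⁻ʳ (map (λ z → diff z x) f) yQ′)
          where yQ′ = AllP.++⁻ʳ (ineqs c) yQ

      -- Each old cone is cut by the hyperplane where `x` equals its representative. The pieces with
      -- `x` above or on it are the new cones `apart` and `tie`; those with `x` below recombine, by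
      -- the induction hypothesis with more inequalities, to the cone where `x` alone is minimal.
      fan-grow : ∀ s (x : Point d) (b : Subset k) f cs E Q → All (Fits f) cs → (f ≡ [] → cs ≡ []) →
        (∀ E Q → f ≢ [] → Σℤ (value E Q) cs ≡ cell E Q) → add s x f ≢ [] → Σℤ (value E Q) (grow s x b f cs) ≡ cell E Q
      fan-grow fixed x b f cs E Q _ _ ih ne = ≡.trans (Σℤ-map (value E Q) (put inside) cs) (ih E Q ne)
      fan-grow absent x b f cs E Q _ _ ih ne = ≡.trans (Σℤ-map (value E Q) (put outside) cs) (ih E Q ne)
      fan-grow free x b [] cs E Q _ none ih ne with none ≡.refl
      ... | ≡.refl = ℤₚ.+-identityʳ _
      fan-grow free x b f@(_ ∷ _) cs E Q hs _ ih ne = begin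
        first ℤ.+ Σℤ (value E Q) (map (tie x) cs ++ map (apart x) cs)
          ≡⟨ ≡.cong (λ t → first ℤ.+ t) (≡.trans (Σℤ-++ (value E Q) (map (tie x) cs) _)
               (≡.cong₂ ℤ._+_ (Σℤ-map (value E Q) (tie x) cs) (Σℤ-map (value E Q) (apart x) cs))) ⟩
        first ℤ.+ (Σℤ (value E Q ∘ tie x) cs ℤ.+ Σℤ (value E Q ∘ apart x) cs)
          ≡⟨ exch first (Σℤ (value E Q ∘ tie x) cs) (Σℤ (value E Q ∘ apart x) cs) ⟩
        Σℤ (value E Q ∘ apart x) cs ℤ.+ (Σℤ (value E Q ∘ tie x) cs ℤ.+ first)
          ≡⟨ ≡.cong (λ t → Σℤ (value E Q ∘ apart x) cs ℤ.+ (Σℤ (value E Q ∘ tie x) cs ℤ.+ t)) (≡.sym (ih E Q′ λ ())) ⟩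
        Σℤ (value E Q ∘ apart x) cs ℤ.+ (Σℤ (value E Q ∘ tie x) cs ℤ.+ Σℤ (value E Q′) cs)
          ≡⟨ ≡.cong (λ t → Σℤ (value E Q ∘ apart x) cs ℤ.+ t) (≡.sym (Σℤ-+ (value E Q ∘ tie x) (value E Q′) cs)) ⟩
        Σℤ (value E Q ∘ apart x) cs ℤ.+ Σℤ (λ c → value E Q (tie x c) ℤ.+ value E Q′ c) cs
          ≡⟨ ≡.sym (Σℤ-+ (value E Q ∘ apart x) (λ c → value E Q (tie x c) ℤ.+ value E Q′ c) cs) ⟩
        Σℤ (λ c → value E Q (apart x c) ℤ.+ (value E Q (tie x c) ℤ.+ value E Q′ c)) cs
          ≡⟨ Σℤ-cong (All.map (λ {c} h → ≡.sym (split c h)) hs) ⟩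
        Σℤ (value E Q) cs
          ≡⟨ ih E Q (λ ()) ⟩
        cell E Q ∎
        where
        open ≡.≡-Reasoning
        Q′ = map (λ z → diff z x) f ++ Q
        first = cell E Q′
        exch : ∀ a b c → a ℤ.+ (b ℤ.+ c) ≡ c ℤ.+ (b ℤ.+ a)
        exch = ℤSolver.solve-∀
        split : ∀ c → Fits f c → value E Q c ≡ value E Q (apart x c) ℤ.+ (value E Q (tie x c) ℤ.+ value E Q′ c)
        split c h = ≡.trans (cell-cut (eqs c ++ E) (ineqs c ++ Q) (diff x (Cone.rep c)) (diff (Cone.rep c) x) opposite)
                            (≡.cong (λ t → value E Q (apart x c) ℤ.+ (value E Q (tie x c) ℤ.+ t)) (below-all E Q x h))
          where
          opposite : ∀ y → y · diff (Cone.rep c) x ≈ - (y · diff x (Cone.rep c))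
          opposite y = trans (·-diff y (Cone.rep c) x) (trans (solve 2 (λ a b → a :- b := :- (b :- a)) refl (y · Cone.rep c) (y · x))
                         (-‿cong (sym (·-diff y x (Cone.rep c)))))

    fan-sum : (σ : Fin k → Status) (u : Fin k → Point d) → frees σ u ≢ [] → ∀ E Q → Σℤ (value E Q) (cones σ u) ≡ cell E Q
    fan-sum {zero} σ u ne = contradiction ≡.refl ne
    fan-sum {suc k} σ u ne E Q = fan-grow (σ zero) (u zero) (base (σ ∘ suc)) (frees (σ ∘ suc) (u ∘ suc)) (cones (σ ∘ suc) (u ∘ suc)) E Q
      (fits (σ ∘ suc) (u ∘ suc)) (no-cones (σ ∘ suc) (u ∘ suc)) (λ E Q ne → fan-sum (σ ∘ suc) (u ∘ suc) ne E Q) ne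

    record Valid (σ : Fin k → Status) (u : Fin k → Point d) (γ : Cone k d) : Set c where
      open Cone γ
      field
        fixed∈ : ∀ {i} → σ i ≡ fixed → i ∈ˢ face
        absent∉ : ∀ {i} → σ i ≡ absent → i ∉ˢ face
        free∈ : ∀ {i} → σ i ≡ free → i ∈ˢ face → u i ∈ rep ∷ ties
        free∉ : ∀ {i} → σ i ≡ free → i ∉ˢ face → u i ∈ others
        ∈free : ∀ {x} → x ∈ rep ∷ ties → ∃ λ i → σ i ≡ free × i ∈ˢ face × x ≡ u i
        ∉free : ∀ {x} → x ∈ others → ∃ λ i → σ i ≡ free × i ∉ˢ face × x ≡ u i

    base-fixed : (σ : Fin k → Status) → ∀ {i} → σ i ≡ fixed → i ∈ˢ base σ
    base-fixed σ {zero} e with σ zero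
    base-fixed σ {zero} ≡.refl | fixed = here
    base-fixed σ {suc i} e = there (base-fixed (σ ∘ suc) e)

    base-other : (σ : Fin k → Status) → ∀ {i} → σ i ≢ fixed → i ∉ˢ base σ
    base-other σ {zero} ne i∈ with σ zero
    base-other σ {zero} ne i∈ | fixed = ne ≡.refl
    base-other σ {zero} ne () | free
    base-other σ {zero} ne () | absent
    base-other σ {suc i} ne (there i∈) = base-other (σ ∘ suc) ne i∈

    private
      frees-∈ : (σ : Fin k → Status) (u : Fin k → Point d) → ∀ {i} → σ i ≡ free → u i ∈ frees σ u
      frees-∈ σ u {zero} e with σ zero
      frees-∈ σ u {zero} ≡.refl | free = here ≡.refl
      frees-∈ σ u {suc i} e = add-∈ (σ zero) (frees-∈ (σ ∘ suc) (u ∘ suc) e)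
        where
        add-∈ : ∀ s {x z : Point _} {f} → z ∈ f → z ∈ add s x f
        add-∈ free = there
        add-∈ fixed = id
        add-∈ absent = id

      ∈-frees : (σ : Fin k → Status) (u : Fin k → Point d) → ∀ {x} → x ∈ frees σ u → ∃ λ i → σ i ≡ free × x ≡ u i
      ∈-frees {suc k} σ u x∈ with σ zero in e
      ∈-frees {suc k} σ u (here p) | free = zero , e , p
      ∈-frees {suc k} σ u (there x∈) | free = let (i , s , p) = ∈-frees (σ ∘ suc) (u ∘ suc) x∈ in suc i , s , p
      ∈-frees {suc k} σ u x∈ | fixed = let (i , s , p) = ∈-frees (σ ∘ suc) (u ∘ suc) x∈ in suc i , s , p
      ∈-frees {suc k} σ u x∈ | absent = let (i , s , p) = ∈-frees (σ ∘ suc) (u ∘ suc) x∈ in suc i , s , p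

      module _ (σ : Fin (suc k) → Status) (u : Fin (suc k) → Point d) where
        first-valid : σ zero ≡ free → Valid σ u (cone (inside ∷ base (σ ∘ suc)) (u zero) [] (frees (σ ∘ suc) (u ∘ suc)))
        first-valid e = record
          { fixed∈ = λ { {zero} _ → here ; {suc i} s → there (base-fixed (σ ∘ suc) s) }
          ; absent∉ = λ { {zero} s _ → case (≡.trans (≡.sym e) s) of λ () ; {suc i} s (there i∈) → base-other (σ ∘ suc) (λ s′ → case (≡.trans (≡.sym s) s′) of λ ()) i∈ }
          ; free∈ = λ { {zero} _ _ → here ≡.refl ; {suc i} s (there i∈) → contradiction i∈ (base-other (σ ∘ suc) (λ s′ → case (≡.trans (≡.sym s) s′) of λ ())) }
          ; free∉ = λ { {zero} _ n → contradiction here n ; {suc i} s _ → frees-∈ (σ ∘ suc) (u ∘ suc) s }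
          ; ∈free = λ { (here p) → zero , e , here , p ; (there ()) }
          ; ∉free = λ x∈ → let (i , s , p) = ∈-frees (σ ∘ suc) (u ∘ suc) x∈ in
                    suc i , s , (λ { (there i∈) → base-other (σ ∘ suc) (λ s′ → case (≡.trans (≡.sym s) s′) of λ ()) i∈ }) , p }

        put-fixed : σ zero ≡ fixed → ∀ {c} → Valid (σ ∘ suc) (u ∘ suc) c → Valid σ u (put inside c)
        put-fixed e v = record
          { fixed∈ = λ { {zero} _ → here ; {suc i} s → there (fixed∈ s) }
          ; absent∉ = λ { {zero} s _ → case (≡.trans (≡.sym e) s) of λ () ; {suc i} s (there i∈) → absent∉ s i∈ }
          ; free∈ = λ { {zero} s _ → case (≡.trans (≡.sym e) s) of λ () ; {suc i} s (there i∈) → free∈ s i∈ }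
          ; free∉ = λ { {zero} _ n → contradiction here n ; {suc i} s n → free∉ s (n ∘ there) }
          ; ∈free = λ x∈ → let (i , s , i∈ , p) = ∈free x∈ in suc i , s , there i∈ , p
          ; ∉free = λ x∈ → let (i , s , n , p) = ∉free x∈ in suc i , s , (λ { (there i∈) → n i∈ }) , p }
          where open Valid v

        put-absent : σ zero ≡ absent → ∀ {c} → Valid (σ ∘ suc) (u ∘ suc) c → Valid σ u (put outside c)
        put-absent e v = record
          { fixed∈ = λ { {zero} s → case (≡.trans (≡.sym e) s) of λ () ; {suc i} s → there (fixed∈ s) }
          ; absent∉ = λ { {suc i} s (there i∈) → absent∉ s i∈ }
          ; free∈ = λ { {suc i} s (there i∈) → free∈ s i∈ }
          ; free∉ = λ { {zero} s _ → case (≡.trans (≡.sym e) s) of λ () ; {suc i} s n → free∉ s (n ∘ there) }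
          ; ∈free = λ x∈ → let (i , s , i∈ , p) = ∈free x∈ in suc i , s , there i∈ , p
          ; ∉free = λ x∈ → let (i , s , n , p) = ∉free x∈ in suc i , s , (λ { (there i∈) → n i∈ }) , p }
          where open Valid v

        tie-valid : σ zero ≡ free → ∀ {c} → Valid (σ ∘ suc) (u ∘ suc) c → Valid σ u (tie (u zero) c)
        tie-valid e {c} v = record
          { fixed∈ = λ { {zero} _ → here ; {suc i} s → there (fixed∈ s) }
          ; absent∉ = λ { {zero} s _ → case (≡.trans (≡.sym e) s) of λ () ; {suc i} s (there i∈) → absent∉ s i∈ }
          ; free∈ = λ { {zero} s _ → there (here ≡.refl) ; {suc i} s (there i∈) → shift (free∈ s i∈) }
          ; free∉ = λ { {zero} _ n → contradiction here n ; {suc i} s n → free∉ s (n ∘ there) }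
          ; ∈free = λ { (here p) → let (i , s , i∈ , q) = ∈free (here p) in suc i , s , there i∈ , q
                      ; (there (here p)) → zero , e , here , p
                      ; (there (there x∈)) → let (i , s , i∈ , q) = ∈free (there x∈) in suc i , s , there i∈ , q }
          ; ∉free = λ x∈ → let (i , s , n , p) = ∉free x∈ in suc i , s , (λ { (there i∈) → n i∈ }) , p }
          where
          open Valid v
          shift : ∀ {z r t} → z ∈ r ∷ t → z ∈ r ∷ u zero ∷ t
          shift (here p) = here p
          shift (there p) = there (there p)

        apart-valid : σ zero ≡ free → ∀ {c} → Valid (σ ∘ suc) (u ∘ suc) c → Valid σ u (apart (u zero) c)
        apart-valid e {c} v = record
          { fixed∈ = λ { {zero} s → case (≡.trans (≡.sym e) s) of λ () ; {suc i} s → there (fixed∈ s) }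
          ; absent∉ = λ { {suc i} s (there i∈) → absent∉ s i∈ }
          ; free∈ = λ { {suc i} s (there i∈) → free∈ s i∈ }
          ; free∉ = λ { {zero} s _ → here ≡.refl ; {suc i} s n → there (free∉ s (n ∘ there)) }
          ; ∈free = λ x∈ → let (i , s , i∈ , p) = ∈free x∈ in suc i , s , there i∈ , p
          ; ∉free = λ { (here p) → zero , e , (λ ()) , p
                      ; (there x∈) → let (i , s , n , p) = ∉free x∈ in suc i , s , (λ { (there i∈) → n i∈ }) , p } }
          where open Valid v

        valid-grow : ∀ s → σ zero ≡ s → ∀ {cs} → All (Valid (σ ∘ suc) (u ∘ suc)) cs →
          All (Valid σ u) (grow s (u zero) (base (σ ∘ suc)) (frees (σ ∘ suc) (u ∘ suc)) cs)
        valid-grow fixed e vs = AllP.map⁺ (All.map (put-fixed e) vs)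
        valid-grow absent e vs = AllP.map⁺ (All.map (put-absent e) vs)
        valid-grow free e vs = first-valid e ∷ AllP.++⁺ (AllP.map⁺ (All.map (tie-valid e) vs)) (AllP.map⁺ (All.map (apart-valid e) vs))

    valid : (σ : Fin k → Status) (u : Fin k → Point d) → All (Valid σ u) (cones σ u)
    valid {zero} σ u = []
    valid {suc k} σ u = valid-grow σ u (σ zero) ≡.refl (valid (σ ∘ suc) (u ∘ suc))

    frees-nonempty : (σ : Fin k → Status) (u : Fin k → Point d) → ∀ {i} → σ i ≡ free → frees σ u ≢ []
    frees-nonempty σ u {i} s e with frees σ u | frees-∈ σ u s
    frees-nonempty σ u s ≡.refl | _ | ()

    Faces : List (Cone k d) → List (Subset k)
    Faces = map Cone.face

    private
      ∷-injʳ : ∀ {b b′ : Bool} {C C′ : Subset k} → b Vec.∷ C ≡ b′ ∷ C′ → C ≡ C′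
      ∷-injʳ ≡.refl = ≡.refl

      map-face : ∀ {j} (f : Cone k d → Cone j d) (g : Subset k → Subset j) cs → (∀ c → Cone.face (f c) ≡ g (Cone.face c)) →
                 map Cone.face (map f cs) ≡ map g (map Cone.face cs)
      map-face f g cs h = ≡.trans (≡.sym (map-∘ cs)) (≡.trans (map-cong h cs) (map-∘ cs))

      faces-of : Status → Subset k → List (Subset k) → List (Subset (suc k))
      faces-of fixed b fs = map (inside ∷_) fs
      faces-of free b fs = (inside ∷ b) ∷ map (inside ∷_) fs ++ map (outside ∷_) fs
      faces-of absent b fs = map (outside ∷_) fs

      faces-grow : ∀ s (x : Point d) (b : Subset k) f cs → Faces (grow s x b f cs) ≡ faces-of s b (Faces cs)
      faces-grow fixed x b f cs = map-face (put inside) (inside ∷_) cs λ _ → ≡.refl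
      faces-grow absent x b f cs = map-face (put outside) (outside ∷_) cs λ _ → ≡.refl
      faces-grow free x b f cs = ≡.cong ((inside ∷ b) ∷_) (≡.trans (map-++ Cone.face (map (tie x) cs) (map (apart x) cs))
        (≡.cong₂ _++_ (map-face (tie x) (inside ∷_) cs λ _ → ≡.refl) (map-face (apart x) (outside ∷_) cs λ _ → ≡.refl)))

      side-of : Status → Bool
      side-of fixed = inside
      side-of free = outside
      side-of absent = outside

      base-∉ : ∀ s (b : Subset k) {fs} → ¬ b ∈ fs → ¬ (side-of s ∷ b) ∈ faces-of s b fs
      base-∉ fixed b n p = let (_ , q , e) = ∈-map⁻ (inside ∷_) p in n (≡.subst (_∈ _) (≡.sym (∷-injʳ e)) q)
      base-∉ absent b n p = let (_ , q , e) = ∈-map⁻ (outside ∷_) p in n (≡.subst (_∈ _) (≡.sym (∷-injʳ e)) q)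
      base-∉ free b {fs} n (there p) with ∈-++⁻ (map (inside ∷_) fs) p
      ... | inj₁ q with ∈-map⁻ (inside ∷_) q
      ...   | _ , _ , ()
      base-∉ free b {fs} n (there p) | inj₂ q = let (_ , q , e) = ∈-map⁻ (outside ∷_) q in n (≡.subst (_∈ _) (≡.sym (∷-injʳ e)) q)

      unique-of : ∀ s (b : Subset k) {fs} → ¬ b ∈ fs → Unique fs → Unique (faces-of s b fs)
      unique-of fixed b n h = UniqueP.map⁺ ∷-injʳ h
      unique-of absent b n h = UniqueP.map⁺ ∷-injʳ h
      unique-of free b {fs} n h = All.tabulate (λ {f} p e → first f p e) AllPairs.∷
        UniqueP.++⁺ (UniqueP.map⁺ ∷-injʳ h) (UniqueP.map⁺ ∷-injʳ h) apart-sides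
        where
        first : ∀ f → f ∈ map (inside ∷_) fs ++ map (outside ∷_) fs → (inside ∷ b) ≢ f
        first f p e with ∈-++⁻ (map (inside ∷_) fs) p
        ... | inj₁ q = let (_ , q , e′) = ∈-map⁻ (inside ∷_) q in n (≡.subst (_∈ _) (≡.sym (∷-injʳ (≡.trans e e′))) q)
        ... | inj₂ q with ≡.trans e (proj₂ (proj₂ (∈-map⁻ (outside ∷_) q)))
        ...   | ()
        apart-sides : ∀ {f} → ¬ (f ∈ map (inside ∷_) fs × f ∈ map (outside ∷_) fs)
        apart-sides (p , q) with ∈-map⁻ (inside ∷_) p | ∈-map⁻ (outside ∷_) q
        ... | _ , _ , ≡.refl | _ , _ , ()

      base-eq : (σ : Fin (suc k) → Status) → base σ ≡ side-of (σ zero) ∷ base (σ ∘ suc)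
      base-eq σ with σ zero
      ... | fixed = ≡.refl
      ... | free = ≡.refl
      ... | absent = ≡.refl

    -- Some free index is always minimal, so the set of fixed indices alone has no cone. In an
    -- interval it is the lower end, which `face-list` adds separately.
    base-not-face : (σ : Fin k → Status) (u : Fin k → Point d) → ¬ base σ ∈ Faces (cones σ u)
    base-not-face {zero} σ u ()
    base-not-face {suc k} σ u = ≡.subst₂ (λ b fs → ¬ b ∈ fs) (≡.sym (base-eq σ)) (≡.sym (faces-grow (σ zero) (u zero) (base (σ ∘ suc)) _ (cones (σ ∘ suc) (u ∘ suc))))
      (base-∉ (σ zero) (base (σ ∘ suc)) (base-not-face (σ ∘ suc) (u ∘ suc)))

    faces-unique : (σ : Fin k → Status) (u : Fin k → Point d) → Unique (Faces (cones σ u))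
    faces-unique {zero} σ u = AllPairs.[]
    faces-unique {suc k} σ u = ≡.subst Unique (≡.sym (faces-grow (σ zero) (u zero) (base (σ ∘ suc)) _ (cones (σ ∘ suc) (u ∘ suc))))
      (unique-of (σ zero) (base (σ ∘ suc)) (base-not-face (σ ∘ suc) (u ∘ suc)) (faces-unique (σ ∘ suc) (u ∘ suc)))

    -- With `faces-unique`, every admissible set except the base occurs exactly once, be it a face
    -- or not; sets that are not faces have an empty cone.
    faces-complete : (σ : Fin k → Status) (u : Fin k → Point d) {C : Subset k} → (∀ {i} → σ i ≡ fixed → i ∈ˢ C) →
                     (∀ {i} → σ i ≡ absent → i ∉ˢ C) → C ≢ base σ → C ∈ Faces (cones σ u)
    faces-complete {zero} σ u {[]} _ _ ne = contradiction ≡.refl ne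
    faces-complete {suc k} σ u {b ∷ C} fx ab ne = ≡.subst (b ∷ C ∈_) (≡.sym (faces-grow (σ zero) (u zero) (base (σ ∘ suc)) _ (cones (σ ∘ suc) (u ∘ suc))))
      (go (σ zero) b ≡.refl fx ab (λ e → ne (≡.trans e (≡.sym (base-eq σ)))))
      where
      rec : C ≢ base (σ ∘ suc) → C ∈ Faces (cones (σ ∘ suc) (u ∘ suc))
      rec = faces-complete (σ ∘ suc) (u ∘ suc) (λ s → unthere (fx s)) (λ s i∈ → ab s (there i∈))
        where
        unthere : ∀ {i b} {C : Subset k} → suc i ∈ˢ b ∷ C → i ∈ˢ C
        unthere (there p) = p
      go : ∀ s b → σ zero ≡ s → (∀ {i} → σ i ≡ fixed → i ∈ˢ b ∷ C) → (∀ {i} → σ i ≡ absent → i ∉ˢ b ∷ C) →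
           b ∷ C ≢ side-of s ∷ base (σ ∘ suc) → b ∷ C ∈ faces-of s (base (σ ∘ suc)) (Faces (cones (σ ∘ suc) (u ∘ suc)))
      go fixed b e fx ab ne with fx {zero} e
      ... | here = ∈-map⁺ (inside ∷_) (rec (λ p → ne (≡.cong (inside ∷_) p)))
      go absent true e fx ab ne = contradiction here (ab {zero} e)
      go absent false e fx ab ne = ∈-map⁺ (outside ∷_) (rec (λ p → ne (≡.cong (outside ∷_) p)))
      go free false e fx ab ne = there (∈-++⁺ʳ (map (inside ∷_) (Faces (cones (σ ∘ suc) (u ∘ suc)))) (∈-map⁺ (outside ∷_) (rec (λ p → ne (≡.cong (outside ∷_) p)))))
      go free true e fx ab ne with VecP.≡-dec BoolP._≟_ C (base (σ ∘ suc))
      ... | yes p = here (≡.cong (inside ∷_) p)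
      ... | no n = there (∈-++⁺ˡ (∈-map⁺ (inside ∷_) (rec n)))

  -- Faces exposed by functionals; Euler's relation for an interval

  module Faces {c ℓ₁ ℓ₂} (F : OrderedField c ℓ₁ ℓ₂) {d n : ℕ} (w : Fin n → Polytopes.Point F d) where
    open OrderedField F hiding (zero) renaming (_<_ to infix 4 _<_; _≤_ to infix 4 _≤_)
    open Polytopes F using (∑; Point) renaming (_·_ to infixl 8 _·_)
    open IntegerSolver commutativeRing
    open OrderedLinear F
    open Systems F
    open Fan F

    vectors : Subset n → List (Point d)
    vectors S = map w (filter (_∈? S) (allFin n))

    ρ : Subset n → ℕ
    ρ S = rank (vectors S)

    -- Faces of the cone generated by the vectors. The empty and the full index set are treated like
    -- all others, so one argument serves every interval.
    FaceBy : Subset n → Set _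
    FaceBy S = ∃ λ y → (∀ {i} → i ∈ˢ S → y · w i ≈ 0#) × (∀ {i} → i ∉ˢ S → 0# < y · w i)

    null⁺ : ∀ {S y} → (∀ {i} → i ∈ˢ S → y · w i ≈ 0#) → Null y (vectors S)
    null⁺ {S} h = Null-map⁺ w _ (λ j∈ → h (proj₂ (∈-filter⁻ (_∈? S) {xs = allFin n} j∈)))

    null⁻ : ∀ {S y} → Null y (vectors S) → ∀ {i} → i ∈ˢ S → y · w i ≈ 0#
    null⁻ {S} h {i} i∈ = All.lookup h (∈-map⁺ w (∈-filter⁺ (_∈? S) (∈-allFin i) i∈))

    FaceBy? : ∀ S → Dec (FaceBy S)
    FaceBy? S with real? (vectors S) (vectors (∁ S))
    ... | yes (y , yE , yQ) = yes (y , null⁻ yE , λ {i} n → All.lookup yQ (∈-map⁺ w (∈-filter⁺ (_∈? ∁ S) (∈-allFin i) (x∉p⇒x∈∁p n))))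
    ... | no ¬r = no λ (y , h , h′) → ¬r (y , null⁺ h , AllP.map⁺ (All.tabulate λ {j} j∈ → h′ (x∈∁p⇒x∉p (proj₂ (∈-filter⁻ (_∈? ∁ S) {xs = allFin n} j∈)))))

    ρ-mono : ∀ {S T} → S ⊆ T → ρ S ℕ.≤ ρ T
    ρ-mono S⊆T = rank-mono λ y h → null⁺ (λ i∈ → null⁻ h (S⊆T i∈))

    outside-element : ∀ {S T : Subset n} → ¬ T ⊆ S → ∃ λ i → i ∈ˢ T × i ∉ˢ S
    outside-element {S} {T} ne with FinP.any? (λ i → (i ∈? T) ×-dec ¬? (i ∈? S))
    ... | yes r = r
    ... | no n = contradiction (λ {i} i∈ → decidable-stable (i ∈? S) λ i∉ → n (i , i∈ , i∉)) ne

    face-dual : ∀ {S i} → FaceBy S → i ∉ˢ S → Dual (vectors S) (w i)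
    face-dual (y , h , h′) i∉ = normalise (null⁺ h) (<⇒≉ (h′ i∉))

    ρ-step : ∀ {S T i} → S ⊆ T → i ∈ˢ T → Dual (vectors S) (w i) → suc (ρ S) ℕ.≤ ρ T
    ρ-step S⊆T i∈ p = ≡.subst (ℕ._≤ _) (rank-dual p) (rank-mono λ y h → null⁻ h i∈ ∷ null⁺ (λ j∈ → null⁻ h (S⊆T j∈)))

    -- The functional exposing `S` is positive at an element of `T` outside `S`, which makes that
    -- element independent of `S`.
    ρ-strict : ∀ {S T} → FaceBy S → S ⊆ T → S ≢ T → ρ S ℕ.< ρ T
    ρ-strict {S} {T} f S⊆T ne = let (i , i∈ , i∉) = outside-element (λ T⊆S → ne (⊆-antisym S⊆T T⊆S)) in ρ-step S⊆T i∈ (face-dual f i∉)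

    ∩-face : ∀ {S T} → FaceBy S → FaceBy T → FaceBy (S ∩ T)
    ∩-face {S} {T} (y , h , h′) (z , g , g′) = lin 1# y 1# z ,
      (λ {i} i∈ → let (i∈S , i∈T) = x∈p∩q⁻ S T i∈ in trans (at i) (trans (+-cong (h i∈S) (g i∈T)) (+-identityˡ 0#))) ,
      (λ {i} i∉ → >0-cong (sym (at i)) (go (i ∈? S) (i ∈? T) i∉))
      where
      at : ∀ i → lin 1# y 1# z · w i ≈ y · w i + z · w i
      at i = trans (·-linˡ 1# y 1# z (w i)) (+-cong (*-identityˡ _) (*-identityˡ _))
      go : ∀ {i} → Dec (i ∈ˢ S) → Dec (i ∈ˢ T) → i ∉ˢ S ∩ T → 0# < y · w i + z · w i
      go (yes p) (yes q) n = contradiction (x∈p∩q⁺ (p , q)) n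
      go (yes p) (no q) _ = >0-cong (trans (sym (+-identityˡ _)) (+-congʳ (sym (h p)))) (g′ q)
      go (no p) (yes q) _ = >0-cong (trans (sym (+-identityʳ _)) (+-congˡ (sym (g q)))) (h′ p)
      go (no p) (no q) _ = +-pos (h′ p) (g′ q)

    module Interval {A B : Subset n} (A⊆B : A ⊆ B) (fA : FaceBy A) (fB : FaceBy B) where
      private
        p : Point d
        p = proj₁ fA
        p-null : ∀ {i} → i ∈ˢ A → p · w i ≈ 0#
        p-null = proj₁ (proj₂ fA)
        p-pos : ∀ {i} → i ∉ˢ A → 0# < p · w i
        p-pos = proj₂ (proj₂ fA)

        status : ∀ {i} → Dec (i ∈ˢ A) → Dec (i ∈ˢ B) → Status
        status (yes _) _ = fixed
        status (no _) (yes _) = free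
        status (no _) (no _) = absent

        σ : Fin n → Status
        σ i = status (i ∈? A) (i ∈? B)

        σ-fixed : ∀ {i} → σ i ≡ fixed → i ∈ˢ A
        σ-fixed {i} = go (i ∈? A) (i ∈? B)
          where
          go : ∀ x y → status {i} x y ≡ fixed → i ∈ˢ A
          go (yes p) _ _ = p
          go (no _) (yes _) ()
          go (no _) (no _) ()

        fixed-σ : ∀ {i} → i ∈ˢ A → σ i ≡ fixed
        fixed-σ {i} i∈ = go (i ∈? A) (i ∈? B)
          where
          go : ∀ x y → status {i} x y ≡ fixed
          go (yes _) _ = ≡.refl
          go (no n) _ = contradiction i∈ n

        σ-free : ∀ {i} → σ i ≡ free → i ∉ˢ A × i ∈ˢ B
        σ-free {i} = go (i ∈? A) (i ∈? B)
          where
          go : ∀ x y → status {i} x y ≡ free → i ∉ˢ A × i ∈ˢ B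
          go (no n) (yes q) _ = n , q
          go (yes _) _ ()
          go (no _) (no _) ()

        free-σ : ∀ {i} → i ∉ˢ A → i ∈ˢ B → σ i ≡ free
        free-σ {i} n q = go (i ∈? A) (i ∈? B)
          where
          go : ∀ x y → status {i} x y ≡ free
          go (no _) (yes _) = ≡.refl
          go (yes p) _ = contradiction p n
          go (no _) (no n) = contradiction q n

        σ-absent : ∀ {i} → σ i ≡ absent → i ∉ˢ B
        σ-absent {i} = go (i ∈? A) (i ∈? B)
          where
          go : ∀ x y → status {i} x y ≡ absent → i ∉ˢ B
          go (no _) (no n) _ = n
          go (yes _) _ ()
          go (no _) (yes _) ()

        absent-σ : ∀ {i} → i ∉ˢ B → σ i ≡ absent
        absent-σ {i} n = go (i ∈? A) (i ∈? B)
          where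
          go : ∀ x y → status {i} x y ≡ absent
          go (no _) (no _) = ≡.refl
          go (yes p) _ = contradiction (A⊆B p) n
          go (no _) (yes q) = contradiction q n

        κ : ∀ i → ∃ λ a → i ∉ˢ A → (p · w i) * a ≈ 1# × 0# < a
        κ i = go (i ∈? A)
          where
          go : Dec (i ∈ˢ A) → ∃ λ a → i ∉ˢ A → (p · w i) * a ≈ 1# × 0# < a
          go (yes q) = 1# , λ n → contradiction q n
          go (no n) = let (a , e , pos) = inv-pos (p-pos n) in a , λ _ → e , pos

        -- Off `A` the vectors are scaled to `p` = 1, so that subtracting a multiple of `p` from a
        -- functional shifts all its values equally. On `A` the factor is the default 1.
        u : Fin n → Point d
        u i = scale (proj₁ (κ i)) (w i)

        u-value : ∀ y i → y · u i ≈ proj₁ (κ i) * (y · w i)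
        u-value y i = ·-scaleʳ (proj₁ (κ i)) y (w i)

        p-one : ∀ {i} → i ∉ˢ A → p · u i ≈ 1#
        p-one {i} n = trans (u-value p i) (trans (*-comm _ _) (proj₁ (proj₂ (κ i) n)))

        w-value : ∀ y {i} → i ∉ˢ A → y · w i ≈ (p · w i) * (y · u i)
        w-value y {i} n = sym (trans (*-congˡ (u-value y i)) (trans (sym (*-assoc _ _ _)) (trans (*-congʳ (proj₁ (proj₂ (κ i) n))) (*-identityˡ _))))

        E : Cone n d → List (Point d)
        E γ = eqs γ ++ vectors A

      intervalCones : List (Cone n d)
      intervalCones = cones σ u

      all-valid : All (Valid σ u) intervalCones
      all-valid = valid σ u

      module _ {γ : Cone n d} (v : Valid σ u γ) where
        open Cone γ
        open Valid v

        A⊆face : A ⊆ face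
        A⊆face i∈ = fixed∈ (fixed-σ i∈)

        face⊆B : face ⊆ B
        face⊆B {i} i∈ = decidable-stable (i ∈? B) λ n → absent∉ (absent-σ n) i∈

        A≢face : A ≢ face
        A≢face ≡.refl = let (i , s , i∈ , _) = ∈free (here ≡.refl) in proj₁ (σ-free s) i∈

        tied : ∀ {y} → Null y (E γ) → ∀ {i} → i ∈ˢ face → i ∉ˢ A → y · u i ≈ y · rep
        tied {y} yE {i} i∈ n = go (free∈ (free-σ n (face⊆B i∈)) i∈)
          where
          go : ∀ {x} → x ∈ rep ∷ ties → y · x ≈ y · rep
          go (here ≡.refl) = refl
          go {x} (there x∈) = trans (solve 2 (λ x r → x := (x :- r) :+ r) refl (y · x) (y · rep))
            (trans (+-congʳ (trans (sym (·-diff y x rep)) (All.lookup (AllP.map⁻ (AllP.++⁻ˡ (eqs γ) yE)) x∈))) (+-identityˡ _))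

        -- The functional y - (y · rep) p vanishes on the face and is positive on the rest of `B`.
        -- Adding a large multiple of the functional exposing `B` makes it positive outside `B`
        -- without changing it on `B`.
        cone⇒face : ∀ {Q} → Real (E γ) (ineqs γ ++ Q) → FaceBy face
        cone⇒face {Q} (y , yE , yQ) = extend (enlarge q z (vectors (∁ B)) q-pos)
          where
          q = proj₁ fB
          q-null : ∀ {i} → i ∈ˢ B → q · w i ≈ 0#
          q-null = proj₁ (proj₂ fB)
          q-pos : Positive q (vectors (∁ B))
          q-pos = AllP.map⁺ (All.tabulate λ {j} j∈ → proj₂ (proj₂ fB) (x∈∁p⇒x∉p (proj₂ (∈-filter⁻ (_∈? ∁ B) {xs = allFin n} j∈))))
          z : Point d
          z = lin 1# y (- (y · rep)) p
          z-value : ∀ i → z · w i ≈ y · w i - (y · rep) * (p · w i)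
          z-value i = trans (·-linˡ 1# y (- (y · rep)) p (w i))
            (solve 3 (λ a r b → con (1 , 0) :* a :+ (:- r) :* b := a :- r :* b) refl (y · w i) (y · rep) (p · w i))
          z-off : ∀ {i} → i ∉ˢ A → z · w i ≈ (p · w i) * (y · u i - y · rep)
          z-off {i} n = trans (z-value i) (trans (+-congʳ (w-value y n)) (solve 3 (λ a u r → a :* u :- r :* a := a :* (u :- r)) refl (p · w i) (y · u i) (y · rep)))
          z-null : ∀ {i} → i ∈ˢ face → z · w i ≈ 0#
          z-null {i} i∈ = go (i ∈? A)
            where
            go : Dec (i ∈ˢ A) → z · w i ≈ 0#
            go (yes a) = trans (z-value i) (trans (+-cong (null⁻ (AllP.++⁻ʳ (eqs γ) yE) a) (-‿cong (*-congˡ (p-null a))))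
              (solve 1 (λ r → con (0 , 0) :- r :* con (0 , 0) := con (0 , 0)) refl (y · rep)))
            go (no n) = trans (z-off n) (trans (*-congˡ (trans (+-congʳ (tied yE i∈ n)) (-‿inverseʳ _))) (zeroʳ _))
          z-pos : ∀ {i} → i ∉ˢ face → i ∈ˢ B → 0# < z · w i
          z-pos {i} n i∈B = >0-cong (sym (z-off i∉A)) (*-pos (p-pos i∉A) (>0-cong (·-diff y (u i) rep)
              (All.lookup (AllP.map⁻ (AllP.++⁻ˡ (ineqs γ) yQ)) (free∉ (free-σ i∉A i∈B) n))))
            where
            i∉A : i ∉ˢ A
            i∉A i∈A = n (A⊆face i∈A)
          extend : (∃ λ t → 0# < t × Positive (lin t q 1# z) (vectors (∁ B))) → FaceBy face
          extend (t , _ , h) = lin t q 1# z , (λ i∈ → trans (onB (face⊆B i∈)) (z-null i∈)) , λ {i} n → positive n (i ∈? B)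
            where
            onB : ∀ {i} → i ∈ˢ B → lin t q 1# z · w i ≈ z · w i
            onB {i} i∈ = trans (·-linˡ t q 1# z (w i)) (trans (+-congʳ (*-congˡ (q-null i∈)))
              (solve 2 (λ t z → t :* con (0 , 0) :+ con (1 , 0) :* z := z) refl t (z · w i)))
            positive : ∀ {i} → i ∉ˢ face → Dec (i ∈ˢ B) → 0# < lin t q 1# z · w i
            positive n (yes i∈) = >0-cong (sym (onB i∈)) (z-pos n i∈)
            positive {i} n (no i∉) = All.lookup h (∈-map⁺ w (∈-filter⁺ (_∈? ∁ B) (∈-allFin i) (x∉p⇒x∈∁p i∉)))

        -- A functional exposing the face has minimum 0 on the scaled vectors, attained exactly on
        -- the face.
        face⇒cone : FaceBy face → Real (E γ) (ineqs γ ++ [])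
        face⇒cone (y , h , h′) = y , AllP.++⁺ (AllP.map⁺ (All.tabulate λ x∈ → trans (·-diff y _ rep)
            (trans (+-cong (on (there x∈)) (-‿cong (on (here ≡.refl)))) (-‿inverseʳ 0#)))) (null⁺ (λ i∈ → h (A⊆face i∈))) ,
          AllP.++⁺ (AllP.map⁺ (All.tabulate λ x∈ → >0-cong (sym (trans (·-diff y _ rep) (trans (+-congˡ (-‿cong (on (here ≡.refl))))
            (solve 1 (λ x → x :- con (0 , 0) := x) refl _)))) (off x∈))) []
          where
          on : ∀ {x} → x ∈ rep ∷ ties → y · x ≈ 0#
          on x∈ with ∈free x∈
          ... | i , s , i∈ , ≡.refl = trans (u-value y i) (trans (*-congˡ (h i∈)) (zeroʳ _))
          off : ∀ {x} → x ∈ others → 0# < y · x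
          off x∈ with ∉free x∈
          ... | i , s , n , ≡.refl = >0-cong (sym (u-value y i)) (*-pos (proj₂ (proj₂ (κ i) (proj₁ (σ-free s)))) (h′ n))

        -- The equations of the cone and `rep` together span the face; `p` is zero on the equations
        -- and 1 at `rep`, so `rep` is independent of them.
        ρ-face : ρ face ≡ suc (rank (E γ))
        ρ-face = ≡.trans (rank-cong to from) (rank-dual (p , p-E , p-rep))
          where
          rep-index = ∈free (here ≡.refl)
          on : ∀ {x} → x ∈ rep ∷ ties → p · x ≈ 1#
          on x∈ with ∈free x∈
          ... | i , s , i∈ , ≡.refl = p-one (proj₁ (σ-free s))
          p-rep : p · rep ≈ 1#
          p-rep = on (here ≡.refl)
          p-E : Null p (E γ)
          p-E = AllP.++⁺ (AllP.map⁺ (All.tabulate λ x∈ → trans (·-diff p _ rep) (trans (+-cong (on (there x∈)) (-‿cong p-rep)) (-‿inverseʳ 1#)))) (null⁺ p-null)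
          to : ∀ y → Null y (vectors face) → Null y (rep ∷ E γ)
          to y h = zero-on (here ≡.refl) ∷ AllP.++⁺ (AllP.map⁺ (All.tabulate λ x∈ → trans (·-diff y _ rep)
              (trans (+-cong (zero-on (there x∈)) (-‿cong (zero-on (here ≡.refl)))) (-‿inverseʳ 0#)))) (null⁺ (λ i∈ → null⁻ h (A⊆face i∈)))
            where
            zero-on : ∀ {x} → x ∈ rep ∷ ties → y · x ≈ 0#
            zero-on x∈ with ∈free x∈
            ... | i , s , i∈ , ≡.refl = trans (u-value y i) (trans (*-congˡ (null⁻ h i∈)) (zeroʳ _))
          from : ∀ y → Null y (rep ∷ E γ) → Null y (vectors face)
          from y (yr ∷ yE) = null⁺ λ {i} i∈ → go i∈ (i ∈? A)
            where
            go : ∀ {i} → i ∈ˢ face → Dec (i ∈ˢ A) → y · w i ≈ 0#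
            go i∈ (yes a) = null⁻ (AllP.++⁻ʳ (eqs γ) yE) a
            go i∈ (no n) = trans (w-value y n) (trans (*-congˡ (trans (tied yE i∈ n) yr)) (zeroʳ _))

        signed : value (vectors A) [] γ ≡ ℤ.- weight (FaceBy? face) (sgn (ρ face))
        signed = go (FaceBy? face)
          where
          go : (f : Dec (FaceBy face)) → value (vectors A) [] γ ≡ ℤ.- weight f (sgn (ρ face))
          go (yes f) = ≡.trans (weight-yes (real? (E γ) (ineqs γ ++ [])) _ (face⇒cone f))
            (≡.sym (≡.trans (≡.cong (λ r → ℤ.- sgn r) ρ-face) (ℤₚ.neg-involutive (sgn (rank (E γ))))))
          go (no n) = weight-no (real? (E γ) (ineqs γ ++ [])) _ (λ r → n (cone⇒face r))

      module _ (A≢B : A ≢ B) where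
        private
          start : ∃ λ i → i ∈ˢ B × i ∉ˢ A
          start = outside-element (λ B⊆A → A≢B (⊆-antisym A⊆B B⊆A))

          i₀ : Fin n
          i₀ = proj₁ start

          nonempty : frees σ u ≢ []
          nonempty = frees-nonempty σ u (free-σ (proj₂ (proj₂ start)) (proj₁ (proj₂ start)))

        -- Without inequalities the whole cone is the annihilator of `A`, with sign `sgn (ρ A)`.
        -- Each part has the sign opposite to that of its face, by the shift of rank in `ρ-face`.
        signed-sum : Σℤ (λ γ → weight (FaceBy? (Cone.face γ)) (sgn (ρ (Cone.face γ)))) intervalCones ≡ ℤ.- sgn (ρ A)
        signed-sum = ≡.trans (≡.sym (ℤₚ.neg-involutive _)) (≡.cong ℤ.-_ (≡.trans (negate intervalCones)
          (≡.trans (≡.sym (Σℤ-cong (All.map (λ v → signed v) all-valid))) (≡.trans (fan-sum σ u nonempty (vectors A) [])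
            (weight-yes (real? (vectors A) []) _ ((λ _ → 0#) , All.tabulate (λ {x} _ → ·-zeroˡ x) , []))))))
          where
          negate : ∀ {f : Cone n d → ℤ.ℤ} cs → ℤ.- Σℤ f cs ≡ Σℤ (λ γ → ℤ.- f γ) cs
          negate [] = ≡.refl
          negate {f} (γ ∷ cs) = ≡.trans (ℤₚ.neg-distrib-+ (f γ) (Σℤ f cs)) (≡.cong (λ t → ℤ.- f γ ℤ.+ t) (negate cs))

        face-list : List (Subset n)
        face-list = A ∷ filter FaceBy? (Faces intervalCones)

        private
          base≡A : base σ ≡ A
          base≡A = ⊆-antisym (λ {i} i∈ → decidable-stable (i ∈? A) λ n → base-other′ (λ s → n (σ-fixed s)) i∈) (λ i∈ → base-fixed′ (fixed-σ i∈))
            where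
            base-other′ : ∀ {i} → σ i ≢ fixed → i ∉ˢ base σ
            base-other′ = base-other σ
            base-fixed′ : ∀ {i} → σ i ≡ fixed → i ∈ˢ base σ
            base-fixed′ = base-fixed σ

        face-list-unique : Unique face-list
        face-list-unique = All.tabulate (λ {S} S∈ e → base-not-face σ u (≡.subst (_∈ Faces intervalCones) (≡.trans (≡.sym e) (≡.sym base≡A))
            (proj₁ (∈-filter⁻ FaceBy? {xs = Faces intervalCones} S∈))))
          AllPairs.∷ UniqueP.filter⁺ FaceBy? (faces-unique σ u)

        face-list-sound : ∀ {S} → S ∈ face-list → FaceBy S × A ⊆ S × S ⊆ B
        face-list-sound (here ≡.refl) = fA , ⊆-refl , A⊆B
        face-list-sound (there S∈) = go (∈-map⁻ Cone.face (proj₁ (∈-filter⁻ FaceBy? {xs = Faces intervalCones} S∈)))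
            (proj₂ (∈-filter⁻ FaceBy? {xs = Faces intervalCones} S∈))
          where
          go : ∀ {S} → (∃ λ γ → γ ∈ intervalCones × S ≡ Cone.face γ) → FaceBy S → FaceBy S × A ⊆ S × S ⊆ B
          go (γ , γ∈ , ≡.refl) f = f , A⊆face (All.lookup all-valid γ∈) , face⊆B (All.lookup all-valid γ∈)

        face-list-complete : ∀ {S} → FaceBy S → A ⊆ S → S ⊆ B → S ∈ face-list
        face-list-complete {S} f A⊆S S⊆B = go (VecP.≡-dec BoolP._≟_ S A)
          where
          go : Dec (S ≡ A) → S ∈ face-list
          go (yes e) = here e
          go (no n) = there (∈-filter⁺ FaceBy? (faces-complete σ u (λ s → A⊆S (σ-fixed s)) (λ s i∈ → σ-absent s (S⊆B i∈))
            (λ e → n (≡.trans e base≡A))) f)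

        face-list-sum : Σℤ (sgn ∘ ρ) face-list ≡ ℤ.+ 0
        face-list-sum = ≡.trans (≡.cong (λ t → sgn (ρ A) ℤ.+ t) (≡.trans (filter-sum (Faces intervalCones))
            (≡.trans (Σℤ-map _ Cone.face intervalCones) signed-sum))) (ℤₚ.+-inverseʳ (sgn (ρ A)))
          where
          filter-sum : ∀ Ss → Σℤ (sgn ∘ ρ) (filter FaceBy? Ss) ≡ Σℤ (λ S → weight (FaceBy? S) (sgn (ρ S))) Ss
          filter-sum [] = ≡.refl
          filter-sum (S ∷ Ss) with FaceBy? S
          ... | yes _ = ≡.cong (λ t → sgn (ρ S) ℤ.+ t) (filter-sum Ss)
          ... | no _ = ≡.trans (filter-sum Ss) (≡.sym (ℤₚ.+-identityˡ _))

        private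
          find-cone : ∀ {Q} cs → Σℤ (value (vectors A) Q) cs ≢ ℤ.+ 0 → ∃ λ γ → γ ∈ cs × Real (E γ) (ineqs γ ++ Q)
          find-cone [] ne = contradiction ≡.refl ne
          find-cone {Q} (γ ∷ cs) ne = go (real? (E γ) (ineqs γ ++ Q))
            where
            go : Dec (Real (E γ) (ineqs γ ++ Q)) → ∃ λ γ′ → γ′ ∈ γ ∷ cs × Real (E γ′) (ineqs γ′ ++ Q)
            go (yes r) = γ , here ≡.refl , r
            go (no n) = let (γ′ , γ∈ , r) = find-cone {Q} cs (λ e → ne (≡.trans (≡.cong₂ ℤ._+_ (weight-no (real? (E γ) (ineqs γ ++ Q)) _ n) e) ≡.refl)) in γ′ , there γ∈ , r

          sgn≢0 : ∀ k → sgn k ≢ ℤ.+ 0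
          sgn≢0 zero ()
          sgn≢0 (suc k) e = sgn≢0 k (≡.trans (≡.sym (ℤₚ.neg-involutive (sgn k))) (≡.cong ℤ.-_ e))

        -- Separating two elements of B that are independent modulo A produces an intermediate face.
        between-faces : 2 ℕ.+ ρ A ℕ.≤ ρ B → ∃ λ C → FaceBy C × A ⊆ C × C ⊆ B × A ≢ C × C ≢ B
        between-faces gap = go (FinP.any? (λ j → (j ∈? B) ×-dec ¬? (j ∈? A) ×-dec real? (vectors A) (diff (u j) (u i₀) ∷ [])))
          where
          i₀∈B = proj₁ (proj₂ start)
          i₀∉A = proj₂ (proj₂ start)
          go : Dec (∃ λ j → j ∈ˢ B × j ∉ˢ A × Real (vectors A) (diff (u j) (u i₀) ∷ [])) → ∃ λ C → FaceBy C × A ⊆ C × C ⊆ B × A ≢ C × C ≢ B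
          -- The half-space where `u j` is above `u i₀` has nonzero signed count, so one of the
          -- cones meets it. On its face the values are equal, so the face misses `j` or `i₀` and
          -- differs from `B`.
          go (yes (j , j∈B , j∉A , r)) = finish (find-cone intervalCones (λ e → sgn≢0 (rank (vectors A))
              (≡.trans (≡.sym (weight-yes (real? (vectors A) (diff (u j) (u i₀) ∷ [])) _ r)) (≡.trans (≡.sym (fan-sum σ u nonempty (vectors A) (diff (u j) (u i₀) ∷ []))) e))))
            where
            finish : (∃ λ γ → γ ∈ intervalCones × Real (E γ) (ineqs γ ++ diff (u j) (u i₀) ∷ [])) → ∃ λ C → FaceBy C × A ⊆ C × C ⊆ B × A ≢ C × C ≢ B
            finish (γ , γ∈ , r@(y , yE , yQ)) = Cone.face γ , cone⇒face v r , A⊆face v , face⊆B v , A≢face v , clash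
              where
              v : Valid σ u γ
              v = All.lookup all-valid γ∈
              clash : Cone.face γ ≡ B → ⊥
              clash e = <⇒≉ (All.head (AllP.++⁻ʳ (ineqs γ) yQ)) (trans (·-diff y (u j) (u i₀)) (trans (+-cong
                (tied v yE (≡.subst (j ∈ˢ_) (≡.sym e) j∈B) j∉A) (-‿cong (tied v yE (≡.subst (i₀ ∈ˢ_) (≡.sym e) i₀∈B) i₀∉A))) (-‿inverseʳ _)))
          -- Otherwise all scaled vectors of `B` agree with `u i₀` modulo `A`, and the rank of `B`
          -- exceeds that of `A` by at most one.
          go (no none) = contradiction gap (ℕₚ.<⇒≱ (ℕ.s≤s (ℕₚ.≤-trans (rank-mono kills) (rank-∷≤ (w i₀) (vectors A)))))
            where
            killed : ∀ j → j ∈ˢ B → j ∉ˢ A → ∀ y → Null y (vectors A) → y · diff (u j) (u i₀) ≈ 0#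
            killed j j∈ j∉ y yA = go′ (dual? (vectors A) (diff (u j) (u i₀)))
              where
              go′ : Dual (vectors A) (diff (u j) (u i₀)) ⊎ Kills (vectors A) (diff (u j) (u i₀)) → y · diff (u j) (u i₀) ≈ 0#
              go′ (inj₁ (z , zE , e)) = contradiction (j , j∈ , j∉ , z , zE , >0-cong (sym e) 0<1 ∷ []) none
              go′ (inj₂ k) = k y yA
            kills : ∀ y → Null y (w i₀ ∷ vectors A) → Null y (vectors B)
            kills y (y₀ ∷ yA) = null⁺ λ {j} j∈ → on j∈ (j ∈? A)
              where
              u₀ : y · u i₀ ≈ 0#
              u₀ = trans (u-value y i₀) (trans (*-congˡ y₀) (zeroʳ _))
              on : ∀ {j} → j ∈ˢ B → Dec (j ∈ˢ A) → y · w j ≈ 0#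
              on j∈ (yes a) = null⁻ yA a
              on {j} j∈ (no n) = trans (w-value y n) (trans (*-congˡ (trans (solve 2 (λ a b → a := (a :- b) :+ b) refl (y · u j) (y · u i₀))
                (trans (+-cong (trans (sym (·-diff y (u j) (u i₀))) (killed j j∈ n y yA)) u₀) (+-identityˡ 0#)))) (zeroʳ _))

  -- The face lattice as an Eulerian poset

  open Combinatorics using (⟦_⟧; ⟦⟧-yes; ⟦⟧-no; EulerianPoset; module Intervals; module Dual; Neighborly;
    atoms≤coatoms; equal⇒dual; dual⇒equal; module Packing)

  unique-↭ : ∀ {a} {A : Set a} {xs ys : List A} → Unique xs → Unique ys → (∀ {x} → x ∈ xs → x ∈ ys) → (∀ {x} → x ∈ ys → x ∈ xs) → xs ↭ ys
  unique-↭ ux uy f g = ∼bag⇒↭ (unique∧set⇒bag ux uy (mk⇔ f g))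

  Σℤ-↭ : ∀ {a} {A : Set a} (f : A → ℤ.ℤ) {xs ys} → xs ↭ ys → Σℤ f xs ≡ Σℤ f ys
  Σℤ-↭ f Perm.refl = ≡.refl
  Σℤ-↭ f (prep x p) = ≡.cong (λ t → f x ℤ.+ t) (Σℤ-↭ f p)
  Σℤ-↭ f (swap {xs} {ys} x y p) = ≡.trans (≡.cong (λ t → f x ℤ.+ (f y ℤ.+ t)) (Σℤ-↭ f p)) (exch (f x) (f y) (Σℤ f ys))
    where
    exch : ∀ a b c → a ℤ.+ (b ℤ.+ c) ≡ b ℤ.+ (a ℤ.+ c)
    exch = ℤSolver.solve-∀
  Σℤ-↭ f (Perm.trans p q) = ≡.trans (Σℤ-↭ f p) (Σℤ-↭ f q)

  lookup-injective : ∀ {a} {A : Set a} {xs : List A} → Unique xs → ∀ {i j} → lookup xs i ≡ lookup xs j → i ≡ j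
  lookup-injective {xs = x ∷ xs} (_ AllPairs.∷ u) {zero} {zero} e = ≡.refl
  lookup-injective {xs = x ∷ xs} (p AllPairs.∷ u) {zero} {suc j} e = contradiction e (All.lookup p (∈-lookup {xs = xs} j))
  lookup-injective {xs = x ∷ xs} (p AllPairs.∷ u) {suc i} {zero} e = contradiction (≡.sym e) (All.lookup p (∈-lookup {xs = xs} i))
  lookup-injective {xs = x ∷ xs} (_ AllPairs.∷ u) {suc i} {suc j} e = ≡.cong suc (lookup-injective u e)

  subsets : ∀ n → List (Subset n)
  subsets zero = [] ∷ []
  subsets (suc n) = map (inside ∷_) (subsets n) ++ map (outside ∷_) (subsets n)

  ∈-subsets : ∀ {n} (S : Subset n) → S ∈ subsets n
  ∈-subsets [] = here ≡.refl
  ∈-subsets {suc n} (true ∷ S) = ∈-++⁺ˡ (∈-map⁺ (inside ∷_) (∈-subsets S))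
  ∈-subsets {suc n} (false ∷ S) = ∈-++⁺ʳ (map (inside ∷_) (subsets n)) (∈-map⁺ (outside ∷_) (∈-subsets S))

  subsets-unique : ∀ n → Unique (subsets n)
  subsets-unique zero = [] AllPairs.∷ AllPairs.[]
  subsets-unique (suc n) = UniqueP.++⁺ (UniqueP.map⁺ VecP.∷-injectiveʳ (subsets-unique n)) (UniqueP.map⁺ VecP.∷-injectiveʳ (subsets-unique n)) disjoint
    where
    disjoint : ∀ {S} → ¬ (S ∈ map (inside ∷_) (subsets n) × S ∈ map (outside ∷_) (subsets n))
    disjoint (p , q) with ∈-map⁻ (inside ∷_) p | ∈-map⁻ (outside ∷_) q
    ... | _ , _ , ≡.refl | _ , _ , ()

  module Counting {a p q} {A : Set a} {P : A → Set p} {Q : A → Set q} (P? : ∀ x → Dec (P x)) (Q? : ∀ x → Dec (Q x)) (r : A → ℕ) where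

    PQ? : ∀ x → Dec (P x × Q x)
    PQ? x = P? x ×-dec Q? x

    here# : A → ℕ → ℕ
    here# x k = ⟦ P? x ⟧ ℕ.* ⟦ Q? x ⟧ ℕ.* ⟦ r x ℕ.≟ k ⟧

    # : List A → ℕ → ℕ
    # xs k = sum {length xs} (λ i → here# (lookup xs i) k)

    evens odds : (ℕ → ℕ) → ℕ
    evens f = f 0 ℕ.+ f 2 ℕ.+ f 4 ℕ.+ f 6
    odds f = f 1 ℕ.+ f 3 ℕ.+ f 5 ℕ.+ f 7

    private
      parity : ∀ k → k ℕ.≤ 7 → ℤ.+ (evens (λ i → ⟦ k ℕ.≟ i ⟧)) ≡ sgn k ℤ.+ ℤ.+ (odds (λ i → ⟦ k ℕ.≟ i ⟧))
      parity 0 _ = ≡.refl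
      parity 1 _ = ≡.refl
      parity 2 _ = ≡.refl
      parity 3 _ = ≡.refl
      parity 4 _ = ≡.refl
      parity 5 _ = ≡.refl
      parity 6 _ = ≡.refl
      parity 7 _ = ≡.refl
      parity (suc (suc (suc (suc (suc (suc (suc (suc _)))))))) (ℕ.s≤s (ℕ.s≤s (ℕ.s≤s (ℕ.s≤s (ℕ.s≤s (ℕ.s≤s (ℕ.s≤s ())))))))

      head-balance : ∀ x → r x ℕ.≤ 7 → (p : Dec (P x)) (q : Dec (Q x)) →
        ℤ.+ (evens (λ k → ⟦ p ⟧ ℕ.* ⟦ q ⟧ ℕ.* ⟦ r x ℕ.≟ k ⟧)) ≡ weight (p ×-dec q) (sgn (r x)) ℤ.+ ℤ.+ (odds (λ k → ⟦ p ⟧ ℕ.* ⟦ q ⟧ ℕ.* ⟦ r x ℕ.≟ k ⟧))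
      head-balance x h (no _) _ = ≡.refl
      head-balance x h (yes _) (no _) = ≡.refl
      head-balance x h (yes _) (yes _) = ≡.trans (≡.cong ℤ.+_ (one (r x) 0 2 4 6)) (≡.trans (parity (r x) h)
          (≡.cong (λ t → sgn (r x) ℤ.+ ℤ.+ t) (≡.sym (one (r x) 1 3 5 7))))
        where
        one′ : ∀ a b c d → 1 ℕ.* a ℕ.+ 1 ℕ.* b ℕ.+ 1 ℕ.* c ℕ.+ 1 ℕ.* d ≡ a ℕ.+ b ℕ.+ c ℕ.+ d
        one′ = ℕSolver.solve-∀
        one : ∀ k a b c d → 1 ℕ.* ⟦ k ℕ.≟ a ⟧ ℕ.+ 1 ℕ.* ⟦ k ℕ.≟ b ⟧ ℕ.+ 1 ℕ.* ⟦ k ℕ.≟ c ⟧ ℕ.+ 1 ℕ.* ⟦ k ℕ.≟ d ⟧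
                        ≡ ⟦ k ℕ.≟ a ⟧ ℕ.+ ⟦ k ℕ.≟ b ⟧ ℕ.+ ⟦ k ℕ.≟ c ⟧ ℕ.+ ⟦ k ℕ.≟ d ⟧
        one k a b c d = one′ ⟦ k ℕ.≟ a ⟧ ⟦ k ℕ.≟ b ⟧ ⟦ k ℕ.≟ c ⟧ ⟦ k ℕ.≟ d ⟧

      filter-∷ : ∀ x xs → Σℤ (sgn ∘ r) (filter PQ? (x ∷ xs)) ≡ weight (PQ? x) (sgn (r x)) ℤ.+ Σℤ (sgn ∘ r) (filter PQ? xs)
      filter-∷ x xs with P? x | Q? x
      ... | yes _ | yes _ = ≡.refl
      ... | yes _ | no _ = ≡.sym (ℤₚ.+-identityˡ _)
      ... | no _ | yes _ = ≡.sym (ℤₚ.+-identityˡ _)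
      ... | no _ | no _ = ≡.sym (ℤₚ.+-identityˡ _)

      merge : ∀ a b c d a′ b′ c′ d′ → (a ℕ.+ a′) ℕ.+ (b ℕ.+ b′) ℕ.+ (c ℕ.+ c′) ℕ.+ (d ℕ.+ d′) ≡ (a ℕ.+ b ℕ.+ c ℕ.+ d) ℕ.+ (a′ ℕ.+ b′ ℕ.+ c′ ℕ.+ d′)
      merge = ℕSolver.solve-∀

      exch : ∀ a b c d → a ℤ.+ b ℤ.+ (c ℤ.+ d) ≡ a ℤ.+ c ℤ.+ (b ℤ.+ d)
      exch = ℤSolver.solve-∀

    -- Links the signed sum over a list to the unsigned counts by rank; the bound 7 is what lets the
    -- four even and four odd counts capture every element.
    balance : ∀ xs → (∀ {x} → x ∈ xs → r x ℕ.≤ 7) → ℤ.+ evens (# xs) ≡ Σℤ (sgn ∘ r) (filter PQ? xs) ℤ.+ ℤ.+ odds (# xs)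
    balance [] h = ≡.refl
    balance (x ∷ xs) h = begin
      ℤ.+ evens (# (x ∷ xs))
        ≡⟨ ≡.cong ℤ.+_ (merge (e 0) (e 2) (e 4) (e 6) (t 0) (t 2) (t 4) (t 6)) ⟩
      ℤ.+ (evens e ℕ.+ evens t)
        ≡⟨ ℤₚ.pos-+ (evens e) (evens t) ⟩
      ℤ.+ evens e ℤ.+ ℤ.+ evens t
        ≡⟨ ≡.cong₂ ℤ._+_ (head-balance x (h (here ≡.refl)) (P? x) (Q? x)) (balance xs (h ∘ there)) ⟩
      (weight (PQ? x) (sgn (r x)) ℤ.+ ℤ.+ odds e) ℤ.+ (Σℤ (sgn ∘ r) (filter PQ? xs) ℤ.+ ℤ.+ odds t)
        ≡⟨ exch (weight (PQ? x) (sgn (r x))) (ℤ.+ odds e) (Σℤ (sgn ∘ r) (filter PQ? xs)) (ℤ.+ odds t) ⟩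
      (weight (PQ? x) (sgn (r x)) ℤ.+ Σℤ (sgn ∘ r) (filter PQ? xs)) ℤ.+ (ℤ.+ odds e ℤ.+ ℤ.+ odds t)
        ≡⟨ ≡.cong₂ ℤ._+_ (≡.sym (filter-∷ x xs)) (≡.trans (≡.sym (ℤₚ.pos-+ (odds e) (odds t)))
             (≡.cong ℤ.+_ (≡.sym (merge (e 1) (e 3) (e 5) (e 7) (t 1) (t 3) (t 5) (t 7))))) ⟩
      Σℤ (sgn ∘ r) (filter PQ? (x ∷ xs)) ℤ.+ ℤ.+ odds (# (x ∷ xs)) ∎
      where
      open ≡.≡-Reasoning
      e t : ℕ → ℕ
      e = here# x
      t = # xs

    #-length : ∀ k xs → (∀ x → P x) → (∀ x → Q x) → # xs k ≡ length (filter (λ x → r x ℕ.≟ k) xs)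
    #-length k [] hp hq = ≡.refl
    #-length k (x ∷ xs) hp hq = ≡.trans (≡.cong₂ ℕ._+_ head (#-length k xs hp hq)) (≡.sym (step (r x ℕ.≟ k)))
      where
      R? = λ x → r x ℕ.≟ k
      head : here# x k ≡ ⟦ r x ℕ.≟ k ⟧
      head = ≡.trans (≡.cong₂ (λ p q → p ℕ.* q ℕ.* ⟦ r x ℕ.≟ k ⟧) (⟦⟧-yes (P? x) (hp x)) (⟦⟧-yes (Q? x) (hq x))) (ℕₚ.*-identityˡ _)
      step : (d : Dec (r x ≡ k)) → length (filter R? (x ∷ xs)) ≡ ⟦ R? x ⟧ ℕ.+ length (filter R? xs)
      step (yes p) = ≡.trans (≡.cong length (filter-accept R? p)) (≡.cong (ℕ._+ length (filter R? xs)) (≡.sym (⟦⟧-yes (R? x) p)))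
      step (no n) = ≡.trans (≡.cong length (filter-reject R? n)) (≡.cong (ℕ._+ length (filter R? xs)) (≡.sym (⟦⟧-no (R? x) n)))

  module FaceLattice {c ℓ₁ ℓ₂} (F : OrderedField c ℓ₁ ℓ₂) {d n : ℕ} (w : Fin n → Polytopes.Point F d) where
    open OrderedField F using (Carrier)
    open OrderedField F using (_≈_; 0#; 1#; refl; sym; trans)
    open Polytopes F using (Point)
    open OrderedLinear F
    open Systems F
    open Fan F
    open Faces F w

    faces : List (Subset n)
    faces = filter FaceBy? (subsets n)

    faces-unique′ : Unique faces
    faces-unique′ = UniqueP.filter⁺ FaceBy? (subsets-unique n)

    ∈-faces⁺ : ∀ {S} → FaceBy S → S ∈ faces
    ∈-faces⁺ {S} f = ∈-filter⁺ FaceBy? (∈-subsets S) f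

    ∈-faces⁻ : ∀ {S} → S ∈ faces → FaceBy S
    ∈-faces⁻ S∈ = proj₂ (∈-filter⁻ FaceBy? {xs = subsets n} S∈)

    N : ℕ
    N = length faces

    el : Fin N → Subset n
    el = lookup faces

    el-face : ∀ x → FaceBy (el x)
    el-face x = ∈-faces⁻ (∈-lookup {xs = faces} x)

    el-injective : ∀ {x y} → el x ≡ el y → x ≡ y
    el-injective = lookup-injective faces-unique′

    abstract
      index : ∀ {S} → FaceBy S → ∃ λ x → el x ≡ S
      index f = Any.index (∈-faces⁺ f) , ≡.sym (AnyP.lookup-index (∈-faces⁺ f))

    module _ (∅-face : FaceBy ∅) (full-face : FaceBy full) (ρ-full : ρ full ≡ 7) where

      private
        botᶠ topᶠ : Fin N
        botᶠ = proj₁ (index ∅-face)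
        topᶠ = proj₁ (index full-face)

        el-bot : el botᶠ ≡ ∅
        el-bot = proj₂ (index ∅-face)
        el-top : el topᶠ ≡ full
        el-top = proj₂ (index full-face)

        ρ-∅ : ρ ∅ ≡ 0
        ρ-∅ = ℕₚ.n≤0⇒n≡0 (rank-mono {E = []} λ y _ → null⁺ λ i∈ → contradiction i∈ ∉⊥)

      ρ≤7′ : ∀ S → ρ S ℕ.≤ 7
      ρ≤7′ S = ≡.subst (ρ S ℕ.≤_) ρ-full (ρ-mono (λ _ → ∈⊤))

      private
        euler′ : ∀ {A B} → A ⊆ B → FaceBy A → FaceBy B → A ≢ B →
                 let cnt = Counting.# (A ⊆?_) (_⊆? B) ρ faces in
                 cnt 0 ℕ.+ cnt 2 ℕ.+ cnt 4 ℕ.+ cnt 6 ≡ cnt 1 ℕ.+ cnt 3 ℕ.+ cnt 5 ℕ.+ cnt 7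
        euler′ {A} {B} A⊆B fA fB A≢B = ℤₚ.+-injective (≡.trans (balance faces (λ {S} _ → ρ≤7′ S))
            (≡.trans (≡.cong (λ t → t ℤ.+ ℤ.+ odds (# faces)) (≡.trans (Σℤ-↭ (sgn ∘ ρ) same) (I.face-list-sum A≢B))) (ℤₚ.+-identityˡ _)))
          where
          open Counting (A ⊆?_) (_⊆? B) ρ
          module I = Interval A⊆B fA fB
          same : filter PQ? faces ↭ I.face-list A≢B
          same = unique-↭ (UniqueP.filter⁺ PQ? faces-unique′) (I.face-list-unique A≢B)
            (λ S∈ → let (S∈ , A⊆S , S⊆B) = ∈-filter⁻ PQ? {xs = faces} S∈ in I.face-list-complete A≢B (∈-faces⁻ S∈) A⊆S S⊆B)
            (λ S∈ → let (f , A⊆S , S⊆B) = I.face-list-sound A≢B S∈ in ∈-filter⁺ PQ? (∈-faces⁺ f) (A⊆S , S⊆B))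

        meet-index : ∀ x y → ∃ λ z → el z ≡ el x ∩ el y
        meet-index x y = index (∩-face (el-face x) (el-face y))

      meetᶠ : Fin N → Fin N → Fin N
      meetᶠ x y = proj₁ (meet-index x y)

      meet-lower : ∀ x y {i} → i ∈ˢ el (meetᶠ x y) → i ∈ˢ el x × i ∈ˢ el y
      meet-lower x y {i} i∈ = x∈p∩q⁻ (el x) (el y) (≡.subst (i ∈ˢ_) (proj₂ (meet-index x y)) i∈)

      meet-greatest : ∀ x y {z} → el z ⊆ el x → el z ⊆ el y → el z ⊆ el (meetᶠ x y)
      meet-greatest x y p q {i} i∈ = ≡.subst (i ∈ˢ_) (≡.sym (proj₂ (meet-index x y))) (x∈p∩q⁺ (p i∈ , q i∈))

      private
        dense′ : ∀ {x y} → el x ⊆ el y → 2 ℕ.+ ρ (el x) ℕ.≤ ρ (el y) →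
                 ∃ λ z → el x ⊆ el z × el z ⊆ el y × ρ (el x) ℕ.< ρ (el z) × ρ (el z) ℕ.< ρ (el y)
        dense′ {x} {y} p gap = finish (Interval.between-faces p (el-face x) (el-face y) ne gap)
          where
          ne : el x ≢ el y
          ne e = ℕₚ.<⇒≱ (ℕₚ.≤-trans (ℕₚ.n≤1+n _) gap) (ℕₚ.≤-reflexive (≡.cong ρ (≡.sym e)))
          finish : (∃ λ C → FaceBy C × el x ⊆ C × C ⊆ el y × el x ≢ C × C ≢ el y) →
                   ∃ λ z → el x ⊆ el z × el z ⊆ el y × ρ (el x) ℕ.< ρ (el z) × ρ (el z) ℕ.< ρ (el y)
          finish (C , f , xC , Cy , x≢C , C≢y) = z , below , above , ρ-strict (el-face x) below (λ e → x≢C (≡.trans e ez)) , ρ-strict (el-face z) above (λ e → C≢y (≡.trans (≡.sym ez) e))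
            where
            z : Fin N
            z = proj₁ (index f)
            ez : el z ≡ C
            ez = proj₂ (index f)
            below : el x ⊆ el z
            below {i} i∈ = ≡.subst (i ∈ˢ_) (≡.sym ez) (xC i∈)
            above : el z ⊆ el y
            above {i} i∈ = Cy (≡.subst (i ∈ˢ_) ez i∈)

      poset : EulerianPoset
      poset = record
        { N = N ; _⊑_ = λ x y → el x ⊆ el y ; _⊑?_ = λ x y → el x ⊆? el y
        ; ⊑-refl = id ; ⊑-trans = λ p q → q ∘ p
        ; ρ = ρ ∘ el
        ; ρ-strict = λ {x} p ne → ρ-strict (el-face x) p (ne ∘ el-injective)
        ; bot = botᶠ ; top = topᶠ
        ; bot-min = λ x {i} i∈ → contradiction (≡.subst (i ∈ˢ_) el-bot i∈) ∉⊥
        ; top-max = λ x {i} _ → ≡.subst (i ∈ˢ_) (≡.sym el-top) ∈⊤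
        ; ρ-bot = ≡.trans (≡.cong ρ el-bot) ρ-∅ ; ρ-top = ≡.trans (≡.cong ρ el-top) ρ-full
        ; between = λ {x} {y} {a} {b} xa xb ya yb → meetᶠ a b , meet-greatest a b {x} xa xb , meet-greatest a b {y} ya yb ,
            (λ i∈ → proj₁ (meet-lower a b i∈)) , (λ i∈ → proj₂ (meet-lower a b i∈))
        ; dense = λ {x} {y} p gap → dense′ {x} {y} p gap
        ; euler = λ {x} {y} p ne → euler′ {el x} {el y} p (el-face x) (el-face y) (ne ∘ el-injective) }

      open Intervals poset using () renaming (c to count)

      count-length : ∀ k → count botᶠ topᶠ k ≡ length (filter (λ S → ρ S ℕ.≟ k) faces)
      count-length k = Counting.#-length (el botᶠ ⊆?_) (_⊆? el topᶠ) ρ k faces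
        (λ S {i} i∈ → contradiction (≡.subst (i ∈ˢ_) el-bot i∈) ∉⊥) (λ S {i} _ → ≡.subst (i ∈ˢ_) (≡.sym el-top) ∈⊤)

      -- Duplicate-free lists with the same members are permutations of each other. This compares
      -- the list inside `NumFaces` with the count in the poset.
      count-faces : ∀ k {L} → Unique L → (∀ {S} → S ∈ L → FaceBy S × ρ S ≡ k) → (∀ {S} → FaceBy S → ρ S ≡ k → S ∈ L) →
                    length L ≡ count botᶠ topᶠ k
      count-faces k {L} uL f g = ≡.trans (↭-length (unique-↭ uL (UniqueP.filter⁺ (λ S → ρ S ℕ.≟ k) faces-unique′)
          (λ S∈ → let (p , e) = f S∈ in ∈-filter⁺ (λ S → ρ S ℕ.≟ k) (∈-faces⁺ p) e)
          (λ S∈ → let (p , e) = ∈-filter⁻ (λ S → ρ S ℕ.≟ k) {xs = faces} S∈ in g (∈-faces⁻ p) e))) (≡.sym (count-length k))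

  -- Polytopes of dimension 6

  module SixPolytope {c ℓ₁ ℓ₂} (F : OrderedField c ℓ₁ ℓ₂) {n : ℕ} (v : Fin n → Polytopes.Point F 6) where
    open OrderedField F hiding (zero) renaming (_<_ to infix 4 _<_; _≤_ to infix 4 _≤_)
    open Polytopes F hiding (_·_)
    open Polytopes F using () renaming (_·_ to infixl 8 _·_)
    open IntegerSolver commutativeRing
    open OrderedLinear F
    open Systems F

    -- Homogeneous coordinates: the inequality a · x ≤ b becomes the functional (b , - a).
    w : Fin n → Point 7
    w j = 1# ◂ v j

    open Faces F w
    open FaceLattice F w hiding (N)

    private
      variable
        d m : ℕ

      neg-· : ∀ (a : Point d) u → (λ k → - a k) · u ≈ - (a · u)
      neg-· a u = trans (∑-cong λ k → solve 2 (λ a u → (:- a) :* u := (:- con (1 , 0)) :* (a :* u)) refl (a k) (u k))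
        (trans (∑-scale (- 1#) (λ k → a k * u k)) (solve 1 (λ s → (:- con (1 , 0)) :* s := :- s) refl (a · u)))

      homogeneous : ∀ b a j → (b ◂ (λ k → - a k)) · w j ≈ b - a · v j
      homogeneous b a j = +-cong (*-identityʳ b) (neg-· a (v j))

    face⁺ : ∀ {S} → IsFaceSet v S → FaceBy S
    face⁺ (a , b , on , off) = b ◂ (λ k → - a k) ,
      (λ {j} j∈ → trans (homogeneous b a j) (trans (+-congˡ (-‿cong (on j j∈))) (-‿inverseʳ b))) ,
      (λ {j} j∉ → >0-cong (sym (homogeneous b a j)) (<⇒0<- (off j j∉)))

    face⁻ : ∀ {S} → FaceBy S → IsFaceSet v S
    face⁻ (y , on , off) = (λ k → - y (suc k)) , y zero ,
      (λ j j∈ → trans (slack j) (trans (+-congˡ (-‿cong (on j∈))) (solve 1 (λ b → b :- con (0 , 0) := b) refl (y zero)))) ,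
      (λ j j∉ → 0<-⇒< (>0-cong (trans (solve 2 (λ b t → t := b :- (b :- t)) refl (y zero) (y · w j)) (+-congˡ (-‿cong (sym (slack j))))) (off j∉)))
      where
      slack : ∀ j → (λ k → - y (suc k)) · v j ≈ y zero - y · w j
      slack j = trans (neg-· (λ k → y (suc k)) (v j))
        (solve 2 (λ b t → :- t := b :- (b :* con (1 , 0) :+ t)) refl (y zero) ((λ k → y (suc k)) · v j))

    -- The leading coordinate 1 turns the condition that the coefficients sum to zero into one more
    -- coordinate of a linear dependency.
    independent⁺ : (p : Fin m → Point 6) → AffinelyIndependent p → Independent (λ i → 1# ◂ p i)
    independent⁺ p ind a e = ind a (trans (∑-cong (λ i → sym (*-identityʳ (a i)))) (e zero)) (λ k → e (suc k))

    independent⁻ : (p : Fin m → Point 6) → Independent (λ i → 1# ◂ p i) → AffinelyIndependent p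
    independent⁻ p ind a e₀ e = ind a (λ { zero → trans (∑-cong (λ i → *-identityʳ (a i))) e₀ ; (suc k) → e k })

    private
      rank-members : ∀ {S} m (g : Fin m → Fin n) → (∀ i → g i ∈ˢ S) → rank (tabulate (w ∘ g)) ℕ.≤ ρ S
      rank-members m g g∈ = rank-mono λ y h → tabulate⁺ (λ i → null⁻ {y = y} h (g∈ i))

      shrink : ∀ t m (g : Fin (t ℕ.+ m) → Fin n) → rank (tabulate (w ∘ g)) ≡ t ℕ.+ m →
               ∃ λ (g′ : Fin m → Fin n) → (∀ i → ∃ λ j → g′ i ≡ g j) × rank (tabulate (w ∘ g′)) ≡ m
      shrink zero m g r = g , (λ i → i , ≡.refl) , r
      shrink (suc t) m g r = let (g′ , members , r′) = shrink t m (g ∘ suc) tail-rank in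
          g′ , (λ i → let (j , e) = members i in suc j , e) , r′
        where
        tail-rank : rank (tabulate (w ∘ g ∘ suc)) ≡ t ℕ.+ m
        tail-rank = ℕₚ.≤-antisym (rank-tabulate≤ (t ℕ.+ m) (w ∘ g ∘ suc))
          (ℕₚ.≤-pred (≡.subst (ℕ._≤ suc (rank (tabulate (w ∘ g ∘ suc)))) r (rank-∷≤ (w (g zero)) (tabulate (w ∘ g ∘ suc)))))

      -- A basis chosen from `S` is shortened to the prescribed size, since `AffDim` quantifies over
      -- families of a fixed size.
      independent-in : ∀ {S} m → m ℕ.≤ ρ S → ∃ λ (g : Fin m → Fin n) → (∀ i → g i ∈ˢ S) × rank (tabulate (w ∘ g)) ≡ m
      independent-in {S} m h = go (select w (filter (_∈? S) (allFin n))) (rank-select w (filter (_∈? S) (allFin n)))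
        where
        go : (s : ∃ λ m → ∃ λ (g : Fin m → Fin n) → (∀ k → g k ∈ filter (_∈? S) (allFin n)) ×
               (∀ y → Null y (tabulate (w ∘ g)) → Null y (vectors S)) × rank (tabulate (w ∘ g)) ≡ m) → proj₁ s ≡ ρ S →
             ∃ λ (g : Fin m → Fin n) → (∀ i → g i ∈ˢ S) × rank (tabulate (w ∘ g)) ≡ m
        go (m₀ , g , g∈ , _ , r) e with ℕₚ.m≤n⇒∃[o]m+o≡n (≡.subst (m ℕ.≤_) (≡.sym e) h)
        ... | t , ≡.refl = go′ (≡.subst (λ k → ∃ λ (g : Fin k → Fin n) → (∀ i → g i ∈ filter (_∈? S) (allFin n)) × rank (tabulate (w ∘ g)) ≡ k) (ℕₚ.+-comm m t) (g , g∈ , r))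
          where
          go′ : (∃ λ (g : Fin (t ℕ.+ m) → Fin n) → (∀ i → g i ∈ filter (_∈? S) (allFin n)) × rank (tabulate (w ∘ g)) ≡ t ℕ.+ m) →
                ∃ λ (g : Fin m → Fin n) → (∀ i → g i ∈ˢ S) × rank (tabulate (w ∘ g)) ≡ m
          go′ (g , g∈ , r) = let (g′ , members , r′) = shrink t m g r in
            g′ , (λ i → let (j , e) = members i in ≡.subst (_∈ˢ S) (≡.sym e) (proj₂ (∈-filter⁻ (_∈? S) {xs = allFin n} (g∈ j)))) , r′

    affDim⇒ρ : ∀ {S k} → AffDim v S k → ρ S ≡ suc k
    affDim⇒ρ {S} {k} ((g , g∈ , ind) , none) = ℕₚ.≤-antisym
      (ℕₚ.≮⇒≥ λ l → let (g′ , g′∈ , r) = independent-in {S} (suc (suc k)) l in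
        none g′ g′∈ (independent⁻ (v ∘ g′) (rank⇒independent (suc (suc k)) (w ∘ g′) r)))
      (≡.subst (ℕ._≤ ρ S) (independent⇒rank (suc k) (w ∘ g) (independent⁺ (v ∘ g) ind)) (rank-members (suc k) g g∈))

    ρ⇒affDim : ∀ {S k} → ρ S ≡ suc k → AffDim v S k
    ρ⇒affDim {S} {k} e = (let (g , g∈ , r) = independent-in {S} (suc k) (ℕₚ.≤-reflexive (≡.sym e)) in
        g , g∈ , independent⁻ (v ∘ g) (rank⇒independent (suc k) (w ∘ g) r)) ,
      λ g g∈ ind → ℕₚ.<⇒≱ (ℕₚ.n<1+n (suc k)) (≡.subst₂ ℕ._≤_ (independent⇒rank (suc (suc k)) (w ∘ g) (independent⁺ (v ∘ g) ind)) e
        (rank-members (suc (suc k)) g g∈))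

    isFace⁺ : ∀ {S k} → IsFace v k S → FaceBy S × ρ S ≡ suc k
    isFace⁺ (f , a) = face⁺ f , affDim⇒ρ a

    isFace⁻ : ∀ {S k} → FaceBy S → ρ S ≡ suc k → IsFace v k S
    isFace⁻ f e = face⁻ f , ρ⇒affDim e

    ∅-face : FaceBy ∅
    ∅-face = unit zero , (λ i∈ → contradiction i∈ ∉⊥) , λ {i} _ → >0-cong (sym (·-unit zero (w i))) 0<1

    full-face : FaceBy full
    full-face = (λ _ → 0#) , (λ {i} _ → ·-zeroˡ (w i)) , λ i∉ → contradiction ∈⊤ i∉

    private
      -- Extracts the coefficients that `ConvexPosition` speaks of. Their sum is kept positive so
      -- that it can be normalised to 1.
      coefficients : ∀ {i : Fin n} {js} {x : Point d} (u : Fin n → Point d) → (∀ {j} → j ∈ js → j ≢ i) → Cone⁺ (map u js) x →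
        ∃ λ (μ : Fin n → Carrier) → μ i ≈ 0# × (∀ j → 0# ≤ μ j) × 0# < ∑ μ × (∀ k → ∑ (λ j → μ j * u j k) ≈ x k)
      coefficients {i = i} u ne (gen q∈) with ∈-map⁻ u q∈
      ... | j , j∈ , ≡.refl = unit j , unit-off j i (ne j∈) , unit≥0 j ,
            >0-cong (sym (trans (∑-cong (λ k → sym (*-identityʳ (unit j k)))) (·-unit j (λ _ → 1#)))) 0<1 , λ k → ·-unit j (λ l → u l k)
        where
        unit-off : ∀ {m} (j i : Fin m) → j ≢ i → unit j i ≈ 0#
        unit-off zero zero n = contradiction ≡.refl n
        unit-off zero (suc i) n = refl
        unit-off (suc j) zero n = refl
        unit-off (suc j) (suc i) n = unit-off j i (n ∘ ≡.cong suc)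
        unit≥0 : ∀ {m} (j i : Fin m) → 0# ≤ unit j i
        unit≥0 zero zero = inj₁ 0<1
        unit≥0 zero (suc i) = inj₂ refl
        unit≥0 (suc j) zero = inj₂ refl
        unit≥0 (suc j) (suc i) = unit≥0 j i
      coefficients u ne (comb {a} {b} {x} {y} a>0 b>0 p q) with coefficients u ne p | coefficients u ne q
      ... | μ , μi , μ≥0 , μ>0 , μe | ν , νi , ν≥0 , ν>0 , νe = lin a μ b ν ,
            trans (+-cong (trans (*-congˡ μi) (zeroʳ a)) (trans (*-congˡ νi) (zeroʳ b))) (+-identityˡ 0#) ,
            (λ j → nonneg (μ≥0 j) (ν≥0 j)) ,
            >0-cong (sym (∑-lin a μ b ν)) (+-pos (*-pos a>0 μ>0) (*-pos b>0 ν>0)) ,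
            λ k → trans (∑-cong λ j → solve 5 (λ a b m n u → (a :* m :+ b :* n) :* u := a :* (m :* u) :+ b :* (n :* u)) refl a b (μ j) (ν j) (u j k))
                    (trans (∑-lin a (λ j → μ j * u j k) b (λ j → ν j * u j k)) (+-cong (*-congˡ (μe k)) (*-congˡ (νe k))))
        where
        nonneg : ∀ {x y} → 0# ≤ x → 0# ≤ y → 0# ≤ a * x + b * y
        nonneg (inj₁ p) (inj₁ q) = inj₁ (+-pos (*-pos a>0 p) (*-pos b>0 q))
        nonneg (inj₁ p) (inj₂ q) = inj₁ (>0-cong (trans (sym (+-identityʳ _)) (+-congˡ (trans (sym (zeroʳ b)) (*-congˡ q)))) (*-pos a>0 p))
        nonneg (inj₂ p) (inj₁ q) = inj₁ (>0-cong (trans (sym (+-identityˡ _)) (+-congʳ (trans (sym (zeroʳ a)) (*-congˡ p)))) (*-pos b>0 q))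
        nonneg (inj₂ p) (inj₂ q) = inj₂ (trans (sym (+-identityˡ 0#)) (+-cong (trans (sym (zeroʳ a)) (*-congˡ p)) (trans (sym (zeroʳ b)) (*-congˡ q))))
      coefficients u ne (resp e p) with coefficients u ne p
      ... | μ , μi , μ≥0 , μ>0 , μe = μ , μi , μ≥0 , μ>0 , λ k → trans (μe k) (e k)

    -- Gordan's alternative for the differences v i - v j with j ≠ i: either a functional is larger
    -- at v i than at all other points, or a nontrivial nonnegative combination of the differences
    -- vanishes, which after scaling writes v i as a convex combination of the others.
    vertex-face : ConvexPosition v → ∀ i → FaceBy ⁅ i ⁆
    vertex-face cp i = go (gordan 6 (map u js))
      where
      js : List (Fin n)
      js = filter (λ j → ¬? (j FinP.≟ i)) (allFin n)
      u : Fin n → Point 6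
      u j = lin 1# (v i) (- 1#) (v j)
      go : (∃ λ y → Positive y (map u js)) ⊎ Cone⁺ (map u js) (λ _ → 0#) → FaceBy ⁅ i ⁆
      go (inj₁ (a , h)) = face⁺ (a , a · v i , (λ j j∈ → reflexive (≡.cong (λ k → a · v k) (x∈⁅y⁆⇒x≡y i j∈))) ,
        λ j j∉ → 0<-⇒< (>0-cong (trans (·-linʳ a 1# (v i) (- 1#) (v j)) (solve 2 (λ x y → con (1 , 0) :* x :+ (:- con (1 , 0)) :* y := x :- y) refl (a · v i) (a · v j)))
          (All.lookup h (∈-map⁺ u (∈-filter⁺ (λ j → ¬? (j FinP.≟ i)) (∈-allFin j) (λ e → j∉ (≡.subst (_∈ˢ ⁅ i ⁆) (≡.sym e) (x∈⁅x⁆ i))))))))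
      go (inj₂ k) = ⊥-elim (cp i (normalised (coefficients {i = i} u (λ j∈ → proj₂ (∈-filter⁻ (λ j → ¬? (j FinP.≟ i)) {xs = allFin n} j∈)) k)))
        where
        normalised : (∃ λ (μ : Fin n → Carrier) → μ i ≈ 0# × (∀ j → 0# ≤ μ j) × 0# < ∑ μ × (∀ k → ∑ (λ j → μ j * u j k) ≈ 0#)) →
          ∃ λ (μ : Fin n → Carrier) → (μ i ≈ 0#) × (∀ j → 0# ≤ μ j) × (∑ μ ≈ 1#) × (∀ k → ∑ (λ j → μ j * v j k) ≈ v i k)
        normalised (μ , μi , μ≥0 , μ>0 , e) = let (s , se , s>0) = inv-pos μ>0 in scale s μ , trans (*-congˡ μi) (zeroʳ s) , (λ j → nonneg s>0 (μ≥0 j)) ,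
            trans (∑-scale s μ) (trans (*-comm s (∑ μ)) se) , λ k → begin
              ∑ (λ j → s * μ j * v j k) ≈⟨ ∑-cong (λ j → *-assoc s (μ j) (v j k)) ⟩
              ∑ (λ j → s * (μ j * v j k)) ≈⟨ ∑-scale s (λ j → μ j * v j k) ⟩
              s * ∑ (λ j → μ j * v j k) ≈⟨ *-congˡ (balance-at k) ⟩
              s * (∑ μ * v i k) ≈⟨ *-assoc s (∑ μ) (v i k) ⟨
              s * ∑ μ * v i k ≈⟨ *-congʳ (trans (*-comm s (∑ μ)) se) ⟩
              1# * v i k ≈⟨ *-identityˡ (v i k) ⟩
              v i k ∎
          where
          open Relation.Binary.Reasoning.Setoid setoid
          nonneg : ∀ {s x} → 0# < s → 0# ≤ x → 0# ≤ s * x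
          nonneg s>0 (inj₁ p) = inj₁ (*-pos s>0 p)
          nonneg {s} s>0 (inj₂ p) = inj₂ (trans (sym (zeroʳ s)) (*-congˡ p))
          balance-at : ∀ k → ∑ (λ j → μ j * v j k) ≈ ∑ μ * v i k
          balance-at k = begin
            ∑ (λ j → μ j * v j k)
              ≈⟨ ∑-cong (λ j → solve 3 (λ m x y → m :* y := x :* m :+ (:- con (1 , 0)) :* (m :* (con (1 , 0) :* x :+ (:- con (1 , 0)) :* y))) refl (μ j) (v i k) (v j k)) ⟩
            ∑ (lin (v i k) μ (- 1#) (λ j → μ j * u j k))
              ≈⟨ ∑-lin (v i k) μ (- 1#) (λ j → μ j * u j k) ⟩
            v i k * ∑ μ + - 1# * ∑ (λ j → μ j * u j k)
              ≈⟨ +-congˡ (*-congˡ (e k)) ⟩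
            v i k * ∑ μ + - 1# * 0#
              ≈⟨ solve 2 (λ x s → x :* s :+ (:- con (1 , 0)) :* con (0 , 0) := s :* x) refl (v i k) (∑ μ) ⟩
            ∑ μ * v i k ∎

    private
      others : ∀ {m} (w : Fin m → Point 7) (i : Fin m) → ∃ λ E → suc (rank E) ℕ.≤ m × (∀ {y} → Null y E → ∀ {j} → j ≢ i → y · w j ≈ 0#)
      others {suc m} w i = tabulate (w ∘ punchIn i) , ℕ.s≤s (rank-tabulate≤ m (w ∘ punchIn i)) ,
        λ {y} h {j} j≢i → ≡.subst (λ j → y · w j ≈ 0#) (FinP.punchIn-punchOut (j≢i ∘ ≡.sym)) (AllP.tabulate⁻ h (punchOut (j≢i ∘ ≡.sym)))

      nulls : ∀ {y} → Null y (vectors full) → Null y (tabulate w)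
      nulls {y} h = tabulate⁺ (λ i → null⁻ {y = y} h ∈⊤)

      rank-all : rank (tabulate w) ≡ ρ full
      rank-all = rank-cong (λ y h → null⁺ {y = y} (λ {i} _ → AllP.tabulate⁻ h i)) (λ y h → nulls {y} h)

      module _ (full-rank : rank (tabulate w) ≡ n) where
        -- If `w i` were in the span of the other vectors, these n - 1 vectors would have rank n.
        opposite : ∀ i → Dual (vectors (∁ ⁅ i ⁆)) (w i)
        opposite i = go (dual? (vectors (∁ ⁅ i ⁆)) (w i)) (others w i)
          where
          go : Dual (vectors (∁ ⁅ i ⁆)) (w i) ⊎ Kills (vectors (∁ ⁅ i ⁆)) (w i) →
               (∃ λ E → suc (rank E) ℕ.≤ n × (∀ {y} → Null y E → ∀ {j} → j ≢ i → y · w j ≈ 0#)) → Dual (vectors (∁ ⁅ i ⁆)) (w i)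
          go (inj₁ p) _ = p
          go (inj₂ k) (E , small , null) = contradiction (≡.subst (ℕ._≤ rank E) full-rank (rank-mono λ y h → tabulate⁺ {f = w} λ j → at y h j (j FinP.≟ i))) (ℕₚ.<⇒≱ small)
            where
            at : ∀ y → Null y E → ∀ j → Dec (j ≡ i) → y · w j ≈ 0#
            at y h j (no n) = null {y} h n
            at y h j (yes ≡.refl) = k y (null⁺ {y = y} λ {l} l∈ → null {y} h λ { ≡.refl → x∈∁p⇒x∉p l∈ (x∈⁅x⁆ i) })

        opposite-face : ∀ i → FaceBy (∁ ⁅ i ⁆)
        opposite-face i = let (y , h , e) = opposite i in y , null⁻ {y = y} h , λ {j} j∉ →
          >0-cong (trans (sym e) (reflexive (≡.cong (λ k → y · w k) (≡.sym (x∈⁅y⁆⇒x≡y i (decidable-stable (j ∈? ⁅ i ⁆) λ n → j∉ (x∉p⇒x∈∁p n))))))) 0<1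

        opposite-rank : ∀ i → suc (ρ (∁ ⁅ i ⁆)) ≡ ρ full
        opposite-rank i = ≡.trans (≡.sym (rank-dual {E = vectors (∁ ⁅ i ⁆)} {w i} (opposite i))) (rank-cong {E = w i ∷ vectors (∁ ⁅ i ⁆)} {vectors full}
          (λ { y (p ∷ h) → null⁺ {y = y} λ {j} _ → at y p h j (j FinP.≟ i) }) (λ y h → null⁻ {y = y} h ∈⊤ ∷ null⁺ {y = y} (λ _ → null⁻ {y = y} h ∈⊤)))
          where
          at : ∀ y → y · w i ≈ 0# → Null y (vectors (∁ ⁅ i ⁆)) → ∀ j → Dec (j ≡ i) → y · w j ≈ 0#
          at y p h j (yes ≡.refl) = p
          at y p h j (no n) = null⁻ {y = y} h (x∉p⇒x∈∁p λ j∈ → n (x∈⁅y⁆⇒x≡y i j∈))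

    module _ (convex : ConvexPosition v) (dim : HasDim v 6) where
      private
        ρ-full : ρ full ≡ 7
        ρ-full = affDim⇒ρ dim

      lattice : EulerianPoset
      lattice = poset ∅-face full-face ρ-full

      private
        module L = EulerianPoset lattice
        open Intervals lattice using () renaming (c to count)

        a : ℕ → ℕ
        a = count L.bot L.top

        ρ-single : ∀ i → ρ ⁅ i ⁆ ≡ 1
        ρ-single i = ℕₚ.≤-antisym (ℕₚ.≤-trans (rank-mono {E = w i ∷ []} λ { y (p ∷ []) → null⁺ {y = y} λ {j} j∈ → ≡.subst (λ j → y · w j ≈ 0#) (≡.sym (x∈⁅y⁆⇒x≡y i j∈)) p }) (rank-∷≤ (w i) []))
          (ℕₚ.≤-trans (ℕ.s≤s ℕ.z≤n) (ρ-strict ∅-face (λ p → contradiction p ∉⊥) λ e → ∉⊥ (≡.subst (i ∈ˢ_) (≡.sym e) (x∈⁅x⁆ i))))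

        rank-one : ∀ {S} → FaceBy S → ρ S ≡ 1 → ∃ λ i → S ≡ ⁅ i ⁆
        rank-one {S} f e = from (outside-element {∅} {S} λ S⊆∅ → case ≡.subst (ℕ._≤ 0) e (rank-mono {E = []} λ y _ → null⁺ {y = y} λ i∈ → contradiction (S⊆∅ i∈) ∉⊥) of λ ())
          where
          from : (∃ λ i → i ∈ˢ S × i ∉ˢ ∅) → ∃ λ i → S ≡ ⁅ i ⁆
          from (i , i∈ , _) = i , go (VecP.≡-dec BoolP._≟_ S ⁅ i ⁆)
            where
            go : Dec (S ≡ ⁅ i ⁆) → S ≡ ⁅ i ⁆
            go (yes p) = p
            go (no ne) = contradiction (ρ-strict (vertex-face convex i) (λ {j} j∈ → ≡.subst (_∈ˢ S) (≡.sym (x∈⁅y⁆⇒x≡y i j∈)) i∈) (ne ∘ ≡.sym))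
              (ℕₚ.≤⇒≯ (ℕₚ.≤-reflexive (≡.trans e (≡.sym (ρ-single i)))))

        singles-injective : ∀ {i j : Fin n} → ⁅ i ⁆ ≡ ⁅ j ⁆ → i ≡ j
        singles-injective {i} {j} e = x∈⁅y⁆⇒x≡y j (≡.subst (i ∈ˢ_) e (x∈⁅x⁆ i))

        length-map-allFin : ∀ {b} {B : Set b} (f : Fin n → B) → length (map f (allFin n)) ≡ n
        length-map-allFin f = ≡.trans (length-map f (allFin n)) (length-tabulate id)

        vertices : n ≡ a 1
        vertices = ≡.trans (≡.sym (length-map-allFin ⁅_⁆)) (count-faces ∅-face full-face ρ-full 1 (UniqueP.map⁺ singles-injective (UniqueP.allFin⁺ n))
          (λ S∈ → let (i , _ , e) = ∈-map⁻ ⁅_⁆ S∈ in ≡.subst (λ S → FaceBy S × ρ S ≡ 1) (≡.sym e) (vertex-face convex i , ρ-single i))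
          (λ f e → let (i , e′) = rank-one f e in ≡.subst (_∈ map ⁅_⁆ (allFin n)) (≡.sym e′) (∈-map⁺ ⁅_⁆ (∈-allFin i))))

        numFaces : ∀ {k m} → NumFaces v k m → m ≡ a (suc k)
        numFaces {k} (Ls , unique , len , iff) = ≡.trans (≡.sym len) (count-faces ∅-face full-face ρ-full (suc k) unique
          (λ {S} S∈ → isFace⁺ (Equivalence.from (iff S) S∈)) (λ {S} f e → Equivalence.to (iff S) (isFace⁻ f e)))

        -- The facets of a simplex are exactly the complements of its vertices.
        simplex⇒7 : IsSimplex v → a 6 ≡ a 1
        simplex⇒7 ind = ≡.trans (≡.sym (≡.trans (≡.sym (length-map-allFin (∁ ∘ ⁅_⁆))) (count-faces ∅-face full-face ρ-full 6
            (UniqueP.map⁺ complement-injective (UniqueP.allFin⁺ n))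
            (λ S∈ → let (i , _ , e) = ∈-map⁻ (∁ ∘ ⁅_⁆) S∈ in ≡.subst (λ S → FaceBy S × ρ S ≡ 6) (≡.sym e) (opposite-face r i , six i))
            (λ f e → let (i , e′) = corank-one f e in ≡.subst (_∈ map (∁ ∘ ⁅_⁆) (allFin n)) (≡.sym e′) (∈-map⁺ (∁ ∘ ⁅_⁆) (∈-allFin i)))))) vertices
          where
          r : rank (tabulate w) ≡ n
          r = independent⇒rank n w (independent⁺ v ind)
          six : ∀ i → ρ (∁ ⁅ i ⁆) ≡ 6
          six i = ℕₚ.suc-injective (≡.trans (opposite-rank r i) ρ-full)
          complement-injective : ∀ {i j : Fin n} → ∁ ⁅ i ⁆ ≡ ∁ ⁅ j ⁆ → i ≡ j
          complement-injective {i} {j} e = decidable-stable (i FinP.≟ j) λ ne →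
            x∈∁p⇒x∉p (≡.subst (i ∈ˢ_) (≡.sym e) (x∉p⇒x∈∁p λ i∈ → ne (x∈⁅y⁆⇒x≡y j i∈))) (x∈⁅x⁆ i)
          -- A facet misses some vertex i, so it lies in the complement of i, which is a face of the
          -- same rank.
          corank-one : ∀ {S} → FaceBy S → ρ S ≡ 6 → ∃ λ i → S ≡ ∁ ⁅ i ⁆
          corank-one {S} f e = from (outside-element {S} {full} λ full⊆S → ℕₚ.<⇒≱ (ℕₚ.n<1+n 6) (≡.subst₂ ℕ._≤_ ρ-full e (ρ-mono full⊆S)))
            where
            from : (∃ λ i → i ∈ˢ full × i ∉ˢ S) → ∃ λ i → S ≡ ∁ ⁅ i ⁆
            from (i , _ , i∉) = i , go (VecP.≡-dec BoolP._≟_ S (∁ ⁅ i ⁆))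
              where
              go : Dec (S ≡ ∁ ⁅ i ⁆) → S ≡ ∁ ⁅ i ⁆
              go (yes p) = p
              go (no ne) = contradiction (ρ-strict f (λ {j} j∈ → x∉p⇒x∈∁p λ j∈i → i∉ (≡.subst (_∈ˢ S) (x∈⁅y⁆⇒x≡y i j∈i) j∈)) ne)
                (ℕₚ.≤⇒≯ (ℕₚ.≤-reflexive (≡.trans (six i) (≡.sym e))))

        7⇒simplex : a 1 ≡ 7 → IsSimplex v
        7⇒simplex e = independent⁻ v (rank⇒independent n w (≡.trans rank-all (≡.trans ρ-full (≡.trans (≡.sym e) (≡.sym vertices)))))

        neighborly : TwoNeighborly v → Neighborly lattice
        neighborly tn {x} {y} hx hy x≢y = from (isFace⁺ (tn (el x) (el y) (isFace⁻ (el-face x) hx) (isFace⁻ (el-face y) hy) (x≢y ∘ el-injective)))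
          where
          from : FaceBy (el x ∪ el y) × ρ (el x ∪ el y) ≡ 2 → ∃ λ e → ρ (el e) ≡ 2 × el x ⊆ el e × el y ⊆ el e
          from (f , r) = let (e , ee) = index f in e , ≡.trans (≡.cong ρ ee) r ,
            (λ {i} i∈ → ≡.subst (i ∈ˢ_) (≡.sym ee) (x∈p∪q⁺ (inj₁ i∈))) , (λ {i} i∈ → ≡.subst (i ∈ˢ_) (≡.sym ee) (x∈p∪q⁺ (inj₂ i∈)))

        undual : ∀ {r k} → r ℕ.≤ 7 → 7 ℕ.∸ r ≡ k → r ≡ 7 ℕ.∸ k
        undual h e = ≡.trans (≡.sym (ℕₚ.m∸[m∸n]≡n h)) (≡.cong (7 ℕ.∸_) e)

        ρ≤7 : ∀ S → ρ S ℕ.≤ 7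
        ρ≤7 = ρ≤7′ ∅-face full-face ρ-full

        dual⁺ : DualTwoNeighborly v 6 → Neighborly (Dual.op lattice)
        dual⁺ dtn {x} {y} hx hy x≢y = from (isFace⁺ (dtn (el x) (el y) (isFace⁻ (el-face x) (undual (ρ≤7 (el x)) hx)) (isFace⁻ (el-face y) (undual (ρ≤7 (el y)) hy)) (x≢y ∘ el-injective)))
          where
          from : FaceBy (el x ∩ el y) × ρ (el x ∩ el y) ≡ 5 → ∃ λ e → 7 ℕ.∸ ρ (el e) ≡ 2 × el e ⊆ el x × el e ⊆ el y
          from (f , r) = let (e , ee) = index f in e , ≡.cong (7 ℕ.∸_) (≡.trans (≡.cong ρ ee) r) ,
            (λ {i} i∈ → p∩q⊆p (el x) (el y) (≡.subst (i ∈ˢ_) ee i∈)) , (λ {i} i∈ → p∩q⊆q (el x) (el y) (≡.subst (i ∈ˢ_) ee i∈))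

        -- The element joining the two facets in the dual has rank 5 and lies in `S ∩ T`, which is a
        -- proper face of `S`; so the intersection has rank exactly 5.
        dual⁻ : Neighborly (Dual.op lattice) → DualTwoNeighborly v 6
        dual⁻ conb S T hS hT S≢T = isFace⁻ ST-face (ℕₚ.≤-antisym (ℕₚ.≤-pred (≡.subst (ρ (S ∩ T) ℕ.<_) rS (ρ-strict ST-face (p∩q⊆p S T) ST≢S))) (from (conb {x} {y} hx hy x≢y)))
          where
          fS = proj₁ (isFace⁺ hS)
          rS = proj₂ (isFace⁺ hS)
          fT = proj₁ (isFace⁺ hT)
          rT = proj₂ (isFace⁺ hT)
          ST-face : FaceBy (S ∩ T)
          ST-face = ∩-face fS fT
          x y : Fin L.N
          x = proj₁ (index fS)
          y = proj₁ (index fT)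
          ex : el x ≡ S
          ex = proj₂ (index fS)
          ey : el y ≡ T
          ey = proj₂ (index fT)
          hx : 7 ℕ.∸ ρ (el x) ≡ 1
          hx = ≡.cong (7 ℕ.∸_) (≡.trans (≡.cong ρ ex) rS)
          hy : 7 ℕ.∸ ρ (el y) ≡ 1
          hy = ≡.cong (7 ℕ.∸_) (≡.trans (≡.cong ρ ey) rT)
          x≢y : x ≢ y
          x≢y e = S≢T (≡.trans (≡.sym ex) (≡.trans (≡.cong el e) ey))
          ST≢S : S ∩ T ≢ S
          ST≢S e = ℕₚ.<-irrefl (≡.trans rS (≡.sym rT)) (ρ-strict fS (λ {i} i∈ → p∩q⊆q S T (≡.subst (i ∈ˢ_) (≡.sym e) i∈)) S≢T)
          from : (∃ λ e → 7 ℕ.∸ ρ (el e) ≡ 2 × el e ⊆ el x × el e ⊆ el y) → 5 ℕ.≤ ρ (S ∩ T)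
          from (e , he , ex′ , ey′) = ≡.subst (ℕ._≤ ρ (S ∩ T)) (undual (ρ≤7 (el e)) he)
            (ρ-mono λ {i} i∈ → x∈p∩q⁺ (≡.subst (i ∈ˢ_) ex (ex′ i∈) , ≡.subst (i ∈ˢ_) ey (ey′ i∈)))

        seven-or-large : Neighborly lattice → Neighborly (Dual.op lattice) → a 1 ≡ 7 ⊎ 27 ℕ.≤ a 1
        seven-or-large nb conb = Packing.atoms-7∨27≤ lattice nb conb (meetᶠ ∅-face full-face ρ-full)
          (λ x y i∈ → proj₁ (meet-lower ∅-face full-face ρ-full x y i∈)) (λ x y i∈ → proj₂ (meet-lower ∅-face full-face ρ-full x y i∈))
          (λ {x} {y} {z} p q → meet-greatest ∅-face full-face ρ-full x y {z} p q)

      facets≥vertices : TwoNeighborly v → ∀ {f₀ f₅} → NumFaces v 0 f₀ → NumFaces v 5 f₅ →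
                        f₀ ℕ.≤ f₅ × ((f₅ ≡ f₀) ⇔ (IsSimplex v ⊎ (DualTwoNeighborly v 6 × 27 ℕ.≤ f₀)))
      facets≥vertices tn {f₀} {f₅} n₀ n₅ = ≡.subst₂ (λ p q → p ℕ.≤ q × ((q ≡ p) ⇔ (IsSimplex v ⊎ (DualTwoNeighborly v 6 × 27 ℕ.≤ p))))
          (≡.sym (numFaces n₀)) (≡.sym (numFaces n₅))
          (atoms≤coatoms lattice nb , mk⇔ to from)
        where
        nb : Neighborly lattice
        nb = neighborly tn
        to : a 6 ≡ a 1 → IsSimplex v ⊎ (DualTwoNeighborly v 6 × 27 ℕ.≤ a 1)
        to e = go (seven-or-large nb conb)
          where
          conb : Neighborly (Dual.op lattice)
          conb = equal⇒dual lattice nb e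
          go : a 1 ≡ 7 ⊎ 27 ℕ.≤ a 1 → IsSimplex v ⊎ (DualTwoNeighborly v 6 × 27 ℕ.≤ a 1)
          go (inj₁ h) = inj₁ (7⇒simplex h)
          go (inj₂ h) = inj₂ (dual⁻ conb , h)
        from : IsSimplex v ⊎ (DualTwoNeighborly v 6 × 27 ℕ.≤ a 1) → a 6 ≡ a 1
        from (inj₁ s) = simplex⇒7 s
        from (inj₂ (d , _)) = dual⇒equal lattice nb (dual⁺ d)

open import Level using (Level)
open import Data.Nat using (ℕ; _≤_)
open import Data.Fin using (Fin)
open import Data.Product using (_×_)
open import Data.Sum using (_⊎_)
open import Relation.Binary.PropositionalEquality using (_≡_)
open import Function.Bundles using (_⇔_)

theorem5 : ∀ {c ℓ₁ ℓ₂ : Level} (F : OrderedField c ℓ₁ ℓ₂) →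
    let open Polytopes F in
    (n : ℕ) (v : Fin n → Point 6) →
    ConvexPosition v → HasDim v 6 → TwoNeighborly v →
    (f₀ f₅ : ℕ) → NumFaces v 0 f₀ → NumFaces v 5 f₅ →
    (f₀ ≤ f₅) ×
    ((f₅ ≡ f₀) ⇔ (IsSimplex v ⊎ (DualTwoNeighborly v 6 × 27 ≤ f₀)))
theorem5 F n v convex dim neighborly f₀ f₅ n₀ n₅ =
  Geometry.SixPolytope.facets≥vertices F v convex dim neighborly n₀ n₅
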